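{- Let $\mathcal{F}$ be a finite family of binary matrices that is closed under row permutations. There exists a polynomial $p$ (depending only on $\mathcal{F}$) such that for every $\epsilon > 0$, with $\delta = 1/p(\epsilon^{ -1})$, every $n \times n$ binary matrix that is $\epsilon$-far from $\mathcal{F}$-freeness contains at least $\delta n^{s+t}$ copies of some $s \times t$ matrix $A \in \mathcal{F}$.
   Context: A matrix $M:[m]\times[n]\to\{0,1\}$ is binary. A submatrix is obtained by deleting rows and columns while preserving the row and column order; a copy of an $s\times t$ matrix $A$ in $M$ is an $s\times t$ submatrix of $M$ equal to $A$. $M$ is $\mathcal{F}$-free if it contains no copy of any matrix of $\mathcal{F}$. An $n\times n$ matrix is $\epsilon$-far from $\mathcal{F}$-freeness if one must change at least $\epsilon n^2$ of its entries to obtain an $\mathcal{F}$-free matrix. $\mathcal{F}$ is closed under row permutations if for every $A\in\mathcal{F}$, every matrix obtained by permuting the rows of $A$ is also in $\mathcal{F}$. -}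

module Defs where

open import Data.Bool using (Bool)
import Data.Bool.Properties as Bool
open import Data.Fin using (Fin; _<_)
open import Data.Fin.Permutation using (Permutation′; _⟨$⟩ʳ_)
import Data.Fin.Properties as Fin
open import Data.Integer using (+_)
open import Data.List using (List; []; _∷_; allFin; cartesianProduct; cartesianProductWith; filter; foldr; length)
open import Data.List.Membership.Propositional using (_∈_)
open import Data.Nat using (ℕ; zero; suc; _^_)
open import Data.Product using (∃; ∃₂; _×_; _,_)
open import Data.Rational using (ℚ; 0ℚ; Positive; 1/_; _/_; _+_; _*_; _≤_)
open import Data.Rational.Properties using (pos⇒nonZero)
open import Data.Vec as Vec using (Vec; []; _∷_; lookup; tabulate)
open import Data.Vec.Properties using (≡-dec)
open import Data.Vec.Relation.Unary.Linked using (Linked; linked?)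
open import Relation.Binary.PropositionalEquality using (_≡_)
open import Relation.Nullary using (¬_; Dec; ¬?; _×-dec_)

-- An m × n matrix is the vector of its m rows.
Matrix : ℕ → ℕ → Set
Matrix m n = Vec (Vec Bool n) m

entry : ∀ {m n} → Matrix m n → Fin m → Fin n → Bool
entry M i j = lookup (lookup M i) j

submatrix : ∀ {m n s t} → Matrix m n → Vec (Fin m) s → Vec (Fin n) t → Matrix s t
submatrix M rows cols = Vec.map (λ i → Vec.map (entry M i) cols) rows

-- A copy is the choice of the rows and columns that are kept, each listed in
-- increasing order, so distinct pairs are distinct submatrices.
IsCopy : ∀ {m n s t} → Matrix s t → Matrix m n → Vec (Fin m) s × Vec (Fin n) t → Set
IsCopy A M (rows , cols) = Linked _<_ rows × Linked _<_ cols × submatrix M rows cols ≡ A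

isCopy? : ∀ {m n s t} (A : Matrix s t) (M : Matrix m n) rc → Dec (IsCopy A M rc)
isCopy? A M (rows , cols) =
  linked? Fin._<?_ rows ×-dec linked? Fin._<?_ cols ×-dec
  ≡-dec (≡-dec Bool._≟_) (submatrix M rows cols) A

-- All of Fin n ^ k, each tuple once.
tuples : ∀ n k → List (Vec (Fin n) k)
tuples n zero    = [] ∷ []
tuples n (suc k) = cartesianProductWith _∷_ (allFin n) (tuples n k)

#copies : ∀ {m n s t} → Matrix s t → Matrix m n → ℕ
#copies {m} {n} {s} {t} A M =
  length (filter (isCopy? A M) (cartesianProduct (tuples m s) (tuples n t)))

Family : Set
Family = List (∃₂ Matrix)

Free : ∀ {m n} → Family → Matrix m n → Set
Free F M = ∀ {s t} (A : Matrix s t) → (s , t , A) ∈ F → ¬ ∃ (IsCopy A M)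

permuteRows : ∀ {s t} → Permutation′ s → Matrix s t → Matrix s t
permuteRows π A = tabulate λ i → lookup A (π ⟨$⟩ʳ i)

ClosedUnderRowPermutations : Family → Set
ClosedUnderRowPermutations F =
  ∀ {s t} (A : Matrix s t) → (s , t , A) ∈ F →
  ∀ (π : Permutation′ s) → (s , t , permuteRows π A) ∈ F

#changes : ∀ {m n} → Matrix m n → Matrix m n → ℕ
#changes {m} {n} M N =
  length (filter (λ (i , j) → ¬? (entry M i j Bool.≟ entry N i j))
                 (cartesianProduct (allFin m) (allFin n)))

toℚ : ℕ → ℚ
toℚ k = + k / 1

-- Holds for every ε when no n × n matrix is F-free.
Far : ∀ {n} → ℚ → Family → Matrix n n → Set
Far {n} ε F M = ∀ N → Free F N → ε * toℚ (n ^ 2) ≤ toℚ (#changes M N)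

-- Coefficients, constant term first.
Polynomial : Set
Polynomial = List ℚ

eval : Polynomial → ℚ → ℚ
eval p x = foldr (λ a v → a + x * v) 0ℚ p

inverse : (q : ℚ) → .{{Positive q}} → ℚ
inverse q = (1/ q) {{pos⇒nonZero q}}

{-# OPTIONS --safe #-}
module Submission where

-- Call two rows close if they differ in few columns, and a row dense if many rows are
-- close to it; all thresholds below are fractions polynomial in ε.
--
-- If many rows are not dense, sample q columns at random.  Rows that are far apart
-- rarely agree on the sample, so the sparse rows show many patterns on it, even after
-- removing the rare ones, and by Sauer–Shelah they shatter t of the sampled columns.
-- Hence a large fraction of the t-tuples of columns carries all 2 ^ t patterns, each on
-- a large fraction of the rows, which gives many copies of any s × t matrix of F up to
-- the order of its rows.
--
-- Otherwise replace each row by one of r representatives with pairwise disjoint balls.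
-- Density at a much finer scale than 1 / r makes each representative agree, on all but
-- few columns, with most of the rows in its own small ball.  A matrix A of F and a choice
-- of representatives for its rows turn the copies into increasing column sequences, the
-- k-th column of which lies in a given set.  Either there are many such sequences, hence
-- many copies of row permutations of A, or few columns meet all weakly increasing ones.
-- If the latter holds for all choices, replacing the columns that were hit or are
-- inaccurate by remaining neighbours, monotonically, gives an F-free matrix near M.

-- Thresholds are integers standing for reciprocals: `T` for a distance n / T, `H` for a density 1 /
-- H, `Θ` for a frequency 1 / Θ. The argument runs with e = 8E, where E ≥ 1 / ε. The cleaned matrix
-- differs from M in at most 6n² / e entries, fewer than the 8n² / e that farness demands: 2n² / e
-- each for the sparse rows, the replaced columns and the distances to the representatives. That all
-- bounds are polynomial rests on two points. Rows that shatter no t of the q sampled columns show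
-- at most (q + 1)^t patterns, while the chance that two far rows agree on the sample decays
-- exponentially in q; so a polynomial q suffices although Θ depends on q. Moreover, the density
-- parameter grows as the distance shrinks, so one scale cannot serve both purposes: the coarse
-- scale fixes the number of representatives, the fine scale is chosen afterwards to survive a union
-- bound over them, and its density parameter does not feed back into their number. Closure under
-- row permutations frees the order of rows but not that of columns, whence the increasing sequences
-- and the monotone replacement.

module NaturalBound where

  open import Data.Bool using (Bool; true; false)
  import Data.Bool.Properties as Bool
  open import Data.Empty using (⊥-elim)
  open import Data.Fin as Fin using (Fin; zero; suc; toℕ)
  open import Data.Fin.Permutation using (Permutation′; _⟨$⟩ʳ_; insert)
  import Data.Fin.Permutation as Perm
  import Data.Fin.Properties as Fin
  open import Data.List as List using (List; []; _∷_; _++_; allFin; cartesianProduct; cartesianProductWith; filter; length)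
  open import Data.List.Membership.Propositional using (_∈_; find; lose)
  open import Data.List.Membership.Propositional.Properties using (∈-allFin; ∈-cartesianProduct⁺; ∈-cartesianProductWith⁺; ∈-++⁺ˡ; ∈-++⁺ʳ; ∈-filter⁺; ∈-filter⁻; ∈-lookup; ∈-map⁺)
  open import Data.List.Properties using (length-++; length-map; length-tabulate)
  open import Data.List.Relation.Binary.Subset.Propositional using (_⊆_)
  import Data.List.Relation.Unary.All as ListAll
  import Data.List.Relation.Unary.All.Properties as ListAll
  import Data.List.Relation.Unary.AllPairs as ListAllPairs
  open ListAllPairs using ([]; _∷_)
  open import Data.List.Relation.Unary.Any as Any using (here; there; any?; satisfied)
  import Data.List.Relation.Unary.Any.Properties as Any
  import Data.List.Relation.Unary.Unique.Propositional as ListUnique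
  import Data.List.Relation.Unary.Unique.Propositional.Properties as ListUnique
  open import Data.Nat using (ℕ; zero; suc; _+_; _*_; _^_; _!; _≤_; _<_; _<?_; _≤?_; z≤n; s≤s; NonZero; >-nonZero)
  open import Data.Nat.DivMod using (_/_; _%_; m≡m%n+[m/n]*n; m%n<n; m/n*n≤m; m≥n⇒m/n>0)
  open import Data.Nat.Properties
  open import Algebra.Properties.CommutativeSemigroup +-commutativeSemigroup using (interchange)
  open import Data.Nat.Tactic.RingSolver using (solve-∀)
  open import Data.Product using (Σ-syntax; ∃-syntax; _×_; _,_; proj₁; proj₂)
  open import Data.Sum as Sum using (_⊎_; inj₁; inj₂)
  open import Data.Unit using (⊤; tt)
  open import Data.Vec as Vec using (Vec; []; _∷_; insertAt; removeAt; lookup; tabulate)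
  import Data.Vec.Properties as Vec
  open import Data.Vec.Relation.Unary.All as All using (All; []; _∷_)
  open import Data.Vec.Relation.Unary.AllPairs using ([]; _∷_; allPairs?)
  open import Data.Vec.Relation.Unary.Linked using (Linked; []; [-]; _∷_; linked?)
  open import Data.Vec.Relation.Unary.Unique.Propositional using (Unique)
  import Data.Vec.Relation.Unary.Unique.Propositional.Properties as VecUnique
  open import Relation.Binary.Definitions using (DecidableEquality; tri<; tri≈; tri>)
  open import Relation.Binary.PropositionalEquality using (_≡_; _≢_; refl; sym; trans; cong; cong₂; subst)
  open import Relation.Nullary using (¬_; Dec; yes; no; does; ¬?; _×-dec_; _⊎-dec_; contradiction)
  open import Relation.Nullary.Decidable using (decidable-stable; dec-false; dec-true; map′)
  open import Defs

  open ≤-Reasoning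

  -- Sums over lists

  ∑ : {X : Set} → List X → (X → ℕ) → ℕ
  ∑ []       f = 0
  ∑ (x ∷ xs) f = f x + ∑ xs f

  infixr 8 ∑
  syntax ∑ xs (λ x → e) = ∑[ x ∈ xs ] e

  ⟦_⟧ : {P : Set} → Dec P → ℕ
  ⟦ yes _ ⟧ = 1
  ⟦ no  _ ⟧ = 0

  ⟦⟧-yes : {P : Set} (P? : Dec P) → P → ⟦ P? ⟧ ≡ 1
  ⟦⟧-yes (yes _) _ = refl
  ⟦⟧-yes (no ¬p) p = contradiction p ¬p

  ⟦⟧-no : {P : Set} (P? : Dec P) → ¬ P → ⟦ P? ⟧ ≡ 0
  ⟦⟧-no (yes p) ¬p = contradiction p ¬p
  ⟦⟧-no (no _)  _  = refl

  ⟦⟧≤1 : {P : Set} (P? : Dec P) → ⟦ P? ⟧ ≤ 1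
  ⟦⟧≤1 (yes _) = ≤-refl
  ⟦⟧≤1 (no _)  = z≤n

  ⟦⟧-≤ : {P : Set} {m : ℕ} (P? : Dec P) → (P → 1 ≤ m) → ⟦ P? ⟧ ≤ m
  ⟦⟧-≤ (yes p) f = f p
  ⟦⟧-≤ (no _)  _ = z≤n

  ⟦⟧-mono : {P Q : Set} (P? : Dec P) (Q? : Dec Q) → (P → Q) → ⟦ P? ⟧ ≤ ⟦ Q? ⟧
  ⟦⟧-mono P? Q? f = ⟦⟧-≤ P? λ p → ≤-reflexive (sym (⟦⟧-yes Q? (f p)))

  ⟦⟧-× : {P Q : Set} (P? : Dec P) (Q? : Dec Q) → ⟦ P? ×-dec Q? ⟧ ≡ ⟦ P? ⟧ * ⟦ Q? ⟧
  ⟦⟧-× (yes _) (yes _) = refl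
  ⟦⟧-× (yes _) (no _)  = refl
  ⟦⟧-× (no _)  _       = refl

  ⟦⟧-* : {P : Set} {a b : ℕ} (P? : Dec P) → (P → a ≤ b) → ⟦ P? ⟧ * a ≤ ⟦ P? ⟧ * b
  ⟦⟧-* (yes p) f = +-monoˡ-≤ 0 (f p)
  ⟦⟧-* (no _)  _ = z≤n

  ⟦⟧-¬ : {P : Set} (P? : Dec P) → ⟦ P? ⟧ + ⟦ ¬? P? ⟧ ≡ 1
  ⟦⟧-¬ (yes _) = refl
  ⟦⟧-¬ (no _)  = refl

  module _ {X : Set} where

    ∑-mono : ∀ (xs : List X) {f g} → (∀ x → x ∈ xs → f x ≤ g x) → ∑ xs f ≤ ∑ xs g
    ∑-mono []       _ = z≤n
    ∑-mono (x ∷ xs) h = +-mono-≤ (h x (here refl)) (∑-mono xs λ y y∈ → h y (there y∈))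

    ∑-mono′ : ∀ (xs : List X) {f g} → (∀ x → f x ≤ g x) → ∑ xs f ≤ ∑ xs g
    ∑-mono′ xs h = ∑-mono xs λ x _ → h x

    ∑-cong : ∀ (xs : List X) {f g} → (∀ x → f x ≡ g x) → ∑ xs f ≡ ∑ xs g
    ∑-cong []       _ = refl
    ∑-cong (x ∷ xs) h = cong₂ _+_ (h x) (∑-cong xs h)

    ∑-+ : ∀ (xs : List X) f g → ∑[ x ∈ xs ] (f x + g x) ≡ ∑ xs f + ∑ xs g
    ∑-+ []       f g = refl
    ∑-+ (x ∷ xs) f g rewrite ∑-+ xs f g = interchange (f x) (g x) (∑ xs f) (∑ xs g)

    ∑-*ˡ : ∀ (xs : List X) c f → ∑[ x ∈ xs ] (c * f x) ≡ c * ∑ xs f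
    ∑-*ˡ []       c f = sym (*-zeroʳ c)
    ∑-*ˡ (x ∷ xs) c f rewrite ∑-*ˡ xs c f = sym (*-distribˡ-+ c (f x) (∑ xs f))

    ∑-*ʳ : ∀ (xs : List X) c f → ∑[ x ∈ xs ] (f x * c) ≡ ∑ xs f * c
    ∑-*ʳ []       c f = refl
    ∑-*ʳ (x ∷ xs) c f rewrite ∑-*ʳ xs c f = sym (*-distribʳ-+ c (f x) (∑ xs f))

    ∑-const : ∀ (xs : List X) c → ∑[ _ ∈ xs ] c ≡ length xs * c
    ∑-const []       c = refl
    ∑-const (x ∷ xs) c = cong (c +_) (∑-const xs c)

    ∑-≤-const : ∀ (xs : List X) {f c} → (∀ x → x ∈ xs → f x ≤ c) → ∑ xs f ≤ length xs * c
    ∑-≤-const xs {f} {c} h = subst (∑ xs f ≤_) (∑-const xs c) (∑-mono xs h)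

    ∑-const-≤ : ∀ (xs : List X) {f c} → (∀ x → x ∈ xs → c ≤ f x) → length xs * c ≤ ∑ xs f
    ∑-const-≤ xs {f} {c} h = subst (_≤ ∑ xs f) (∑-const xs c) (∑-mono xs h)

    ∑-∈ : ∀ {xs : List X} {x} f → x ∈ xs → f x ≤ ∑ xs f
    ∑-∈ f (here refl) = m≤m+n _ _
    ∑-∈ f (there x∈)  = ≤-trans (∑-∈ f x∈) (m≤n+m _ _)

    ∑-++ : ∀ (xs ys : List X) f → ∑ (xs ++ ys) f ≡ ∑ xs f + ∑ ys f
    ∑-++ []       ys f = refl
    ∑-++ (x ∷ xs) ys f rewrite ∑-++ xs ys f = sym (+-assoc (f x) _ _)

    ∑-< : ∀ (xs : List X) {f c} → ∑ xs f < length xs * c → ∃[ x ] f x < c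
    ∑-< (x ∷ xs) {f} {c} h with f x <? c
    ... | yes fx<c = x , fx<c
    ... | no  fx≮c = ∑-< xs (+-cancelˡ-< c _ _ (<-≤-trans (s≤s (+-monoˡ-≤ _ (≮⇒≥ fx≮c))) h))

    length-filter : ∀ {P : X → Set} (P? : ∀ x → Dec (P x)) xs →
                    length (filter P? xs) ≡ ∑[ x ∈ xs ] ⟦ P? x ⟧
    length-filter P? []       = refl
    length-filter P? (x ∷ xs) with P? x
    ... | yes _ = cong suc (length-filter P? xs)
    ... | no  _ = length-filter P? xs

    ∑-⟦⟧≤length : ∀ {P : X → Set} (P? : ∀ x → Dec (P x)) xs → ∑[ x ∈ xs ] ⟦ P? x ⟧ ≤ length xs
    ∑-⟦⟧≤length P? xs = ≤-trans (∑-≤-const xs λ x _ → ⟦⟧≤1 (P? x)) (≤-reflexive (*-identityʳ _))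

    ∑-swap : ∀ {Y : Set} (xs : List X) (ys : List Y) (f : X → Y → ℕ) →
             ∑[ x ∈ xs ] ∑[ y ∈ ys ] f x y ≡ ∑[ y ∈ ys ] ∑[ x ∈ xs ] f x y
    ∑-swap xs []       f = trans (∑-const xs 0) (*-zeroʳ (length xs))
    ∑-swap xs (y ∷ ys) f =
      trans (∑-+ xs (λ x → f x y) (λ x → ∑ ys (f x))) (cong (_ +_) (∑-swap xs ys f))

    -- Serves two kinds of disjointness: distinctness of list elements, and disjointness of the
    -- balls around representatives.
    ∑-AllPairs : ∀ {P : X → Set} {S : X → X → Set} (P? : ∀ x → Dec (P x)) {xs} → ListAllPairs.AllPairs S xs →
                 (∀ {x y} → P x → P y → ¬ S x y) → ∑[ x ∈ xs ] ⟦ P? x ⟧ ≤ 1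
    ∑-AllPairs P? []                   h = z≤n
    ∑-AllPairs P? {x ∷ xs} (Sxs ∷ Ss) h with P? x
    ... | no  _  = ∑-AllPairs P? Ss h
    ... | yes px = s≤s (≤-trans
      (∑-≤-const xs λ y y∈ → ≤-reflexive (⟦⟧-no (P? y) λ py → h px py (ListAll.lookup Sxs y∈)))
      (≤-reflexive (*-zeroʳ (length xs))))

    ∑-Unique : ∀ {P : X → Set} (P? : ∀ x → Dec (P x)) {xs} → ListUnique.Unique xs →
               (∀ {x y} → P x → P y → x ≡ y) → ∑[ x ∈ xs ] ⟦ P? x ⟧ ≤ 1
    ∑-Unique P? uq h = ∑-AllPairs P? uq λ px py x≢y → x≢y (h px py)

  ∑-map : ∀ {X Y : Set} (g : X → Y) xs f → ∑ (List.map g xs) f ≡ ∑[ x ∈ xs ] f (g x)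
  ∑-map g []       f = refl
  ∑-map g (x ∷ xs) f = cong (f (g x) +_) (∑-map g xs f)

  ∑-cartesianProductWith : ∀ {X Y Z : Set} (g : X → Y → Z) xs ys f →
    ∑ (cartesianProductWith g xs ys) f ≡ ∑[ x ∈ xs ] ∑[ y ∈ ys ] f (g x y)
  ∑-cartesianProductWith g []       ys f = refl
  ∑-cartesianProductWith g (x ∷ xs) ys f =
    trans (∑-++ (List.map (g x) ys) _ f) (cong₂ _+_ (∑-map (g x) ys f) (∑-cartesianProductWith g xs ys f))

  -- Fibre counting: the indicator of `g x ≡ y` is inserted, the sums are exchanged, and each fibre
  -- of g has at most one element.
  ∑-injective : ∀ {X Y : Set} (_≟_ : DecidableEquality Y) (g : X → Y) → (∀ {x y} → g x ≡ g y → x ≡ y) →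
                ∀ {xs ys} → ListUnique.Unique xs → (∀ x → g x ∈ ys) → ∀ f → ∑[ x ∈ xs ] f (g x) ≤ ∑ ys f
  ∑-injective _≟_ g inj {xs} {ys} uq g∈ f = begin
    ∑[ x ∈ xs ] f (g x)                             ≤⟨ ∑-mono′ xs (λ x → ≤-trans
        (≤-reflexive (sym (trans (cong (_* f (g x)) (⟦⟧-yes (g x ≟ g x) refl)) (*-identityˡ _))))
        (∑-∈ (λ y → ⟦ g x ≟ y ⟧ * f y) (g∈ x))) ⟩
    ∑[ x ∈ xs ] ∑[ y ∈ ys ] (⟦ g x ≟ y ⟧ * f y)     ≡⟨ ∑-swap xs ys (λ x y → ⟦ g x ≟ y ⟧ * f y) ⟩
    ∑[ y ∈ ys ] ∑[ x ∈ xs ] (⟦ g x ≟ y ⟧ * f y)     ≡⟨ ∑-cong ys (λ y → ∑-*ʳ xs (f y) _) ⟩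
    ∑[ y ∈ ys ] ((∑[ x ∈ xs ] ⟦ g x ≟ y ⟧) * f y)   ≤⟨ ∑-mono′ ys (λ y → *-monoˡ-≤ (f y)
        (∑-Unique (λ x → g x ≟ y) uq (λ p q → inj (trans p (sym q))))) ⟩
    ∑[ y ∈ ys ] (1 * f y)                           ≡⟨ ∑-cong ys (λ y → *-identityˡ (f y)) ⟩
    ∑ ys f                                          ∎

  length-cartesianProductWith : ∀ {X Y Z : Set} (g : X → Y → Z) xs ys →
    length (cartesianProductWith g xs ys) ≡ length xs * length ys
  length-cartesianProductWith g xs ys = begin-equality
    length (cartesianProductWith g xs ys)          ≡⟨ length≡∑ (cartesianProductWith g xs ys) ⟩
    ∑[ _ ∈ cartesianProductWith g xs ys ] 1        ≡⟨ ∑-cartesianProductWith g xs ys _ ⟩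
    ∑[ _ ∈ xs ] ∑[ _ ∈ ys ] 1                      ≡⟨ ∑-const xs _ ⟩
    length xs * ∑[ _ ∈ ys ] 1                      ≡⟨ cong (length xs *_) (length≡∑ ys) ⟨
    length xs * length ys                          ∎
    where
    length≡∑ : ∀ {X : Set} (xs : List X) → length xs ≡ ∑[ _ ∈ xs ] 1
    length≡∑ xs = sym (trans (∑-const xs 1) (*-identityʳ _))

  length-allFin : ∀ n → length (allFin n) ≡ n
  length-allFin n = length-tabulate {n = n} _

  tuples-Unique : ∀ n k → ListUnique.Unique (tuples n k)
  tuples-Unique n zero    = ListAll.[] ∷ []
  tuples-Unique n (suc k) =
    ListUnique.cartesianProductWith⁺ _∷_ Vec.∷-injective (ListUnique.allFin⁺ n) (tuples-Unique n k)

  ∈-tuples : ∀ {n k} (v : Vec (Fin n) k) → v ∈ tuples n k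
  ∈-tuples []      = here refl
  ∈-tuples (x ∷ v) = ∈-cartesianProductWith⁺ _∷_ (∈-allFin x) (∈-tuples v)

  length-tuples : ∀ n k → length (tuples n k) ≡ n ^ k
  length-tuples n zero    = refl
  length-tuples n (suc k) =
    trans (length-cartesianProductWith _∷_ (allFin n) (tuples n k)) (cong₂ _*_ (length-allFin n) (length-tuples n k))

  ∑-tuples : ∀ n k f → ∑ (tuples n (suc k)) f ≡ ∑[ i ∈ allFin n ] ∑[ v ∈ tuples n k ] f (i ∷ v)
  ∑-tuples n k f = ∑-cartesianProductWith _∷_ (allFin n) (tuples n k) f

  -- Selections and rearrangements of vectors

  -- `skip` is available only while something remains to be selected, so each choice of t among q
  -- positions is encoded exactly once.
  data Sel : ℕ → ℕ → Set where
    done : ∀ {q} → Sel 0 q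
    take : ∀ {t q} → Sel t q → Sel (suc t) (suc q)
    skip : ∀ {t q} → Sel (suc t) q → Sel (suc t) (suc q)

  sel : ∀ {X : Set} {t q} → Sel t q → Vec X q → Vec X t
  sel done     _       = []
  sel (take σ) (x ∷ v) = x ∷ sel σ v
  sel (skip σ) (x ∷ v) = sel σ v

  sel-map : ∀ {X Y : Set} {t q} (f : X → Y) (σ : Sel t q) v → Vec.map f (sel σ v) ≡ sel σ (Vec.map f v)
  sel-map f done     _       = refl
  sel-map f (take σ) (x ∷ v) = cong (f x ∷_) (sel-map f σ v)
  sel-map f (skip σ) (x ∷ v) = sel-map f σ v

  sels : ∀ t q → List (Sel t q)
  sels zero    q       = done ∷ []
  sels (suc t) zero    = []
  sels (suc t) (suc q) = List.map take (sels t q) ++ List.map skip (sels (suc t) q)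

  ∈-sels : ∀ {t q} (σ : Sel t q) → σ ∈ sels t q
  ∈-sels done                   = here refl
  ∈-sels (take σ)               = ∈-++⁺ˡ (∈-map⁺ take (∈-sels σ))
  ∈-sels {suc t} {suc q} (skip σ) = ∈-++⁺ʳ (List.map take (sels t q)) (∈-map⁺ skip (∈-sels σ))

  -- Lets (q + 1)^t play the part of the binomial sums, both in counting selections and in
  -- Sauer-Shelah: it satisfies Pascal's recursion as an inequality.
  pascal-^ : ∀ q t → suc q ^ t + suc q ^ suc t ≤ suc (suc q) ^ suc t
  pascal-^ q t = begin
    suc q ^ t + suc q * suc q ^ t     ≡⟨⟩
    suc (suc q) * suc q ^ t           ≤⟨ *-monoʳ-≤ (suc (suc q)) (^-monoˡ-≤ t (n≤1+n (suc q))) ⟩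
    suc (suc q) * suc (suc q) ^ t     ∎

  length-sels : ∀ t q → length (sels t q) ≤ suc q ^ t
  length-sels zero    q       = ≤-refl
  length-sels (suc t) zero    = z≤n
  length-sels (suc t) (suc q) = begin
    length (List.map take (sels t q) ++ List.map skip (sels (suc t) q))  ≡⟨ length-++ (List.map take (sels t q)) ⟩
    length (List.map take (sels t q)) + length (List.map skip (sels (suc t) q))
      ≡⟨ cong₂ _+_ (length-map take (sels t q)) (length-map skip (sels (suc t) q)) ⟩
    length (sels t q) + length (sels (suc t) q)   ≤⟨ +-mono-≤ (length-sels t q) (length-sels (suc t) q) ⟩
    suc q ^ t + suc q ^ suc t                     ≤⟨ pascal-^ q t ⟩
    suc (suc q) ^ suc t                           ∎

  -- Restricting a uniform q-tuple to fixed t positions gives a uniform t-tuple; the powers of n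
  -- clear the denominators of the two averages.
  ∑-sel : ∀ {n t q} (σ : Sel t q) f →
          n ^ t * ∑[ z ∈ tuples n q ] f (sel σ z) ≡ n ^ q * ∑ (tuples n t) f
  ∑-sel {n} {_} {q} done f = begin-equality
    1 * ∑[ _ ∈ tuples n q ] f []   ≡⟨ *-identityˡ _ ⟩
    ∑[ _ ∈ tuples n q ] f []       ≡⟨ ∑-const (tuples n q) (f []) ⟩
    length (tuples n q) * f []     ≡⟨ cong₂ _*_ (length-tuples n q) (sym (+-identityʳ (f []))) ⟩
    n ^ q * (f [] + 0)             ∎
  ∑-sel {n} {suc t} {suc q} (take σ) f = begin-equality
    n * n ^ t * ∑[ z ∈ tuples n (suc q) ] f (sel (take σ) z)
      ≡⟨ cong (n * n ^ t *_) (∑-tuples n q _) ⟩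
    n * n ^ t * ∑[ i ∈ allFin n ] ∑[ z ∈ tuples n q ] f (i ∷ sel σ z)
      ≡⟨ *-assoc n (n ^ t) _ ⟩
    n * (n ^ t * ∑[ i ∈ allFin n ] ∑[ z ∈ tuples n q ] f (i ∷ sel σ z))
      ≡⟨ cong (n *_) (∑-*ˡ (allFin n) (n ^ t) _) ⟨
    n * ∑[ i ∈ allFin n ] (n ^ t * ∑[ z ∈ tuples n q ] f (i ∷ sel σ z))
      ≡⟨ cong (n *_) (∑-cong (allFin n) (λ i → ∑-sel σ (λ w → f (i ∷ w)))) ⟩
    n * ∑[ i ∈ allFin n ] (n ^ q * ∑[ w ∈ tuples n t ] f (i ∷ w))
      ≡⟨ cong (n *_) (∑-*ˡ (allFin n) (n ^ q) _) ⟩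
    n * (n ^ q * ∑[ i ∈ allFin n ] ∑[ w ∈ tuples n t ] f (i ∷ w))
      ≡⟨ *-assoc n (n ^ q) _ ⟨
    n * n ^ q * ∑[ i ∈ allFin n ] ∑[ w ∈ tuples n t ] f (i ∷ w)
      ≡⟨ cong (n * n ^ q *_) (∑-tuples n t f) ⟨
    n * n ^ q * ∑ (tuples n (suc t)) f ∎
  ∑-sel {n} {suc t} {suc q} (skip σ) f = begin-equality
    n ^ suc t * ∑[ z ∈ tuples n (suc q) ] f (sel (skip σ) z)
      ≡⟨ cong (n ^ suc t *_) (∑-tuples n q _) ⟩
    n ^ suc t * ∑[ _ ∈ allFin n ] ∑[ z ∈ tuples n q ] f (sel σ z)
      ≡⟨ cong (n ^ suc t *_) (trans (∑-const (allFin n) _) (cong (_* ∑[ z ∈ tuples n q ] f (sel σ z)) (length-allFin n))) ⟩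
    n ^ suc t * (n * ∑[ z ∈ tuples n q ] f (sel σ z))
      ≡⟨ swap (n ^ suc t) n _ ⟩
    n * (n ^ suc t * ∑[ z ∈ tuples n q ] f (sel σ z))
      ≡⟨ cong (n *_) (∑-sel σ f) ⟩
    n * (n ^ q * ∑ (tuples n (suc t)) f)
      ≡⟨ *-assoc n (n ^ q) _ ⟨
    n * n ^ q * ∑ (tuples n (suc t)) f ∎
    where
    swap : ∀ a b c → a * (b * c) ≡ b * (a * c)
    swap = solve-∀

  Shattered : ∀ {t q} → (Vec Bool q → Set) → Sel t q → Set
  Shattered P σ = ∀ b → ∃[ v ] P v × sel σ v ≡ b

  -- Sauer–Shelah.  P′ below is the projection of P and P″ the set of vectors both
  -- of whose extensions lie in P, so that |P| = |P′| + |P″|.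
  sauer-shelah : ∀ t q {P : Vec Bool q → Set} (P? : ∀ v → Dec (P v)) → (∀ (σ : Sel t q) → ¬ Shattered P σ) →
                 ∃[ V ] length V ≤ suc q ^ t × (∀ v → P v → v ∈ V)
  sauer-shelah zero    q       P? none = [] , z≤n , λ v pv → ⊥-elim (none done λ { [] → v , pv , refl })
  sauer-shelah (suc t) zero    P? none = [] ∷ [] , ≤-reflexive (sym (^-zeroˡ (suc t))) , λ { [] _ → here refl }
  sauer-shelah (suc t) (suc q) {P} P? none = V , V-length , V-covers
    where
    P′ P″ : Vec Bool q → Set
    P′ v = P (false ∷ v) ⊎ P (true ∷ v)
    P″ v = P (false ∷ v) × P (true ∷ v)

    lift′ : ∀ {σ : Sel (suc t) q} → Shattered P′ σ → Shattered P (skip σ)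
    lift′ sh b with sh b
    ... | v , inj₁ p , eq = false ∷ v , p , eq
    ... | v , inj₂ p , eq = true  ∷ v , p , eq

    lift″ : ∀ {σ : Sel t q} → Shattered P″ σ → Shattered P (take σ)
    lift″ sh (false ∷ b) = let v , (p , _) , eq = sh b in false ∷ v , p , cong (false ∷_) eq
    lift″ sh (true  ∷ b) = let v , (_ , p) , eq = sh b in true  ∷ v , p , cong (true  ∷_) eq

    rec′ : ∃[ V ] length V ≤ suc q ^ suc t × (∀ v → P′ v → v ∈ V)
    rec′ = sauer-shelah (suc t) q (λ v → P? (false ∷ v) ⊎-dec P? (true ∷ v)) (λ σ sh → none (skip σ) (lift′ sh))
    rec″ : ∃[ V ] length V ≤ suc q ^ t × (∀ v → P″ v → v ∈ V)
    rec″ = sauer-shelah t q (λ v → P? (false ∷ v) ×-dec P? (true ∷ v)) (λ σ sh → none (take σ) (lift″ sh))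

    V′ V″ V : List (Vec Bool _)
    V′ = proj₁ rec′
    V″ = proj₁ rec″

    -- `first` picks one extension in P for each v in the projection. An element of P that it misses
    -- starts with true while the extension by false is also in P, so `second` applied to `V″`
    -- covers it.
    first second : Vec Bool q → Vec Bool (suc q)
    first v with P? (false ∷ v)
    ... | yes _ = false ∷ v
    ... | no  _ = true  ∷ v
    second v = true ∷ v

    V = List.map second V″ ++ List.map first V′

    V-length : length V ≤ suc (suc q) ^ suc t
    V-length = begin
      length V                                                      ≡⟨ length-++ (List.map second V″) ⟩
      length (List.map second V″) + length (List.map first V′)      ≡⟨ cong₂ _+_ (length-map second V″) (length-map first V′) ⟩
      length V″ + length V′                                         ≤⟨ +-mono-≤ (proj₁ (proj₂ rec″)) (proj₁ (proj₂ rec′)) ⟩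
      suc q ^ t + suc q ^ suc t                                     ≤⟨ pascal-^ q t ⟩
      suc (suc q) ^ suc t                                           ∎

    first∈ : ∀ {v} → v ∈ V′ → first v ∈ V
    first∈ v∈ = ∈-++⁺ʳ (List.map second V″) (∈-map⁺ first v∈)

    V-covers : ∀ v → P v → v ∈ V
    V-covers (b ∷ v) p with P? (false ∷ v) | first∈ {v}
    V-covers (false ∷ v) p | yes _ | f = f (proj₂ (proj₂ rec′) v (inj₁ p))
    V-covers (true  ∷ v) p | yes r | _ = ∈-++⁺ˡ (∈-map⁺ second (proj₂ (proj₂ rec″) v (r , p)))
    V-covers (false ∷ v) p | no ¬p | _ = contradiction p ¬p
    V-covers (true  ∷ v) p | no _  | f = f (proj₂ (proj₂ rec′) v (inj₂ p))

  -- A code records the positions chosen by insertion sort.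
  Code : ℕ → Set
  Code zero    = ⊤
  Code (suc k) = Fin (suc k) × Code k

  codes : ∀ k → List (Code k)
  codes zero    = tt ∷ []
  codes (suc k) = cartesianProduct (allFin (suc k)) (codes k)

  ∈-codes : ∀ {k} (c : Code k) → c ∈ codes k
  ∈-codes {zero}  tt      = here refl
  ∈-codes {suc k} (j , c) = ∈-cartesianProduct⁺ (∈-allFin j) (∈-codes c)

  length-codes : ∀ k → length (codes k) ≡ k !
  length-codes zero    = refl
  length-codes (suc k) =
    trans (length-cartesianProductWith _,_ (allFin (suc k)) (codes k)) (cong₂ _*_ (length-allFin (suc k)) (length-codes k))

  module _ {X : Set} where

    rearrange rearrange⁻¹ : ∀ {k} → Code k → Vec X k → Vec X k
    rearrange {zero}  _       v       = v
    rearrange {suc k} (j , c) (x ∷ v) = insertAt (rearrange c v) j x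
    rearrange⁻¹ {zero}  _       v = v
    rearrange⁻¹ {suc k} (j , c) v = lookup v j ∷ rearrange⁻¹ c (removeAt v j)

    rearrange⁻¹-rearrange : ∀ {k} (c : Code k) v → rearrange⁻¹ c (rearrange c v) ≡ v
    rearrange⁻¹-rearrange {zero}  _       v       = refl
    rearrange⁻¹-rearrange {suc k} (j , c) (x ∷ v) = cong₂ _∷_
      (Vec.insertAt-lookup (rearrange c v) j x)
      (trans (cong (rearrange⁻¹ c) (Vec.removeAt-insertAt (rearrange c v) j x)) (rearrange⁻¹-rearrange c v))

    rearrange-rearrange⁻¹ : ∀ {k} (c : Code k) v → rearrange c (rearrange⁻¹ c v) ≡ v
    rearrange-rearrange⁻¹ {zero}  _       v = refl
    rearrange-rearrange⁻¹ {suc k} (j , c) v =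
      trans (cong (λ w → insertAt w j (lookup v j)) (rearrange-rearrange⁻¹ c (removeAt v j))) (Vec.insertAt-removeAt v j)

    rearrange-injective : ∀ {k} (c : Code k) {v w} → rearrange c v ≡ rearrange c w → v ≡ w
    rearrange-injective c {v} {w} eq =
      trans (sym (rearrange⁻¹-rearrange c v)) (trans (cong (rearrange⁻¹ c) eq) (rearrange⁻¹-rearrange c w))

    All-insertAt : ∀ {P : X → Set} {k} {v : Vec X k} j {x} → P x → All P v → All P (insertAt v j x)
    All-insertAt zero    px pv       = px ∷ pv
    All-insertAt (suc j) px (py ∷ pv) = py ∷ All-insertAt j px pv

    All-rearrange : ∀ {P : X → Set} {k} (c : Code k) {v} → All P v → All P (rearrange c v)
    All-rearrange {k = zero}  c       pv        = pv
    All-rearrange {k = suc k} (j , c) (px ∷ pv) = All-insertAt j px (All-rearrange c pv)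

  rearrange-map : ∀ {X Y : Set} {k} (f : X → Y) (c : Code k) v → Vec.map f (rearrange c v) ≡ rearrange c (Vec.map f v)
  rearrange-map {k = zero}  f c       v       = refl
  rearrange-map {k = suc k} f (j , c) (x ∷ v) =
    trans (Vec.map-insertAt f x (rearrange c v) j) (cong (λ w → insertAt w j (f x)) (rearrange-map f c v))

  -- Needed because closure of the family is stated for permutations; position j of the rearranged
  -- vector reads the head of the original one.
  toPermutation : ∀ {k} → Code k → Permutation′ k
  toPermutation {zero}  _       = Perm.id
  toPermutation {suc k} (j , c) = insert j zero (toPermutation c)

  lookup-rearrange : ∀ {X : Set} {k} (c : Code k) (v : Vec X k) i →
                     lookup (rearrange c v) i ≡ lookup v (toPermutation c ⟨$⟩ʳ i)
  lookup-rearrange {k = suc k} (j , c) (x ∷ v) i with j Fin.≟ i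
  ... | yes refl = Vec.insertAt-lookup (rearrange c v) j x
  ... | no  j≢i  =
    trans (cong (lookup (insertAt (rearrange c v) j x)) (sym (Fin.punchIn-punchOut j≢i)))
   (trans (Vec.insertAt-punchIn (rearrange c v) j x (Fin.punchOut j≢i))
          (lookup-rearrange c v (Fin.punchOut j≢i)))

  module _ {n : ℕ} where

    insert-sorted : ∀ {k} (v : Vec (Fin n) k) {x} → Linked Fin._<_ v → All (x ≢_) v →
                    ∃[ j ] Linked Fin._<_ (insertAt v j x)
    insert-sorted []       _ _ = zero , [-]
    insert-sorted (y ∷ ys) {x} sorted (x≢y ∷ x≢ys) with Fin.<-cmp x y
    ... | tri< x<y _ _ = zero , x<y ∷ sorted
    ... | tri≈ _ x≡y _ = contradiction x≡y x≢y
    insert-sorted (y ∷ [])     _            _            | tri> _ _ y<x = suc zero , y<x ∷ [-]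
    insert-sorted (y ∷ z ∷ zs) (y<z ∷ sorted) (_ ∷ x≢zs) | tri> _ _ y<x with insert-sorted (z ∷ zs) sorted x≢zs
    ... | zero  , l = suc zero    , y<x ∷ l
    ... | suc j , l = suc (suc j) , y<z ∷ l

    insertion-sort : ∀ {k} (v : Vec (Fin n) k) → Unique v → ∃[ c ] Linked Fin._<_ (rearrange c v)
    insertion-sort []      _         = tt , []
    insertion-sort (x ∷ v) (x≢ ∷ uq) =
      let c , l = insertion-sort v uq
          j , l′ = insert-sorted (rearrange c v) l (All-rearrange c x≢)
      in (j , c) , l′

    -- Each vector is charged to the code that sorts it. Since a fixed code acts injectively, no
    -- image is counted twice for the same code.
    ∑-rearrange : ∀ {k} {P : Vec (Fin n) k → Set} {Q : Code k → Vec (Fin n) k → Set}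
                  (P? : ∀ x → Dec (P x)) (Q? : ∀ c x → Dec (Q c x)) →
                  (∀ x → P x → ∃[ c ] Q c (rearrange c x)) →
                  ∑[ x ∈ tuples n k ] ⟦ P? x ⟧ ≤ ∑[ c ∈ codes k ] ∑[ x ∈ tuples n k ] ⟦ Q? c x ⟧
    ∑-rearrange {k} P? Q? h = begin
      ∑[ x ∈ tuples n k ] ⟦ P? x ⟧
        ≤⟨ ∑-mono′ (tuples n k) (λ x → ⟦⟧-≤ (P? x) λ px → let c , q = h x px in
             ≤-trans (≤-reflexive (sym (⟦⟧-yes (Q? c (rearrange c x)) q)))
                     (∑-∈ (λ c → ⟦ Q? c (rearrange c x) ⟧) (∈-codes c))) ⟩
      ∑[ x ∈ tuples n k ] ∑[ c ∈ codes k ] ⟦ Q? c (rearrange c x) ⟧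
        ≡⟨ ∑-swap (tuples n k) (codes k) (λ x c → ⟦ Q? c (rearrange c x) ⟧) ⟩
      ∑[ c ∈ codes k ] ∑[ x ∈ tuples n k ] ⟦ Q? c (rearrange c x) ⟧
        ≤⟨ ∑-mono′ (codes k) (λ c → ∑-injective (Vec.≡-dec Fin._≟_) (rearrange c) (rearrange-injective c)
             (tuples-Unique n k) (λ x → ∈-tuples (rearrange c x)) (λ x → ⟦ Q? c x ⟧)) ⟩
      ∑[ c ∈ codes k ] ∑[ x ∈ tuples n k ] ⟦ Q? c x ⟧ ∎

  -- Copies from column tuples

  -- The pigeonhole principle; `x₀` is the answer for the empty list.
  ∑-max : ∀ {X : Set} (xs : List X) f → X → ∃[ y ] ∑ xs f ≤ length xs * f y
  ∑-max []       f x₀ = x₀ , z≤n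
  ∑-max (x ∷ xs) f x₀ with ∑-max xs f x₀
  ... | y , h with ≤-total (f x) (f y)
  ...   | inj₁ fx≤fy = y , +-mono-≤ fx≤fy h
  ...   | inj₂ fy≤fx = x , +-monoʳ-≤ (f x) (≤-trans h (*-monoʳ-≤ (length xs) fy≤fx))

  fresh-or-hit : ∀ {n k} (i : Fin n) (x : Vec (Fin n) k) → All (i ≢_) x ⊎ ∃[ j ] i ≡ lookup x j
  fresh-or-hit i [] = inj₁ []
  fresh-or-hit i (y ∷ x) with i Fin.≟ y | fresh-or-hit i x
  ... | yes i≡y | _              = inj₂ (zero , i≡y)
  ... | no  _   | inj₂ (j , i≡)  = inj₂ (suc j , i≡)
  ... | no  i≢y | inj₁ fresh     = inj₁ (i≢y ∷ fresh)

  _≟ᵛ_ : ∀ {t} (b b′ : Vec Bool t) → Dec (b ≡ b′)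
  _≟ᵛ_ = Vec.≡-dec Bool._≟_

  rearrange∈F : ∀ {F} → ClosedUnderRowPermutations F → ∀ {s t} {A : Matrix s t} → (s , t , A) ∈ F →
                ∀ c → (s , t , rearrange c A) ∈ F
  rearrange∈F {F} closed {s} {t} {A} A∈F c = subst (λ B → (s , t , B) ∈ F) eq (closed A A∈F (toPermutation c))
    where
    eq : permuteRows (toPermutation c) A ≡ rearrange c A
    eq = trans (Vec.tabulate-cong λ i → sym (lookup-rearrange c A i)) (Vec.tabulate∘lookup (rearrange c A))

  code₀ : ∀ k → Code k
  code₀ zero    = tt
  code₀ (suc k) = zero , code₀ k

  -- B is the reciprocal of the density of copies, which keeps the whole argument within the natural
  -- numbers.
  Rich : ∀ {n} → Family → Matrix n n → ℕ → Set
  Rich {n} F M B = ∃[ s ] ∃[ t ] Σ[ A ∈ Matrix s t ] ((s , t , A) ∈ F × n ^ (s + t) ≤ B * #copies A M)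

  module _ {n : ℕ} (M : Matrix n n) where

    freq : ∀ {t} → Vec Bool t → Vec (Fin n) t → ℕ
    freq b z = ∑[ i ∈ allFin n ] ⟦ Vec.map (entry M i) z ≟ᵛ b ⟧

    DistinctRows : ∀ {s t} → Matrix s t → Vec (Fin n) t → Vec (Fin n) s → Set
    DistinctRows A z x = Unique x × submatrix M x z ≡ A

    distinctRows? : ∀ {s t} (A : Matrix s t) z x → Dec (DistinctRows A z x)
    distinctRows? A z x = allPairs? (λ i j → ¬? (i Fin.≟ j)) x ×-dec Vec.≡-dec _≟ᵛ_ (submatrix M x z) A

    extension : ∀ {s t} (b : Vec Bool t) (z : Vec (Fin n) t) (x : Vec (Fin n) s) (i : Fin n) →
                Dec (Vec.map (entry M i) z ≡ b × All (i ≢_) x)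
    extension b z x i = (Vec.map (entry M i) z ≟ᵛ b) ×-dec All.all? (λ j → ¬? (i Fin.≟ j)) x

    freq≤extensions : ∀ {s t} (b : Vec Bool t) (z : Vec (Fin n) t) (x : Vec (Fin n) s) →
                      freq b z ≤ (∑[ i ∈ allFin n ] ⟦ extension b z x i ⟧) + s
    freq≤extensions {s} b z x = begin
      freq b z
        ≤⟨ ∑-mono′ (allFin n) (λ i → ⟦⟧-≤ (Vec.map (entry M i) z ≟ᵛ b) (fresh i)) ⟩
      ∑[ i ∈ allFin n ] (⟦ extension b z x i ⟧ + ∑[ j ∈ allFin s ] ⟦ i Fin.≟ lookup x j ⟧)
        ≡⟨ ∑-+ (allFin n) _ _ ⟩
      E + ∑[ i ∈ allFin n ] ∑[ j ∈ allFin s ] ⟦ i Fin.≟ lookup x j ⟧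
        ≡⟨ cong (E +_) (∑-swap (allFin n) (allFin s) (λ i j → ⟦ i Fin.≟ lookup x j ⟧)) ⟩
      E + ∑[ j ∈ allFin s ] ∑[ i ∈ allFin n ] ⟦ i Fin.≟ lookup x j ⟧
        ≤⟨ +-monoʳ-≤ E (∑-≤-const (allFin s) λ j _ →
             ∑-Unique (Fin._≟ lookup x j) (ListUnique.allFin⁺ n) (λ p q → trans p (sym q))) ⟩
      E + length (allFin s) * 1
        ≡⟨ cong (E +_) (trans (*-identityʳ _) (length-allFin s)) ⟩
      E + s ∎
      where
      E = ∑[ i ∈ allFin n ] ⟦ extension b z x i ⟧

      fresh : ∀ i → Vec.map (entry M i) z ≡ b → 1 ≤ ⟦ extension b z x i ⟧ + ∑[ j ∈ allFin s ] ⟦ i Fin.≟ lookup x j ⟧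
      fresh i eq with fresh-or-hit i x
      ... | inj₁ f       = ≤-trans (≤-reflexive (sym (⟦⟧-yes (extension b z x i) (eq , f)))) (m≤m+n _ _)
      ... | inj₂ (j , h) = ≤-trans (≤-reflexive (sym (⟦⟧-yes (i Fin.≟ lookup x j) h)))
                             (≤-trans (∑-∈ (λ j → ⟦ i Fin.≟ lookup x j ⟧) (∈-allFin j)) (m≤n+m _ _))

    -- Each row of A has at least n / Θ matches, of which fewer than n / 2Θ or exactly that many are
    -- excluded as already used. So every row can be chosen in at least n / 2Θ ways.
    many-distinctRows : ∀ {s t} (A : Matrix s t) z Θ → (∀ k → n ≤ Θ * freq (lookup A k) z) → 2 * Θ * s ≤ n →
                        n ^ s ≤ (2 * Θ) ^ s * ∑[ x ∈ tuples n s ] ⟦ distinctRows? A z x ⟧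
    many-distinctRows []                _ _ _    _    = ≤-refl
    many-distinctRows {suc s} (b ∷ A) z Θ many large = begin
      n * n ^ s                         ≤⟨ *-monoʳ-≤ n (many-distinctRows A z Θ (λ k → many (suc k)) large′) ⟩
      n * (c ^ s * ∑ (tuples n s) D)    ≡⟨ lemma₁ n (c ^ s) (∑ (tuples n s) D) ⟩
      c ^ s * (∑ (tuples n s) D * n)    ≡⟨ cong (c ^ s *_) (∑-*ʳ (tuples n s) n D) ⟨
      c ^ s * ∑[ x ∈ tuples n s ] (D x * n)
        ≤⟨ *-monoʳ-≤ (c ^ s) (∑-mono′ (tuples n s) step) ⟩
      c ^ s * ∑[ x ∈ tuples n s ] (c * ∑[ i ∈ allFin n ] D′ (i ∷ x))
        ≡⟨ cong (c ^ s *_) (∑-*ˡ (tuples n s) c _) ⟩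
      c ^ s * (c * ∑[ x ∈ tuples n s ] ∑[ i ∈ allFin n ] D′ (i ∷ x))
        ≡⟨ cong (λ m → c ^ s * (c * m)) (∑-swap (tuples n s) (allFin n) (λ x i → D′ (i ∷ x))) ⟩
      c ^ s * (c * ∑[ i ∈ allFin n ] ∑[ x ∈ tuples n s ] D′ (i ∷ x))
        ≡⟨ lemma₂ (c ^ s) c _ ⟩
      c * c ^ s * ∑[ i ∈ allFin n ] ∑[ x ∈ tuples n s ] D′ (i ∷ x)
        ≡⟨ cong (c * c ^ s *_) (∑-tuples n s D′) ⟨
      c * c ^ s * ∑ (tuples n (suc s)) D′ ∎
      where
      c = 2 * Θ
      D : Vec (Fin n) s → ℕ
      D x = ⟦ distinctRows? A z x ⟧
      D′ : Vec (Fin n) (suc s) → ℕ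
      D′ x = ⟦ distinctRows? (b ∷ A) z x ⟧

      large′ : c * s ≤ n
      large′ = ≤-trans (*-monoʳ-≤ c (n≤1+n s)) large

      lemma₁ : ∀ a b c → a * (b * c) ≡ b * (c * a)
      lemma₁ = solve-∀
      lemma₂ : ∀ a b c → a * (b * c) ≡ b * a * c
      lemma₂ = solve-∀
      lemma₃ : ∀ a b c → 2 * (a * (b + c)) ≡ 2 * a * b + 2 * a * c
      lemma₃ = solve-∀

      n≤extensions : ∀ x → n ≤ c * ∑[ i ∈ allFin n ] ⟦ extension b z x i ⟧
      n≤extensions x = +-cancelʳ-≤ n _ _ (begin
        n + n                                ≡⟨ cong (n +_) (+-identityʳ n) ⟨
        2 * n                                ≤⟨ *-monoʳ-≤ 2 (≤-trans (many zero) (*-monoʳ-≤ Θ (freq≤extensions b z x))) ⟩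
        2 * (Θ * (∑[ i ∈ allFin n ] ⟦ extension b z x i ⟧ + s))
          ≡⟨ lemma₃ Θ (∑[ i ∈ allFin n ] ⟦ extension b z x i ⟧) s ⟩
        c * ∑[ i ∈ allFin n ] ⟦ extension b z x i ⟧ + c * s
          ≤⟨ +-monoʳ-≤ (c * ∑[ i ∈ allFin n ] ⟦ extension b z x i ⟧) large′ ⟩
        c * ∑[ i ∈ allFin n ] ⟦ extension b z x i ⟧ + n ∎)

      step : ∀ x → D x * n ≤ c * ∑[ i ∈ allFin n ] D′ (i ∷ x)
      step x with distinctRows? A z x
      ... | no  _         = z≤n
      ... | yes (uq , eq) = begin
        1 * n                                         ≡⟨ *-identityˡ n ⟩
        n                                             ≤⟨ n≤extensions x ⟩
        c * ∑[ i ∈ allFin n ] ⟦ extension b z x i ⟧   ≤⟨ *-monoʳ-≤ c (∑-mono′ (allFin n) λ i →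
          ⟦⟧-mono (extension b z x i) (distinctRows? (b ∷ A) z (i ∷ x)) λ (e , f) → f ∷ uq , cong₂ _∷_ e eq) ⟩
        c * ∑[ i ∈ allFin n ] D′ (i ∷ x)              ∎

    #copies-∑ : ∀ {s t} (A : Matrix s t) →
                #copies A M ≡ ∑[ z ∈ tuples n t ] ∑[ x ∈ tuples n s ] ⟦ isCopy? A M (x , z) ⟧
    #copies-∑ {s} {t} A = trans (length-filter (isCopy? A M) (cartesianProduct (tuples n s) (tuples n t)))
      (trans (∑-cartesianProductWith _,_ (tuples n s) (tuples n t) _)
             (∑-swap (tuples n s) (tuples n t) (λ x z → ⟦ isCopy? A M (x , z) ⟧)))

    distinctRows≤copies : ∀ {s t} (A : Matrix s t) z → Linked Fin._<_ z →
      ∑[ x ∈ tuples n s ] ⟦ distinctRows? A z x ⟧ ≤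
      ∑[ c ∈ codes s ] ∑[ x ∈ tuples n s ] ⟦ isCopy? (rearrange c A) M (x , z) ⟧
    distinctRows≤copies A z sorted =
      ∑-rearrange (distinctRows? A z) (λ c x → isCopy? (rearrange c A) M (x , z)) λ x (uq , eq) →
        let c , l = insertion-sort x uq in
        c , l , sorted , trans (rearrange-map (λ i → Vec.map (entry M i) z) c x) (cong (rearrange c) eq)

    -- Rows matching the rows of A are chosen one by one, avoiding repetitions; sorting
    -- them turns A into a row permutation of A.
    rich : ∀ {F} → ClosedUnderRowPermutations F → ∀ {s t} {A : Matrix s t} → (s , t , A) ∈ F →
           ∀ Θ K → 2 * Θ * s ≤ n → {G : Vec (Fin n) t → Set} (G? : ∀ z → Dec (G z)) →
           (∀ z → G z → Linked Fin._<_ z × (∀ k → n ≤ Θ * freq (lookup A k) z)) →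
           n ^ t ≤ K * ∑[ z ∈ tuples n t ] ⟦ G? z ⟧ → Rich F M (K * ((2 * Θ) ^ s * s !))
    rich closed {s} {t} {A} A∈F Θ K large G? good many =
      s , t , rearrange c A , rearrange∈F closed A∈F c , (begin
        n ^ (s + t)                           ≡⟨ ^-distribˡ-+-* n s t ⟩
        n ^ s * n ^ t                         ≤⟨ *-monoʳ-≤ (n ^ s) many ⟩
        n ^ s * (K * ∑ (tuples n t) g)        ≡⟨ lemma₁ (n ^ s) K (∑ (tuples n t) g) ⟩
        K * (∑ (tuples n t) g * n ^ s)        ≡⟨ cong (K *_) (∑-*ʳ (tuples n t) (n ^ s) g) ⟨
        K * ∑[ z ∈ tuples n t ] (g z * n ^ s) ≤⟨ *-monoʳ-≤ K (∑-mono′ (tuples n t) step) ⟩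
        K * ∑[ z ∈ tuples n t ] (b * ∑[ c ∈ codes s ] ∑[ x ∈ tuples n s ] copy c x z)
          ≡⟨ cong (K *_) (∑-*ˡ (tuples n t) b _) ⟩
        K * (b * ∑[ z ∈ tuples n t ] ∑[ c ∈ codes s ] ∑[ x ∈ tuples n s ] copy c x z)
          ≡⟨ cong (λ m → K * (b * m)) (∑-swap (tuples n t) (codes s) (λ z c → ∑[ x ∈ tuples n s ] copy c x z)) ⟩
        K * (b * ∑[ c ∈ codes s ] ∑[ z ∈ tuples n t ] ∑[ x ∈ tuples n s ] copy c x z)
          ≡⟨ cong (λ m → K * (b * m)) (∑-cong (codes s) (λ c → #copies-∑ (rearrange c A))) ⟨
        K * (b * ∑[ c ∈ codes s ] #copies (rearrange c A) M)
          ≤⟨ *-monoʳ-≤ K (*-monoʳ-≤ b (proj₂ best)) ⟩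
        K * (b * (length (codes s) * #copies (rearrange c A) M))
          ≡⟨ cong (λ m → K * (b * (m * #copies (rearrange c A) M))) (length-codes s) ⟩
        K * (b * (s ! * #copies (rearrange c A) M))
          ≡⟨ lemma₂ K b (s !) _ ⟩
        K * (b * s !) * #copies (rearrange c A) M ∎)
      where
      b = (2 * Θ) ^ s
      g : Vec (Fin n) t → ℕ
      g z = ⟦ G? z ⟧
      copy : Code s → Vec (Fin n) s → Vec (Fin n) t → ℕ
      copy c x z = ⟦ isCopy? (rearrange c A) M (x , z) ⟧
      best : ∃[ c ] ∑[ c ∈ codes s ] #copies (rearrange c A) M ≤ length (codes s) * #copies (rearrange c A) M
      best = ∑-max (codes s) (λ c → #copies (rearrange c A) M) (code₀ s)
      c = proj₁ best

      lemma₁ : ∀ a b c → a * (b * c) ≡ b * (c * a)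
      lemma₁ = solve-∀
      lemma₂ : ∀ a b c d → a * (b * (c * d)) ≡ a * (b * c) * d
      lemma₂ = solve-∀

      step : ∀ z → g z * n ^ s ≤ b * ∑[ c ∈ codes s ] ∑[ x ∈ tuples n s ] copy c x z
      step z with G? z
      ... | no  _  = z≤n
      ... | yes gz = ≤-trans (≤-reflexive (*-identityˡ (n ^ s)))
                       (≤-trans (many-distinctRows A z Θ (proj₂ (good z gz)) large)
                                (*-monoʳ-≤ b (distinctRows≤copies A z (proj₁ (good z gz)))))

  -- Dense rows

  ∑-pos : ∀ {X : Set} {P : X → Set} (P? : ∀ x → Dec (P x)) xs → 0 < ∑[ x ∈ xs ] ⟦ P? x ⟧ → ∃[ x ] P x
  ∑-pos P? (x ∷ xs) h with P? x
  ... | yes px = x , px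
  ... | no  _  = ∑-pos P? xs h

  boolVecs : ∀ t → List (Vec Bool t)
  boolVecs zero    = [] ∷ []
  boolVecs (suc t) = cartesianProductWith _∷_ (true ∷ false ∷ []) (boolVecs t)

  ∈-boolVecs : ∀ {t} (b : Vec Bool t) → b ∈ boolVecs t
  ∈-boolVecs []      = here refl
  ∈-boolVecs (x ∷ b) = ∈-cartesianProductWith⁺ _∷_ (∈-bools x) (∈-boolVecs b)
    where
    ∈-bools : ∀ x → x ∈ true ∷ false ∷ []
    ∈-bools true  = here refl
    ∈-bools false = there (here refl)

  module _ {n : ℕ} (M : Matrix n n) where

    dist agree : Fin n → Fin n → ℕ
    dist  i i′ = ∑[ j ∈ allFin n ] ⟦ ¬? (entry M i j Bool.≟ entry M i′ j) ⟧
    agree i i′ = ∑[ j ∈ allFin n ] ⟦ entry M i j Bool.≟ entry M i′ j ⟧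

    agree+dist : ∀ i i′ → agree i i′ + dist i i′ ≡ n
    agree+dist i i′ = begin-equality
      agree i i′ + dist i i′                ≡⟨ ∑-+ (allFin n) _ _ ⟨
      ∑[ j ∈ allFin n ] (⟦ entry M i j Bool.≟ entry M i′ j ⟧ + ⟦ ¬? (entry M i j Bool.≟ entry M i′ j) ⟧)
                                            ≡⟨ ∑-cong (allFin n) (λ j → ⟦⟧-¬ (entry M i j Bool.≟ entry M i′ j)) ⟩
      ∑[ _ ∈ allFin n ] 1                   ≡⟨ ∑-const (allFin n) 1 ⟩
      length (allFin n) * 1                 ≡⟨ trans (*-identityʳ _) (length-allFin n) ⟩
      n                                     ∎

    Close : ℕ → Fin n → Fin n → Set
    Close T i i′ = T * dist i i′ ≤ n

    close? : ∀ T i i′ → Dec (Close T i i′)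
    close? T i i′ = T * dist i i′ ≤? n

    ball : ℕ → Fin n → ℕ
    ball T i = ∑[ i′ ∈ allFin n ] ⟦ close? T i i′ ⟧

    Dense : ℕ → ℕ → Fin n → Set
    Dense T H i = n ≤ H * ball T i

    dense? : ∀ T H i → Dec (Dense T H i)
    dense? T H i = n ≤? H * ball T i

    -- A quantitative form of shattering: the rows of M realise every pattern on z, each with
    -- frequency at least 1 / Θ.
    Robust : ∀ {t} → ℕ → Vec (Fin n) t → Set
    Robust Θ z = ∀ b → n ≤ Θ * freq M b z

    robust? : ∀ {t} Θ (z : Vec (Fin n) t) → Dec (Robust Θ z)
    robust? {t} Θ z = map′ (λ h b → ListAll.lookup h (∈-boolVecs b)) (λ h → ListAll.tabulate λ _ → h _)
      (ListAll.all? (λ b → n ≤? Θ * freq M b z) (boolVecs t))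

    ¬robust : ∀ {t Θ} (z : Vec (Fin n) t) → ¬ Robust Θ z → ∃[ b ] Θ * freq M b z < n
    ¬robust {t} {Θ} z ¬r =
      let b , h = satisfied (ListAll.¬All⇒Any¬ (λ b → n ≤? Θ * freq M b z) (boolVecs t)
                    λ h → ¬r λ b → ListAll.lookup h (∈-boolVecs b))
      in b , ≰⇒> h

    Sorted×Robust : ∀ {t} → ℕ → Vec (Fin n) t → Set
    Sorted×Robust Θ z = Linked Fin._<_ z × Robust Θ z

    sorted×robust? : ∀ {t} Θ (z : Vec (Fin n) t) → Dec (Sorted×Robust Θ z)
    sorted×robust? Θ z = linked? Fin._<?_ z ×-dec robust? Θ z

    robust-row : ∀ {t Θ} {z : Vec (Fin n) t} → 0 < n → Robust Θ z → ∀ b → ∃[ i ] Vec.map (entry M i) z ≡ b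
    robust-row {Θ = Θ} {z} 0<n r b = ∑-pos (λ i → Vec.map (entry M i) z ≟ᵛ b) (allFin n) (n≢0⇒n>0 λ eq →
      <⇒≱ 0<n (≤-trans (r b) (≤-reflexive (trans (cong (Θ *_) eq) (*-zeroʳ Θ)))))

    -- Columns are sampled with repetition. The pattern that is true at position j only is realised
    -- by some row, and that row separates the column at j from every other one.
    robust-Unique : ∀ {t Θ} {z : Vec (Fin n) t} → 0 < n → Robust Θ z → Unique z
    robust-Unique {t} {Θ} {z} 0<n r = subst Unique (Vec.tabulate∘lookup z) (VecUnique.tabulate⁺ injective)
      where
      injective : ∀ {j j′} → lookup z j ≡ lookup z j′ → j ≡ j′
      injective {j} {j′} eq with j′ Fin.≟ j
      ... | yes j′≡j = sym j′≡j
      ... | no  j′≢j = contradiction (trans (sym (value j)) (trans (cong (entry M i) eq) (value j′)))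
            λ e → case-eq (trans (sym (dec-true (j Fin.≟ j) refl)) (trans e (dec-false (j′ Fin.≟ j) j′≢j)))
        where
        b : Vec Bool t
        b = tabulate λ k → does (k Fin.≟ j)
        i = proj₁ (robust-row {Θ = Θ} {z} 0<n r b)
        value : ∀ k → entry M i (lookup z k) ≡ does (k Fin.≟ j)
        value k = trans (sym (Vec.lookup-map k (entry M i) z))
          (trans (cong (λ v → lookup v k) (proj₂ (robust-row {Θ = Θ} {z} 0<n r b))) (Vec.lookup∘tabulate _ k))
        case-eq : ¬ true ≡ false
        case-eq ()

    robust-rearrange : ∀ {t Θ} {z : Vec (Fin n) t} (c : Code t) → Robust Θ z → Robust Θ (rearrange c z)
    robust-rearrange {Θ = Θ} {z} c r b = ≤-trans (r (rearrange⁻¹ c b)) (*-monoʳ-≤ Θ (∑-mono′ (allFin n) λ i →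
      ⟦⟧-mono (Vec.map (entry M i) z ≟ᵛ rearrange⁻¹ c b) (Vec.map (entry M i) (rearrange c z) ≟ᵛ b)
        λ eq → trans (rearrange-map (entry M i) c z) (trans (cong (rearrange c) eq) (rearrange-rearrange⁻¹ c b))))

    -- Robustness is insensitive to the order of the columns and forces them to be distinct, so
    -- sorting loses only the factor t!.
    ∑-robust≤ : ∀ t Θ → 0 < n →
      ∑[ z ∈ tuples n t ] ⟦ robust? Θ z ⟧ ≤ t ! * ∑[ z ∈ tuples n t ] ⟦ sorted×robust? Θ z ⟧
    ∑-robust≤ t Θ 0<n = begin
      ∑[ z ∈ tuples n t ] ⟦ robust? Θ z ⟧
        ≤⟨ ∑-rearrange {k = t} (robust? Θ) (λ _ → sorted×robust? Θ) (λ z r →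
             let c , l = insertion-sort z (robust-Unique {Θ = Θ} 0<n r) in c , l , robust-rearrange {Θ = Θ} c r) ⟩
      ∑[ _ ∈ codes t ] ∑[ z ∈ tuples n t ] ⟦ sorted×robust? Θ z ⟧
        ≡⟨ ∑-const (codes t) _ ⟩
      length (codes t) * ∑[ z ∈ tuples n t ] ⟦ sorted×robust? Θ z ⟧
        ≡⟨ cong (_* ∑[ z ∈ tuples n t ] ⟦ sorted×robust? Θ z ⟧) (length-codes t) ⟩
      t ! * ∑[ z ∈ tuples n t ] ⟦ sorted×robust? Θ z ⟧ ∎

    agree? : ∀ {q} i i′ (z : Vec (Fin n) q) → Dec (Vec.map (entry M i) z ≡ Vec.map (entry M i′) z)
    agree? i i′ z = Vec.map (entry M i) z ≟ᵛ Vec.map (entry M i′) z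

    -- The columns of a sample are independent, each contributing a factor `agree i i′`.
    ∑-agree : ∀ q i i′ → ∑[ z ∈ tuples n q ] ⟦ agree? i i′ z ⟧ ≤ agree i i′ ^ q
    ∑-agree zero    i i′ = ≤-refl
    ∑-agree (suc q) i i′ = begin
      ∑[ z ∈ tuples n (suc q) ] ⟦ agree? i i′ z ⟧
        ≡⟨ ∑-tuples n q _ ⟩
      ∑[ j ∈ allFin n ] ∑[ z ∈ tuples n q ] ⟦ agree? i i′ (j ∷ z) ⟧
        ≤⟨ ∑-mono′ (allFin n) (λ j → ∑-mono′ (tuples n q) λ z → ≤-trans
             (⟦⟧-mono (agree? i i′ (j ∷ z)) ((entry M i j Bool.≟ entry M i′ j) ×-dec agree? i i′ z) Vec.∷-injective)
             (≤-reflexive (⟦⟧-× (entry M i j Bool.≟ entry M i′ j) (agree? i i′ z)))) ⟩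
      ∑[ j ∈ allFin n ] ∑[ z ∈ tuples n q ] (⟦ entry M i j Bool.≟ entry M i′ j ⟧ * ⟦ agree? i i′ z ⟧)
        ≡⟨ ∑-cong (allFin n) (λ j → ∑-*ˡ (tuples n q) ⟦ entry M i j Bool.≟ entry M i′ j ⟧ _) ⟩
      ∑[ j ∈ allFin n ] (⟦ entry M i j Bool.≟ entry M i′ j ⟧ * ∑[ z ∈ tuples n q ] ⟦ agree? i i′ z ⟧)
        ≡⟨ ∑-*ʳ (allFin n) _ _ ⟩
      agree i i′ * ∑[ z ∈ tuples n q ] ⟦ agree? i i′ z ⟧
        ≤⟨ *-monoʳ-≤ (agree i i′) (∑-agree q i i′) ⟩
      agree i i′ * agree i i′ ^ q ∎

  -- Random samples of columns

  ^-distribʳ-* : ∀ q a b → (a * b) ^ q ≡ a ^ q * b ^ q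
  ^-distribʳ-* zero    a b = refl
  ^-distribʳ-* (suc q) a b = trans (cong (a * b *_) (^-distribʳ-* q a b)) (lemma a b (a ^ q) (b ^ q))
    where
    lemma : ∀ a b c d → a * b * (c * d) ≡ a * c * (b * d)
    lemma = solve-∀

  module _ {n : ℕ} (M : Matrix n n) where

    Far′ : ∀ {q} → ℕ → Fin n → Fin n → Vec (Fin n) q → Set
    Far′ T i i′ z = ¬ Close M T i i′ × Vec.map (entry M i) z ≡ Vec.map (entry M i′) z

    far? : ∀ {q} T i i′ (z : Vec (Fin n) q) → Dec (Far′ T i i′ z)
    far? T i i′ z = ¬? (close? M T i i′) ×-dec agree? M i i′ z

    -- The number of ordered pairs of far rows that the sample z fails to tell apart.
    confused : ∀ {q} → ℕ → Vec (Fin n) q → ℕ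
    confused T z = ∑[ i ∈ allFin n ] ∑[ i′ ∈ allFin n ] ⟦ far? T i i′ z ⟧

    -- Supplies the base T / (T + 1) of the exponential decay; this is why distances are measured
    -- against `suc T`.
    far-agree : ∀ T {i i′} → ¬ Close M (suc T) i i′ → suc T * agree M i i′ ≤ T * n
    far-agree T {i} {i′} far = +-cancelʳ-≤ n _ _ (begin
      suc T * agree M i i′ + n                          ≤⟨ +-monoʳ-≤ (suc T * agree M i i′) (<⇒≤ (≰⇒> far)) ⟩
      suc T * agree M i i′ + suc T * dist M i i′        ≡⟨ *-distribˡ-+ (suc T) (agree M i i′) (dist M i i′) ⟨
      suc T * (agree M i i′ + dist M i i′)              ≡⟨ cong (suc T *_) (agree+dist M i i′) ⟩
      n + T * n                                         ≡⟨ +-comm n (T * n) ⟩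
      T * n + n                                         ∎)

    ∑-far : ∀ T q i i′ → suc T ^ q * ∑[ z ∈ tuples n q ] ⟦ far? (suc T) i i′ z ⟧ ≤ T ^ q * n ^ q
    ∑-far T q i i′ = cases (close? M (suc T) i i′)
      where
      cases : Dec (Close M (suc T) i i′) → suc T ^ q * ∑[ z ∈ tuples n q ] ⟦ far? (suc T) i i′ z ⟧ ≤ T ^ q * n ^ q
      cases (yes close) = begin
        suc T ^ q * ∑[ z ∈ tuples n q ] ⟦ far? (suc T) i i′ z ⟧
          ≤⟨ *-monoʳ-≤ (suc T ^ q) (∑-≤-const (tuples n q) λ z _ →
               ≤-reflexive (⟦⟧-no (far? (suc T) i i′ z) λ (far , _) → far close)) ⟩
        suc T ^ q * (length (tuples n q) * 0)
          ≡⟨ trans (cong (suc T ^ q *_) (*-zeroʳ (length (tuples n q)))) (*-zeroʳ (suc T ^ q)) ⟩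
        0               ≤⟨ z≤n ⟩
        T ^ q * n ^ q   ∎
      cases (no far) = begin
        suc T ^ q * ∑[ z ∈ tuples n q ] ⟦ far? (suc T) i i′ z ⟧
          ≤⟨ *-monoʳ-≤ (suc T ^ q) (≤-trans
               (∑-mono′ (tuples n q) (λ z → ⟦⟧-mono (far? (suc T) i i′ z) (agree? M i i′ z) proj₂))
               (∑-agree M q i i′)) ⟩
        suc T ^ q * agree M i i′ ^ q    ≡⟨ ^-distribʳ-* q (suc T) (agree M i i′) ⟨
        (suc T * agree M i i′) ^ q      ≤⟨ ^-monoˡ-≤ q (far-agree T far) ⟩
        (T * n) ^ q                     ≡⟨ ^-distribʳ-* q T n ⟩
        T ^ q * n ^ q                   ∎

    ∑-confused : ∀ T q → suc T ^ q * ∑[ z ∈ tuples n q ] confused (suc T) z ≤ n * n * (T ^ q * n ^ q)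
    ∑-confused T q = begin
      suc T ^ q * ∑[ z ∈ tuples n q ] confused (suc T) z
        ≡⟨ cong (suc T ^ q *_) (∑-swap (tuples n q) (allFin n) (λ z i → ∑[ i′ ∈ allFin n ] ⟦ far? (suc T) i i′ z ⟧)) ⟩
      suc T ^ q * ∑[ i ∈ allFin n ] ∑[ z ∈ tuples n q ] ∑[ i′ ∈ allFin n ] ⟦ far? (suc T) i i′ z ⟧
        ≡⟨ ∑-*ˡ (allFin n) (suc T ^ q) _ ⟨
      ∑[ i ∈ allFin n ] (suc T ^ q * ∑[ z ∈ tuples n q ] ∑[ i′ ∈ allFin n ] ⟦ far? (suc T) i i′ z ⟧)
        ≤⟨ ∑-≤-const (allFin n) (λ i _ → row i) ⟩
      length (allFin n) * (n * (T ^ q * n ^ q))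
        ≡⟨ trans (cong (_* (n * (T ^ q * n ^ q))) (length-allFin n)) (sym (*-assoc n n _)) ⟩
      n * n * (T ^ q * n ^ q) ∎
      where
      row : ∀ i → suc T ^ q * ∑[ z ∈ tuples n q ] ∑[ i′ ∈ allFin n ] ⟦ far? (suc T) i i′ z ⟧ ≤ n * (T ^ q * n ^ q)
      row i = begin
        suc T ^ q * ∑[ z ∈ tuples n q ] ∑[ i′ ∈ allFin n ] ⟦ far? (suc T) i i′ z ⟧
          ≡⟨ cong (suc T ^ q *_) (∑-swap (tuples n q) (allFin n) (λ z i′ → ⟦ far? (suc T) i i′ z ⟧)) ⟩
        suc T ^ q * ∑[ i′ ∈ allFin n ] ∑[ z ∈ tuples n q ] ⟦ far? (suc T) i i′ z ⟧
          ≡⟨ ∑-*ˡ (allFin n) (suc T ^ q) _ ⟨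
        ∑[ i′ ∈ allFin n ] (suc T ^ q * ∑[ z ∈ tuples n q ] ⟦ far? (suc T) i i′ z ⟧)
          ≤⟨ ∑-≤-const (allFin n) (λ i′ _ → ∑-far T q i i′) ⟩
        length (allFin n) * (T ^ q * n ^ q)
          ≡⟨ cong (_* (T ^ q * n ^ q)) (length-allFin n) ⟩
        n * (T ^ q * n ^ q) ∎

    robustSels : ∀ {q} t → ℕ → Vec (Fin n) q → ℕ
    robustSels {q} t Θ z = ∑[ σ ∈ sels t q ] ⟦ robust? M Θ (sel σ z) ⟧

    -- A union bound over the selections, each of which turns the sample into a uniform t-tuple.
    ∑-robustSels : ∀ t q Θ →
      n ^ t * ∑[ z ∈ tuples n q ] robustSels t Θ z ≤ suc q ^ t * (n ^ q * ∑[ y ∈ tuples n t ] ⟦ robust? M Θ y ⟧)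
    ∑-robustSels t q Θ = begin
      n ^ t * ∑[ z ∈ tuples n q ] robustSels t Θ z
        ≡⟨ cong (n ^ t *_) (∑-swap (tuples n q) (sels t q) (λ z σ → ⟦ robust? M Θ (sel σ z) ⟧)) ⟩
      n ^ t * ∑[ σ ∈ sels t q ] ∑[ z ∈ tuples n q ] ⟦ robust? M Θ (sel σ z) ⟧
        ≡⟨ ∑-*ˡ (sels t q) (n ^ t) _ ⟨
      ∑[ σ ∈ sels t q ] (n ^ t * ∑[ z ∈ tuples n q ] ⟦ robust? M Θ (sel σ z) ⟧)
        ≤⟨ ∑-≤-const (sels t q) (λ σ _ → ≤-reflexive (∑-sel σ (λ y → ⟦ robust? M Θ y ⟧))) ⟩
      length (sels t q) * (n ^ q * ∑[ y ∈ tuples n t ] ⟦ robust? M Θ y ⟧)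
        ≤⟨ *-monoˡ-≤ _ (length-sels t q) ⟩
      suc q ^ t * (n ^ q * ∑[ y ∈ tuples n t ] ⟦ robust? M Θ y ⟧) ∎

  module _ {n : ℕ} (M : Matrix n n) (0<n : 0 < n) where

    -- First moments: `few` makes the average number of robust selections less than 1/2, and `hq`
    -- makes the average of 2Θ² `confused` at most n² / 2. Some sample therefore has combined weight
    -- less than n².
    good-sample : ∀ t q T Θ → 4 * (Θ * Θ) * T ^ q ≤ suc T ^ q →
      2 * t ! * suc q ^ t * ∑[ z ∈ tuples n t ] ⟦ sorted×robust? M Θ z ⟧ < n ^ t →
      Σ[ z ∈ Vec (Fin n) q ] (robustSels M t Θ z ≡ 0 × 2 * (Θ * Θ) * confused M (suc T) z < n * n)
    good-sample t q T Θ hq few = z , n<1⇒n≡0 r<1 , ≤-<-trans (m≤n+m _ _) bound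
      where
      Q a : ℕ
      Q = 2 * (Θ * Θ)
      a = suc q ^ t
      f : Vec (Fin n) q → ℕ
      -- With weight n², a single robust selection would already reach the bound, so a sample below
      -- it has none.
      f z = n * n * robustSels M t Θ z + Q * confused M (suc T) z
      R = ∑[ y ∈ tuples n t ] ⟦ robust? M Θ y ⟧
      B = ∑[ z ∈ tuples n t ] ⟦ sorted×robust? M Θ z ⟧
      Σr = ∑[ z ∈ tuples n q ] robustSels M t Θ z
      Σc = ∑[ z ∈ tuples n q ] confused M (suc T) z

      instance
        n≢0 : NonZero n
        n≢0 = >-nonZero 0<n
        n^q≢0 : NonZero (n ^ q)
        n^q≢0 = m^n≢0 n q
        nn≢0 : NonZero (n * n)
        nn≢0 = m*n≢0 n n
        T^q≢0 : NonZero (suc T ^ q)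
        T^q≢0 = m^n≢0 (suc T) q

      lemma₁ : ∀ a b → a * (2 * b) ≡ 2 * (a * b)
      lemma₁ = solve-∀
      lemma₂ : ∀ a m f b → 2 * (a * (m * (f * b))) ≡ m * (2 * f * a * b)
      lemma₂ = solve-∀

      Σr-small : 2 * Σr < n ^ q
      Σr-small = *-cancelˡ-< (n ^ t) _ _ (begin-strict
        n ^ t * (2 * Σr)              ≡⟨ lemma₁ (n ^ t) Σr ⟩
        2 * (n ^ t * Σr)              ≤⟨ *-monoʳ-≤ 2 (∑-robustSels M t q Θ) ⟩
        2 * (a * (n ^ q * R))         ≤⟨ *-monoʳ-≤ 2 (*-monoʳ-≤ a (*-monoʳ-≤ (n ^ q) (∑-robust≤ M t Θ 0<n))) ⟩
        2 * (a * (n ^ q * (t ! * B))) ≡⟨ lemma₂ a (n ^ q) (t !) B ⟩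
        n ^ q * (2 * t ! * a * B)     <⟨ *-monoʳ-< (n ^ q) few ⟩
        n ^ q * n ^ t                 ≡⟨ *-comm (n ^ q) (n ^ t) ⟩
        n ^ t * n ^ q                 ∎)

      lemma₃ : ∀ s x c → s * (2 * (2 * x * c)) ≡ 4 * x * (s * c)
      lemma₃ = solve-∀
      lemma₄ : ∀ x m u v → 4 * x * (m * (u * v)) ≡ 4 * x * u * (m * v)
      lemma₄ = solve-∀

      Σc-small : 2 * (Q * Σc) ≤ n * n * n ^ q
      Σc-small = *-cancelˡ-≤ (suc T ^ q) (begin
        suc T ^ q * (2 * (Q * Σc))                ≡⟨ lemma₃ (suc T ^ q) (Θ * Θ) Σc ⟩
        4 * (Θ * Θ) * (suc T ^ q * Σc)            ≤⟨ *-monoʳ-≤ (4 * (Θ * Θ)) (∑-confused M T q) ⟩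
        4 * (Θ * Θ) * (n * n * (T ^ q * n ^ q))   ≡⟨ lemma₄ (Θ * Θ) (n * n) (T ^ q) (n ^ q) ⟩
        4 * (Θ * Θ) * T ^ q * (n * n * n ^ q)     ≤⟨ *-monoˡ-≤ (n * n * n ^ q) hq ⟩
        suc T ^ q * (n * n * n ^ q)               ∎)

      lemma₅ : ∀ m r c → 2 * (m * r + c) ≡ m * (2 * r) + 2 * c
      lemma₅ = solve-∀
      lemma₆ : ∀ m k → m * k + m * k ≡ 2 * (k * m)
      lemma₆ = solve-∀

      Σf-small : ∑ (tuples n q) f < length (tuples n q) * (n * n)
      Σf-small = *-cancelˡ-< 2 _ _ (begin-strict
        2 * ∑ (tuples n q) f                          ≡⟨ cong (2 *_) (trans (∑-+ (tuples n q) _ _)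
                                                           (cong₂ _+_ (∑-*ˡ (tuples n q) (n * n) _) (∑-*ˡ (tuples n q) Q _))) ⟩
        2 * (n * n * Σr + Q * Σc)                     ≡⟨ lemma₅ (n * n) Σr (Q * Σc) ⟩
        n * n * (2 * Σr) + 2 * (Q * Σc)               <⟨ +-mono-<-≤ (*-monoʳ-< (n * n) Σr-small) Σc-small ⟩
        n * n * n ^ q + n * n * n ^ q                 ≡⟨ lemma₆ (n * n) (n ^ q) ⟩
        2 * (n ^ q * (n * n))                         ≡⟨ cong (λ m → 2 * (m * (n * n))) (length-tuples n q) ⟨
        2 * (length (tuples n q) * (n * n))           ∎)

      z = proj₁ (∑-< (tuples n q) Σf-small)
      bound : f z < n * n
      bound = proj₂ (∑-< (tuples n q) Σf-small)
      r<1 : robustSels M t Θ z < 1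
      r<1 = *-cancelˡ-< (n * n) _ _ (≤-<-trans (m≤m+n _ _) (<-≤-trans bound (≤-reflexive (sym (*-identityʳ (n * n))))))

    module _ {P : Fin n → Set} (P? : ∀ i → Dec (P i)) where

      class? : ∀ {q} (z : Vec (Fin n) q) v i → Dec (P i × Vec.map (entry M i) z ≡ v)
      class? z v i = P? i ×-dec (Vec.map (entry M i) z ≟ᵛ v)

      -- Discarding the rows that realise a rare pattern leaves rows that shatter no t
      -- of the columns z, hence with few patterns on z.
      large-class : ∀ t q E (z : Vec (Fin n) q) → let Θ = 2 * E * suc q ^ t in
        robustSels M t Θ z ≡ 0 → n < E * ∑[ i ∈ allFin n ] ⟦ P? i ⟧ →
        ∃[ v ] n < Θ * ∑[ i ∈ allFin n ] ⟦ class? z v i ⟧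
      large-class t q E z none many = v , (begin-strict
        n                                              <⟨ n<X′ ⟩
        2 * E * X′                                     ≤⟨ *-monoʳ-≤ (2 * E) X′≤ ⟩
        2 * E * (length V * C′ v)                      ≤⟨ *-monoʳ-≤ (2 * E) (*-mono-≤ (proj₁ (proj₂ cover)) C′≤) ⟩
        2 * E * (a * ∑[ i ∈ allFin n ] ⟦ class? z v i ⟧) ≡⟨ *-assoc (2 * E) a _ ⟨
        Θ * ∑[ i ∈ allFin n ] ⟦ class? z v i ⟧         ∎)
        where
        a Θ : ℕ
        a = suc q ^ t
        Θ = 2 * E * a

        instance
          a≢0 : NonZero a
          a≢0 = m^n≢0 (suc q) t

        rare : ∀ σ → ∃[ b ] Θ * freq M b (sel σ z) < n
        rare σ = ¬robust M {Θ = Θ} (sel σ z) λ r → 1+n≰n (begin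
          1                              ≡⟨ ⟦⟧-yes (robust? M Θ (sel σ z)) r ⟨
          ⟦ robust? M Θ (sel σ z) ⟧      ≤⟨ ∑-∈ (λ σ → ⟦ robust? M Θ (sel σ z) ⟧) (∈-sels σ) ⟩
          robustSels M t Θ z             ≡⟨ none ⟩
          0                              ∎)

        b : Sel t q → Vec Bool t
        b σ = proj₁ (rare σ)

        Hit : Fin n → Sel t q → Set
        Hit i σ = Vec.map (entry M i) (sel σ z) ≡ b σ

        Kept : Fin n → Set
        Kept i = P i × ListAll.All (λ σ → ¬ Hit i σ) (sels t q)

        hit? : ∀ i σ → Dec (Hit i σ)
        hit? i σ = Vec.map (entry M i) (sel σ z) ≟ᵛ b σ

        kept? : ∀ i → Dec (Kept i)
        kept? i = P? i ×-dec ListAll.all? (λ σ → ¬? (hit? i σ)) (sels t q)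

        X X′ Lost : ℕ
        X    = ∑[ i ∈ allFin n ] ⟦ P? i ⟧
        X′   = ∑[ i ∈ allFin n ] ⟦ kept? i ⟧
        Lost = ∑[ σ ∈ sels t q ] freq M (b σ) (sel σ z)

        kept-or-hit : ∀ i → P i → 1 ≤ ⟦ kept? i ⟧ + ∑[ σ ∈ sels t q ] ⟦ hit? i σ ⟧
        kept-or-hit i p = cases (ListAll.all? (λ σ → ¬? (hit? i σ)) (sels t q))
          where
          cases : Dec (ListAll.All (λ σ → ¬ Hit i σ) (sels t q)) → 1 ≤ ⟦ kept? i ⟧ + ∑[ σ ∈ sels t q ] ⟦ hit? i σ ⟧
          cases (yes k) = ≤-trans (≤-reflexive (sym (⟦⟧-yes (kept? i) (p , k)))) (m≤m+n _ _)
          cases (no ¬k) =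
            let σ , σ∈ , ¬¬h = find (ListAll.¬All⇒Any¬ (λ σ → ¬? (hit? i σ)) (sels t q) ¬k) in
            ≤-trans (≤-reflexive (sym (⟦⟧-yes (hit? i σ) (decidable-stable (hit? i σ) ¬¬h))))
              (≤-trans (∑-∈ (λ σ → ⟦ hit? i σ ⟧) σ∈) (m≤n+m _ _))

        X≤ : X ≤ X′ + Lost
        X≤ = begin
          X
            ≤⟨ ∑-mono′ (allFin n) (λ i → ⟦⟧-≤ (P? i) (kept-or-hit i)) ⟩
          ∑[ i ∈ allFin n ] (⟦ kept? i ⟧ + ∑[ σ ∈ sels t q ] ⟦ hit? i σ ⟧)
            ≡⟨ ∑-+ (allFin n) _ _ ⟩
          X′ + ∑[ i ∈ allFin n ] ∑[ σ ∈ sels t q ] ⟦ hit? i σ ⟧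
            ≡⟨ cong (X′ +_) (∑-swap (allFin n) (sels t q) (λ i σ → ⟦ hit? i σ ⟧)) ⟩
          X′ + Lost ∎

        lemma₁ : ∀ a e l → a * (2 * e * l) ≡ 2 * e * a * l
        lemma₁ = solve-∀
        lemma₂ : ∀ e x l → 2 * e * (x + l) ≡ 2 * e * l + 2 * e * x
        lemma₂ = solve-∀
        lemma₃ : ∀ e x → 2 * (e * x) ≡ 2 * e * x
        lemma₃ = solve-∀

        -- There are at most (q + 1)^t selections, each losing fewer than n / Θ rows. The definition
        -- of Θ turns this into n / 2E, half of what `many` guarantees.
        Lost-small : 2 * E * Lost ≤ n
        Lost-small = *-cancelˡ-≤ a (begin
          a * (2 * E * Lost)       ≡⟨ lemma₁ a E Lost ⟩
          Θ * Lost                 ≡⟨ ∑-*ˡ (sels t q) Θ _ ⟨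
          ∑[ σ ∈ sels t q ] (Θ * freq M (b σ) (sel σ z))
                                   ≤⟨ ∑-≤-const (sels t q) (λ σ _ → <⇒≤ (proj₂ (rare σ))) ⟩
          length (sels t q) * n    ≤⟨ *-monoˡ-≤ n (length-sels t q) ⟩
          a * n                    ∎)

        n<X′ : n < 2 * E * X′
        n<X′ = +-cancelˡ-< n _ _ (begin-strict
          n + n                        ≡⟨ cong (n +_) (+-identityʳ n) ⟨
          2 * n                        <⟨ *-monoʳ-< 2 many ⟩
          2 * (E * X)                  ≡⟨ lemma₃ E X ⟩
          2 * E * X                    ≤⟨ *-monoʳ-≤ (2 * E) X≤ ⟩
          2 * E * (X′ + Lost)          ≡⟨ lemma₂ E X′ Lost ⟩
          2 * E * Lost + 2 * E * X′    ≤⟨ +-monoˡ-≤ (2 * E * X′) Lost-small ⟩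
          n + 2 * E * X′               ∎)

        Pattern : Vec Bool q → Set
        Pattern v = ∃[ i ] (Kept i × Vec.map (entry M i) z ≡ v)

        cover : ∃[ V ] length V ≤ suc q ^ t × (∀ v → Pattern v → v ∈ V)
        -- If the kept patterns shattered σ, a kept row would show the rare pattern `b σ`, contrary
        -- to its being kept.
        cover = sauer-shelah t q (λ v → Fin.any? λ i → kept? i ×-dec (Vec.map (entry M i) z ≟ᵛ v)) λ σ sh →
          let v , (i , (_ , kept) , eq) , selv≡b = sh (b σ)
          in ListAll.lookup kept (∈-sels σ) (trans (sel-map (entry M i) σ z) (trans (cong (sel σ) eq) selv≡b))

        V = proj₁ cover
        C′ : Vec Bool q → ℕ
        C′ v = ∑[ i ∈ allFin n ] ⟦ kept? i ×-dec (Vec.map (entry M i) z ≟ᵛ v) ⟧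

        best : ∃[ v ] ∑ V C′ ≤ length V * C′ v
        best = ∑-max V C′ (Vec.replicate q true)
        v = proj₁ best

        C′≤ : C′ v ≤ ∑[ i ∈ allFin n ] ⟦ class? z v i ⟧
        C′≤ = ∑-mono′ (allFin n) λ i → ⟦⟧-mono (kept? i ×-dec (Vec.map (entry M i) z ≟ᵛ v)) (class? z v i)
          λ ((p , _) , eq) → p , eq

        X′≤ : X′ ≤ length V * C′ v
        X′≤ = begin
          X′
            ≤⟨ ∑-mono′ (allFin n) (λ i → ⟦⟧-≤ (kept? i) λ k → let v = Vec.map (entry M i) z in
                 ≤-trans (≤-reflexive (sym (⟦⟧-yes (kept? i ×-dec (v ≟ᵛ v)) (k , refl))))
                         (∑-∈ (λ w → ⟦ kept? i ×-dec (v ≟ᵛ w) ⟧) (proj₂ (proj₂ cover) v (i , k , refl)))) ⟩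
          ∑[ i ∈ allFin n ] ∑[ w ∈ V ] ⟦ kept? i ×-dec (Vec.map (entry M i) z ≟ᵛ w) ⟧
            ≡⟨ ∑-swap (allFin n) V (λ i w → ⟦ kept? i ×-dec (Vec.map (entry M i) z ≟ᵛ w) ⟧) ⟩
          ∑ V C′
            ≤⟨ proj₂ best ⟩
          length V * C′ v ∎

      -- The ball of a sparse row has fewer than n / 2Θ elements, less than half the class. Every
      -- row of the class is thus far from more than half of it, yet agrees with it on z, and these
      -- pairs are confused.
      class-confused : ∀ {q} T Θ (z : Vec (Fin n) q) v → (∀ i → P i → 2 * Θ * ball M T i < n) →
        let m = ∑[ i ∈ allFin n ] ⟦ class? z v i ⟧ in
        n < Θ * m → m * m ≤ 2 * confused M T z
      class-confused T Θ z v sparse n<Θm = *-cancelˡ-≤ Θ {{Θ≢0}} (+-cancelˡ-≤ (Θ * (m * m)) _ _ (begin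
        Θ * (m * m) + Θ * (m * m)                  ≡⟨ lemma₁ Θ (m * m) ⟩
        2 * Θ * (m * m)                            ≤⟨ *-monoʳ-≤ (2 * Θ) mm≤ ⟩
        2 * Θ * (∑[ i ∈ allFin n ] (C i * ball M T i) + confused M T z)
          ≡⟨ *-distribˡ-+ (2 * Θ) _ (confused M T z) ⟩
        2 * Θ * ∑[ i ∈ allFin n ] (C i * ball M T i) + 2 * Θ * confused M T z
          ≤⟨ +-monoˡ-≤ (2 * Θ * confused M T z) balls ⟩
        Θ * (m * m) + 2 * Θ * confused M T z       ≡⟨ cong (Θ * (m * m) +_) (lemma₂ Θ (confused M T z)) ⟩
        Θ * (m * m) + Θ * (2 * confused M T z)     ∎))
        where
        C : Fin n → ℕ
        C i = ⟦ class? z v i ⟧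
        m = ∑ (allFin n) C

        Θ≢0 : NonZero Θ
        Θ≢0 = m*n≢0⇒m≢0 Θ {m} {{>-nonZero (≤-<-trans z≤n n<Θm)}}

        lemma₁ : ∀ a b → a * b + a * b ≡ 2 * a * b
        lemma₁ = solve-∀
        lemma₂ : ∀ a b → 2 * a * b ≡ a * (2 * b)
        lemma₂ = solve-∀
        lemma₃ : ∀ a b c → a * (b * c) ≡ b * (a * c)
        lemma₃ = solve-∀

        row : ∀ i → C i * m ≤ C i * ball M T i + ∑[ i′ ∈ allFin n ] ⟦ far? M T i i′ z ⟧
        row i with class? z v i
        ... | no  _        = z≤n
        ... | yes (_ , eq) = begin
          1 * m    ≡⟨ *-identityˡ m ⟩
          m        ≤⟨ ∑-mono′ (allFin n) (λ i′ → ⟦⟧-≤ (class? z v i′) λ (_ , eq′) → close-or-far i′ eq′) ⟩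
          ∑[ i′ ∈ allFin n ] (⟦ close? M T i i′ ⟧ + ⟦ far? M T i i′ z ⟧)
                   ≡⟨ ∑-+ (allFin n) _ _ ⟩
          ball M T i + ∑[ i′ ∈ allFin n ] ⟦ far? M T i i′ z ⟧
                   ≡⟨ cong (_+ ∑[ i′ ∈ allFin n ] ⟦ far? M T i i′ z ⟧) (*-identityˡ (ball M T i)) ⟨
          1 * ball M T i + ∑[ i′ ∈ allFin n ] ⟦ far? M T i i′ z ⟧ ∎
          where
          close-or-far : ∀ i′ → Vec.map (entry M i′) z ≡ v → 1 ≤ ⟦ close? M T i i′ ⟧ + ⟦ far? M T i i′ z ⟧
          close-or-far i′ eq′ = cases (close? M T i i′)
            where
            cases : Dec (Close M T i i′) → 1 ≤ ⟦ close? M T i i′ ⟧ + ⟦ far? M T i i′ z ⟧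
            cases (yes c) = ≤-trans (≤-reflexive (sym (⟦⟧-yes (close? M T i i′) c))) (m≤m+n _ _)
            cases (no ¬c) = ≤-trans (≤-reflexive (sym (⟦⟧-yes (far? M T i i′ z) (¬c , trans eq (sym eq′))))) (m≤n+m _ _)

        mm≤ : m * m ≤ ∑[ i ∈ allFin n ] (C i * ball M T i) + confused M T z
        mm≤ = begin
          m * m                               ≡⟨ ∑-*ʳ (allFin n) m C ⟨
          ∑[ i ∈ allFin n ] (C i * m)         ≤⟨ ∑-mono′ (allFin n) row ⟩
          ∑[ i ∈ allFin n ] (C i * ball M T i + ∑[ i′ ∈ allFin n ] ⟦ far? M T i i′ z ⟧)
                                              ≡⟨ ∑-+ (allFin n) _ _ ⟩
          ∑[ i ∈ allFin n ] (C i * ball M T i) + confused M T z ∎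

        balls : 2 * Θ * ∑[ i ∈ allFin n ] (C i * ball M T i) ≤ Θ * (m * m)
        balls = begin
          2 * Θ * ∑[ i ∈ allFin n ] (C i * ball M T i)     ≡⟨ ∑-*ˡ (allFin n) (2 * Θ) _ ⟨
          ∑[ i ∈ allFin n ] (2 * Θ * (C i * ball M T i))   ≡⟨ ∑-cong (allFin n) (λ i → lemma₃ (2 * Θ) (C i) (ball M T i)) ⟩
          ∑[ i ∈ allFin n ] (C i * (2 * Θ * ball M T i))   ≤⟨ ∑-mono′ (allFin n) (λ i →
                                                                ⟦⟧-* (class? z v i) λ (p , _) → <⇒≤ (sparse i p)) ⟩
          ∑[ i ∈ allFin n ] (C i * n)                      ≡⟨ ∑-*ʳ (allFin n) n C ⟩
          m * n                                            ≤⟨ *-monoʳ-≤ m (<⇒≤ n<Θm) ⟩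
          m * (Θ * m)                                      ≡⟨ lemma₃ m Θ m ⟩
          Θ * (m * m)                                      ∎

    dense-or-robust : ∀ t q T E → let Θ = 2 * E * suc q ^ t in 4 * (Θ * Θ) * T ^ q ≤ suc T ^ q →
      E * ∑[ i ∈ allFin n ] ⟦ ¬? (dense? M (suc T) (2 * Θ) i) ⟧ ≤ n ⊎
      n ^ t ≤ 2 * t ! * suc q ^ t * ∑[ z ∈ tuples n t ] ⟦ sorted×robust? M Θ z ⟧
    dense-or-robust t q T E hq
      with n ^ t ≤? 2 * t ! * suc q ^ t * ∑[ z ∈ tuples n t ] ⟦ sorted×robust? M (2 * E * suc q ^ t) z ⟧
         | E * ∑[ i ∈ allFin n ] ⟦ ¬? (dense? M (suc T) (2 * (2 * E * suc q ^ t)) i) ⟧ ≤? n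
    ... | yes many | _        = inj₂ many
    ... | no  _    | yes few  = inj₁ few
    -- The sample confuses fewer than n² / 2Θ² pairs, whereas a class of m > n / Θ sparse rows with
    -- a common pattern forces at least m² / 2.
    ... | no  few  | no  many = ⊥-elim (<-irrefl refl (begin-strict
          2 * (Θ * Θ) * (m * m)                       ≤⟨ *-monoʳ-≤ (2 * (Θ * Θ)) (class-confused sparse? (suc T) Θ z v (λ _ → ≰⇒>) n<Θm) ⟩
          2 * (Θ * Θ) * (2 * confused M (suc T) z)    ≡⟨ lemma₁ (2 * (Θ * Θ)) (confused M (suc T) z) ⟩
          2 * (2 * (Θ * Θ) * confused M (suc T) z)    <⟨ *-monoʳ-< 2 (proj₂ (proj₂ sample)) ⟩
          2 * (n * n)                                 ≤⟨ *-monoʳ-≤ 2 (*-mono-≤ (<⇒≤ n<Θm) (<⇒≤ n<Θm)) ⟩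
          2 * (Θ * m * (Θ * m))                       ≡⟨ lemma₂ Θ m ⟩
          2 * (Θ * Θ) * (m * m)                       ∎))
      where
      Θ = 2 * E * suc q ^ t
      sparse? : ∀ i → Dec (¬ Dense M (suc T) (2 * Θ) i)
      sparse? i = ¬? (dense? M (suc T) (2 * Θ) i)
      sample : Σ[ z ∈ Vec (Fin n) q ] (robustSels M t Θ z ≡ 0 × 2 * (Θ * Θ) * confused M (suc T) z < n * n)
      sample = good-sample t q T Θ hq (≰⇒> few)
      z = proj₁ sample
      class : ∃[ v ] n < Θ * ∑[ i ∈ allFin n ] ⟦ class? sparse? z v i ⟧
      class = large-class sparse? t q E z (proj₁ (proj₂ sample)) (≰⇒> many)
      v = proj₁ class
      m = ∑[ i ∈ allFin n ] ⟦ class? sparse? z v i ⟧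
      n<Θm : n < Θ * m
      n<Θm = proj₂ class
      lemma₁ : ∀ a b → a * (2 * b) ≡ 2 * (a * b)
      lemma₁ = solve-∀
      lemma₂ : ∀ a b → 2 * (a * b * (a * b)) ≡ 2 * (a * a) * (b * b)
      lemma₂ = solve-∀

  -- Hitting sets, retractions and sample sizes

  -- The first two terms of the binomial expansion of (T + 1)^(k + 1).
  bernoulli : ∀ T k → T ^ suc k + suc k * T ^ k ≤ suc T ^ suc k
  bernoulli T zero    = ≤-reflexive (lemma T)
    where
    lemma : ∀ T → T * 1 + 1 ≡ suc T * 1
    lemma = solve-∀
  bernoulli T (suc k) = begin
    T * (T * u) + (2 + k) * (T * u)                         ≤⟨ m≤m+n _ (suc k * u) ⟩
    T * (T * u) + (2 + k) * (T * u) + suc k * u             ≡⟨ lemma T u k ⟩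
    suc T * (T * u + suc k * u)                             ≤⟨ *-monoʳ-≤ (suc T) (bernoulli T k) ⟩
    suc T * suc T ^ suc k                                   ∎
    where
    u = T ^ k
    lemma : ∀ T u k → T * (T * u) + (2 + k) * (T * u) + (1 + k) * u ≡ (1 + T) * (T * u + (1 + k) * u)
    lemma = solve-∀

  -- Each batch of T + 1 samples gains a factor 2, because (T + 1)^(T + 1) ≥ 2 T^(T + 1).
  2^k-gain : ∀ T k → 2 ^ k * T ^ (suc T * k) ≤ suc T ^ (suc T * k)
  2^k-gain T k = begin
    2 ^ k * T ^ (suc T * k)       ≡⟨ cong (2 ^ k *_) (^-*-assoc T (suc T) k) ⟨
    2 ^ k * (T ^ suc T) ^ k       ≡⟨ ^-distribʳ-* k 2 (T ^ suc T) ⟨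
    (2 * T ^ suc T) ^ k           ≤⟨ ^-monoˡ-≤ k double ⟩
    (suc T ^ suc T) ^ k           ≡⟨ ^-*-assoc (suc T) (suc T) k ⟩
    suc T ^ (suc T * k)           ∎
    where
    double : 2 * T ^ suc T ≤ suc T ^ suc T
    double = begin
      2 * (T * T ^ T)               ≡⟨ cong (T ^ suc T +_) (+-identityʳ (T ^ suc T)) ⟩
      T ^ suc T + T * T ^ T         ≤⟨ +-monoʳ-≤ (T ^ suc T) (*-monoˡ-≤ (T ^ T) (n≤1+n T)) ⟩
      T ^ suc T + suc T * T ^ T     ≤⟨ bernoulli T T ⟩
      suc T ^ suc T                 ∎

  -- Solves a circular requirement, as the quantity to be beaten grows with q. For c = 4t + 1 and m
  -- = W + S c, the size q = S c m satisfies q + 1 ≤ (m + 1)². Hence W (q + 1)^(2t) ≤ (m + 1)^c ≤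
  -- 2^(c m), the gain of c m batches of S samples.
  sampleSize : ℕ → ℕ → ℕ → ℕ
  sampleSize W t S = S * (suc (4 * t) * (W + S * suc (4 * t)))

  sampleSize-large : ∀ W t T → let q = sampleSize W t (suc T) in
                     W * (suc q ^ t * suc q ^ t) * T ^ q ≤ suc T ^ q
  sampleSize-large W t T = begin
    W * (suc q ^ t * suc q ^ t) * T ^ q     ≤⟨ *-monoˡ-≤ (T ^ q) bound ⟩
    2 ^ (c * m) * T ^ q                     ≤⟨ 2^k-gain T (c * m) ⟩
    suc T ^ q                               ∎
    where
    c m q : ℕ
    c = suc (4 * t)
    m = W + suc T * c
    q = suc T * (c * m)

    suc-m≤2^m : ∀ m → suc m ≤ 2 ^ m
    suc-m≤2^m zero    = ≤-refl
    suc-m≤2^m (suc m) = begin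
      1 + suc m           ≤⟨ +-mono-≤ (m^n>0 2 m) (suc-m≤2^m m) ⟩
      2 ^ m + 2 ^ m       ≡⟨ cong (2 ^ m +_) (+-identityʳ (2 ^ m)) ⟨
      2 ^ suc m           ∎

    q<mm : suc q ≤ suc m * suc m
    q<mm = begin
      suc (suc T * (c * m))        ≡⟨ cong suc (*-assoc (suc T) c m) ⟨
      suc (suc T * c * m)          ≤⟨ s≤s (*-monoˡ-≤ m (m≤n+m (suc T * c) W)) ⟩
      suc (m * m)                  ≤⟨ s≤s (≤-trans (m≤n+m (m * m) (m + m)) (≤-reflexive (lemma m))) ⟩
      suc m * suc m                ∎
      where
      lemma : ∀ m → m + m + m * m ≡ m + m * (1 + m)
      lemma = solve-∀

    four : ∀ a t → a ^ (4 * t) ≡ (a * a) ^ t * (a * a) ^ t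
    four a t = begin-equality
      a ^ (4 * t)                ≡⟨ ^-*-assoc a 4 t ⟨
      (a ^ 4) ^ t                ≡⟨ cong (_^ t) (lemma a) ⟩
      (a * a * (a * a)) ^ t      ≡⟨ ^-distribʳ-* t (a * a) (a * a) ⟩
      (a * a) ^ t * (a * a) ^ t  ∎
      where
      lemma : ∀ a → a * (a * (a * (a * 1))) ≡ a * a * (a * a)
      lemma = solve-∀

    bound : W * (suc q ^ t * suc q ^ t) ≤ 2 ^ (c * m)
    bound = begin
      W * (suc q ^ t * suc q ^ t)
        ≤⟨ *-mono-≤ (≤-trans (m≤m+n W (suc T * c)) (n≤1+n m)) (*-mono-≤ (^-monoˡ-≤ t q<mm) (^-monoˡ-≤ t q<mm)) ⟩
      suc m * ((suc m * suc m) ^ t * (suc m * suc m) ^ t)   ≡⟨ cong (suc m *_) (four (suc m) t) ⟨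
      suc m ^ c                                             ≤⟨ ^-monoˡ-≤ c (suc-m≤2^m m) ⟩
      (2 ^ m) ^ c                                           ≡⟨ ^-*-assoc 2 m c ⟩
      2 ^ (m * c)                                           ≡⟨ cong (2 ^_) (*-comm m c) ⟩
      2 ^ (c * m)                                           ∎

  module _ {n : ℕ} where

    Between : (Fin n → Set) → ℕ → ℕ → Fin n → Set
    Between C p u j = p ≤ toℕ j × toℕ j < u × C j

    between? : ∀ {C} → (∀ j → Dec (C j)) → ∀ p u j → Dec (Between C p u j)
    between? C? p u j = (p ≤? toℕ j) ×-dec (toℕ j <? u) ×-dec C? j

    module _ {C : Fin n → Set} (C? : ∀ j → Dec (C j)) (p : ℕ) where

      #between : ℕ → ℕ
      #between u = ∑[ j ∈ allFin n ] ⟦ between? C? p u j ⟧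

      #between-suc : ∀ u → #between (suc u) ≤ suc (#between u)
      #between-suc u = begin
        #between (suc u)
          ≤⟨ ∑-mono′ (allFin n) (λ j → ⟦⟧-≤ (between? C? p (suc u) j) (split j)) ⟩
        ∑[ j ∈ allFin n ] (⟦ toℕ j ≟ u ⟧ + ⟦ between? C? p u j ⟧)
          ≡⟨ ∑-+ (allFin n) _ _ ⟩
        ∑[ j ∈ allFin n ] ⟦ toℕ j ≟ u ⟧ + #between u
          ≤⟨ +-monoˡ-≤ (#between u) (∑-Unique (λ j → toℕ j ≟ u) (ListUnique.allFin⁺ n)
               (λ e e′ → Fin.toℕ-injective (trans e (sym e′)))) ⟩
        suc (#between u) ∎
        where
        split : ∀ j → Between C p (suc u) j → 1 ≤ ⟦ toℕ j ≟ u ⟧ + ⟦ between? C? p u j ⟧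
        split j (p≤j , s≤s j≤u , c) with m≤n⇒m<n∨m≡n j≤u
        ... | inj₁ j<u = ≤-trans (≤-reflexive (sym (⟦⟧-yes (between? C? p u j) (p≤j , j<u , c)))) (m≤n+m _ _)
        ... | inj₂ j≡u = ≤-trans (≤-reflexive (sym (⟦⟧-yes (toℕ j ≟ u) j≡u))) (m≤m+n _ _)

      -- A discrete intermediate value argument: the count starts at 0 and grows by at most one per
      -- index, so it cannot jump over m.
      threshold : ∀ m u → #between u < m ⊎ ∃[ p′ ] #between p′ ≡ m
      threshold zero    zero = inj₂ (0 , n≤0⇒n≡0 (≤-trans (∑-≤-const (allFin n) λ j _ →
        ≤-reflexive (⟦⟧-no (between? C? p 0 j) λ ())) (≤-reflexive (*-zeroʳ (length (allFin n))))))
      threshold (suc m) zero = inj₁ (s≤s (≤-trans (∑-≤-const (allFin n) λ j _ →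
        ≤-reflexive (⟦⟧-no (between? C? p 0 j) λ ())) (≤-trans (≤-reflexive (*-zeroʳ (length (allFin n)))) z≤n)))
      threshold m (suc u) with threshold m u
      ... | inj₂ found = inj₂ found
      ... | inj₁ small with m≤n⇒m<n∨m≡n (≤-trans (#between-suc u) small)
      ...   | inj₁ still = inj₁ still
      ...   | inj₂ equal = inj₂ (suc u , equal)

    -- Copies in M need strictly increasing columns. Columns of the cleaned matrix may be moved onto
    -- the same column of M, so they yield only weakly increasing sequences, and these are what a
    -- hitting set must meet.
    Increasing Weakly : ∀ {t} → ℕ → (Fin t → Fin n → Set) → Vec (Fin n) t → Set
    Increasing p C []      = ⊤
    Increasing p C (j ∷ z) = (p ≤ toℕ j × C zero j) × Increasing (suc (toℕ j)) (λ k → C (suc k)) z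
    Weakly     p C []      = ⊤
    Weakly     p C (j ∷ z) = (p ≤ toℕ j × C zero j) × Weakly (toℕ j) (λ k → C (suc k)) z

    increasing? : ∀ {t} p {C : Fin t → Fin n → Set} → (∀ k j → Dec (C k j)) → ∀ z → Dec (Increasing p C z)
    increasing? p C? []      = yes tt
    increasing? p C? (j ∷ z) = ((p ≤? toℕ j) ×-dec C? zero j) ×-dec increasing? (suc (toℕ j)) (λ k → C? (suc k)) z

    increasing-weaken : ∀ {t p p′} {C : Fin t → Fin n → Set} {z} → p′ ≤ p → Increasing p C z → Increasing p′ C z
    increasing-weaken {z = []}    _    _               = tt
    increasing-weaken {z = j ∷ z} p′≤p ((p≤j , c) , h) = (≤-trans p′≤p p≤j , c) , h

    weakly-weaken : ∀ {t p p′} {C : Fin t → Fin n → Set} {z} → p′ ≤ p → Weakly p C z → Weakly p′ C z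
    weakly-weaken {z = []}    _    _               = tt
    weakly-weaken {z = j ∷ z} p′≤p ((p≤j , c) , h) = (≤-trans p′≤p p≤j , c) , h

    increasing⇒Linked : ∀ {t p} {C : Fin t → Fin n → Set} z → Increasing p C z → Linked Fin._<_ z
    increasing⇒Linked []          _                   = []
    increasing⇒Linked (j ∷ [])    _                   = [-]
    increasing⇒Linked {C = C} (j ∷ k ∷ z) (_ , h@((j<k , _) , _)) =
      j<k ∷ increasing⇒Linked {C = λ i → C (suc i)} (k ∷ z) h

    increasing⇒lookup : ∀ {t p} {C : Fin t → Fin n → Set} z → Increasing p C z → ∀ k → C k (lookup z k)
    increasing⇒lookup (j ∷ z) ((_ , c) , _) zero    = c
    increasing⇒lookup (j ∷ z) (_ , h)       (suc k) = increasing⇒lookup z h k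

    Linked⇒weakly : ∀ {t} {C : Fin t → Fin n → Set} z → Linked Fin._≤_ z → (∀ k → C k (lookup z k)) → Weakly 0 C z
    Linked⇒weakly []          _         _ = tt
    Linked⇒weakly (j ∷ [])    _         c = (z≤n , c zero) , tt
    Linked⇒weakly {C = C} (j ∷ k ∷ z) (j≤k ∷ l) c with Linked⇒weakly {C = λ i → C (suc i)} (k ∷ z) l (λ i → c (suc i))
    ... | (_ , ck) , h = (z≤n , c zero) , (j≤k , ck) , h

    -- Either the sets C k contain blocks of m elements with block k entirely before
    -- block k + 1, or the search for these blocks, from left to right, stops early
    -- and the elements inspected so far meet every weakly increasing transversal.
    blocks-or-hittingSet : ∀ t m p {C : Fin t → Fin n → Set} (C? : ∀ k j → Dec (C k j)) →
      (∃[ D ] length D ≤ t * m × (∀ z → Weakly p C z → ∃[ k ] lookup z k ∈ D)) ⊎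
      m ^ t ≤ ∑[ z ∈ tuples n t ] ⟦ increasing? p C? z ⟧
    blocks-or-hittingSet zero    m p C? = inj₂ ≤-refl
    blocks-or-hittingSet (suc t) m p {C} C? with threshold (C? zero) p m n
    ... | inj₁ few = inj₁ (D , ≤-trans (≤-reflexive (length-filter (between? (C? zero) p n) (allFin n)))
                                       (≤-trans (<⇒≤ few) (m≤m+n m (t * m))) , hits)
      where
      D = filter (between? (C? zero) p n) (allFin n)
      hits : ∀ z → Weakly p C z → ∃[ k ] lookup z k ∈ D
      hits (j ∷ z) ((p≤j , c) , _) =
        zero , ∈-filter⁺ (between? (C? zero) p n) (∈-allFin j) (p≤j , Fin.toℕ<n j , c)
    ... | inj₂ (p′ , #≡m) with blocks-or-hittingSet t m p′ (λ k → C? (suc k))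
    ...   | inj₁ (D′ , D′≤ , hits′) = inj₁ (D ++ D′ , len , hits)
      where
      D = filter (between? (C? zero) p p′) (allFin n)
      len : length (D ++ D′) ≤ m + t * m
      len = begin
        length (D ++ D′)         ≡⟨ length-++ D ⟩
        length D + length D′     ≡⟨ cong (_+ length D′) (trans (length-filter (between? (C? zero) p p′) (allFin n)) #≡m) ⟩
        m + length D′            ≤⟨ +-monoʳ-≤ m D′≤ ⟩
        m + t * m                ∎
      hits : ∀ z → Weakly p C z → ∃[ k ] lookup z k ∈ D ++ D′
      hits (j ∷ z) ((p≤j , c) , h) with toℕ j <? p′
      ... | yes j<p′ = zero , ∈-++⁺ˡ (∈-filter⁺ (between? (C? zero) p p′) (∈-allFin j) (p≤j , j<p′ , c))
      -- A first column at or beyond p′ can escape D, but then the tail also stays at or beyond p′,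
      -- where D′ meets it.
      ... | no  j≮p′ = let k , k∈ = hits′ z (weakly-weaken {z = z} (≮⇒≥ j≮p′) h) in suc k , ∈-++⁺ʳ D k∈
    ...   | inj₂ many = inj₂ (begin
      m * m ^ t                                                   ≤⟨ *-monoʳ-≤ m many ⟩
      m * I                                                       ≡⟨ cong (_* I) #≡m ⟨
      #between (C? zero) p p′ * I                                 ≡⟨ ∑-*ʳ (allFin n) I _ ⟨
      ∑[ j ∈ allFin n ] (⟦ between? (C? zero) p p′ j ⟧ * I)       ≤⟨ ∑-mono′ (allFin n) extend ⟩
      ∑[ j ∈ allFin n ] ∑[ z ∈ tuples n t ] ⟦ increasing? p C? (j ∷ z) ⟧
                                                                  ≡⟨ ∑-tuples n t _ ⟨
      ∑[ z ∈ tuples n (suc t) ] ⟦ increasing? p C? z ⟧            ∎)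
      where
      I = ∑[ z ∈ tuples n t ] ⟦ increasing? p′ (λ k → C? (suc k)) z ⟧
      extend : ∀ j → ⟦ between? (C? zero) p p′ j ⟧ * I ≤ ∑[ z ∈ tuples n t ] ⟦ increasing? p C? (j ∷ z) ⟧
      extend j with between? (C? zero) p p′ j
      ... | no  _                  = z≤n
      ... | yes (p≤j , j<p′ , c) = ≤-trans (≤-reflexive (*-identityˡ I)) (∑-mono′ (tuples n t) λ z →
              ⟦⟧-mono (increasing? p′ (λ k → C? (suc k)) z) (increasing? p C? (j ∷ z))
                λ h → (p≤j , c) , increasing-weaken {z = z} j<p′ h)

  -- Each index moves to the next one satisfying P or, beyond the last such index, back to that one.
  retraction : ∀ {n} {P : Fin n → Set} → (∀ j → Dec (P j)) → ∃[ j ] P j →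
    Σ[ g ∈ (Fin n → Fin n) ] ((∀ j → P (g j)) × (∀ j → P j → g j ≡ j) × (∀ {j k} → j Fin.≤ k → g j Fin.≤ g k))
  retraction {suc n} {P} P? ne with Fin.any? (λ j → P? (suc j))
  retraction {suc n} {P} P? ne | no none = (λ _ → zero) , (λ _ → P0 ne) , fixed , λ _ → z≤n
    where
    P0 : ∃[ j ] P j → P zero
    P0 (zero  , p) = p
    P0 (suc j , p) = ⊥-elim (none (j , p))
    fixed : ∀ j → P j → zero ≡ j
    fixed zero    _ = refl
    fixed (suc j) p = ⊥-elim (none (j , p))
  retraction {suc (suc n)} {P} P? ne | yes some with retraction (λ j → P? (suc j)) some
  ... | g′ , g′∈ , g′-fixed , g′-mono with P? zero
  ...   | yes p0 = g , g∈ , fixed , mono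
    where
    g : Fin (suc (suc n)) → Fin (suc (suc n))
    g zero    = zero
    g (suc j) = suc (g′ j)
    g∈ : ∀ j → P (g j)
    g∈ zero    = p0
    g∈ (suc j) = g′∈ j
    fixed : ∀ j → P j → g j ≡ j
    fixed zero    _ = refl
    fixed (suc j) p = cong suc (g′-fixed j p)
    mono : ∀ {j k} → j Fin.≤ k → g j Fin.≤ g k
    mono {zero}          _       = z≤n
    mono {suc j} {suc k} (s≤s h) = s≤s (g′-mono h)
  ...   | no ¬p0 = g , g∈ , fixed , mono
    where
    g : Fin (suc (suc n)) → Fin (suc (suc n))
    g zero    = suc (g′ zero)
    g (suc j) = suc (g′ j)
    g∈ : ∀ j → P (g j)
    g∈ zero    = g′∈ zero
    g∈ (suc j) = g′∈ j
    fixed : ∀ j → P j → g j ≡ j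
    fixed zero    p = contradiction p ¬p0
    fixed (suc j) p = cong suc (g′-fixed j p)
    mono : ∀ {j k} → j Fin.≤ k → g j Fin.≤ g k
    mono {zero}  {zero}  _       = ≤-refl
    mono {zero}  {suc k} _       = s≤s (g′-mono z≤n)
    mono {suc j} {suc k} (s≤s h) = s≤s (g′-mono h)

  -- Greedy choice: an element is added unless it is R-related to one already taken.
  maximal-separated : ∀ {X : Set} {R : X → X → Set} (R? : ∀ x y → Dec (R x y)) → (∀ x → R x x) → ∀ xs →
    ∃[ ys ] ys ⊆ xs × ListAllPairs.AllPairs (λ x y → ¬ R x y) ys × (∀ {x} → x ∈ xs → ∃[ y ] (y ∈ ys × R x y))
  maximal-separated R? R-refl []       = [] , (λ ()) , ListAllPairs.[] , λ ()
  maximal-separated {R = R} R? R-refl (x ∷ xs) with maximal-separated R? R-refl xs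
  ... | ys , ys⊆ , sep , dom with any? (R? x) ys
  ...   | yes r = ys , (λ y∈ → there (ys⊆ y∈)) , sep , λ where
            (here refl) → find r
            (there x∈)  → dom x∈
  ...   | no ¬r = x ∷ ys , sub , ListAll.¬Any⇒All¬ ys ¬r ListAllPairs.∷ sep , λ where
            (here refl) → x , here refl , R-refl x
            (there x∈)  → let y , y∈ , r = dom x∈ in y , there y∈ , r
    where
    sub : x ∷ ys ⊆ x ∷ xs
    sub (here eq)  = here eq
    sub (there y∈) = there (ys⊆ y∈)

  -- Merges the hitting sets of single instances into one, unless some instance already produces
  -- many copies. It is applied over the choices of representatives and again over the family.
  collect : ∀ {X Y Good : Set} {R : X → List Y → Set} → (∀ {x D D′} → D ⊆ D′ → R x D → R x D′) → ∀ xs k →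
    (∀ {x} → x ∈ xs → Good ⊎ ∃[ D ] length D ≤ k × R x D) →
    Good ⊎ ∃[ D ] length D ≤ length xs * k × (∀ {x} → x ∈ xs → R x D)
  collect mono []       k h = inj₂ ([] , z≤n , λ ())
  collect mono (x ∷ xs) k h with h (here refl) | collect mono xs k (λ x∈ → h (there x∈))
  ... | inj₁ good           | _                    = inj₁ good
  ... | inj₂ _              | inj₁ good            = inj₁ good
  ... | inj₂ (D , D≤ , RxD) | inj₂ (D′ , D′≤ , R′) =
    inj₂ (D ++ D′ , ≤-trans (≤-reflexive (length-++ D)) (+-mono-≤ D≤ D′≤) , λ where
      (here refl) → mono ∈-++⁺ˡ RxD
      (there x∈)  → mono (∈-++⁺ʳ D) (R′ x∈))

  -- Clusters of rows

  module _ {n : ℕ} (M : Matrix n n) where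

    private
      differ? : ∀ i i′ j → Dec (entry M i j ≢ entry M i′ j)
      differ? i i′ j = ¬? (entry M i j Bool.≟ entry M i′ j)

    dist-refl : ∀ i → dist M i i ≡ 0
    dist-refl i = n≤0⇒n≡0 (≤-trans (∑-≤-const (allFin n) λ j _ → ≤-reflexive (⟦⟧-no (differ? i i j) λ h → h refl))
                                   (≤-reflexive (*-zeroʳ (length (allFin n)))))

    dist-triangle : ∀ x y i → dist M x y ≤ dist M x i + dist M y i
    dist-triangle x y i = begin
      dist M x y
        ≤⟨ ∑-mono′ (allFin n) (λ j → ⟦⟧-≤ (differ? x y j) (split j)) ⟩
      ∑[ j ∈ allFin n ] (⟦ differ? x i j ⟧ + ⟦ differ? y i j ⟧)
        ≡⟨ ∑-+ (allFin n) _ _ ⟩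
      dist M x i + dist M y i ∎
      where
      split : ∀ j → entry M x j ≢ entry M y j → 1 ≤ ⟦ differ? x i j ⟧ + ⟦ differ? y i j ⟧
      split j x≢y with entry M x j Bool.≟ entry M i j | entry M y j Bool.≟ entry M i j
      ... | no  _   | _       = s≤s z≤n
      ... | yes _   | no _    = ≤-refl
      ... | yes x≡i | yes y≡i = contradiction (trans x≡i (sym y≡i)) x≢y

    -- The representatives form a maximal family of rows with pairwise disjoint balls.
    clusters : ∀ T H {Y : Fin n → Set} (Y? : ∀ i → Dec (Y i)) → 0 < n → (∀ {i} → Y i → Dense M T H i) →
      ∃[ r ] Σ[ reps ∈ (Fin r → Fin n) ] (r ≤ H × (∀ a → Y (reps a)) ×
        (∀ {i} → Y i → ∃[ a ] T * dist M i (reps a) ≤ 2 * n))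
    clusters T H {Y} Y? 0<n dense with maximal-separated meet? (λ i → i , self i , self i) (filter Y? (allFin n))
      where
      Meet : Fin n → Fin n → Set
      Meet x y = ∃[ i ] (Close M T x i × Close M T y i)
      meet? : ∀ x y → Dec (Meet x y)
      meet? x y = Fin.any? λ i → close? M T x i ×-dec close? M T y i
      self : ∀ i → Close M T i i
      self i = ≤-trans (≤-reflexive (trans (cong (T *_) (dist-refl i)) (*-zeroʳ T))) z≤n
    ... | ys , ys⊆ , sep , dominating = length ys , List.lookup ys , few , (λ a → ys-Y (∈-lookup {xs = ys} a)) , near
      where
      ys-Y : ∀ {y} → y ∈ ys → Y y
      ys-Y y∈ = proj₂ (∈-filter⁻ Y? {xs = allFin n} (ys⊆ y∈))

      -- Every ball has at least n / H rows, and no row lies in two of them.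
      few : length ys ≤ H
      few = *-cancelʳ-≤ (length ys) H n {{>-nonZero 0<n}} (begin
        length ys * n                                         ≤⟨ ∑-const-≤ ys (λ y y∈ → dense (ys-Y y∈)) ⟩
        ∑[ y ∈ ys ] (H * ball M T y)                          ≡⟨ ∑-*ˡ ys H _ ⟩
        H * ∑[ y ∈ ys ] ball M T y                            ≡⟨ cong (H *_) (∑-swap ys (allFin n) (λ y i → ⟦ close? M T y i ⟧)) ⟩
        H * ∑[ i ∈ allFin n ] ∑[ y ∈ ys ] ⟦ close? M T y i ⟧  ≤⟨ *-monoʳ-≤ H (∑-≤-const (allFin n) λ i _ →
          ∑-AllPairs (λ y → close? M T y i) sep λ c c′ ¬meet → ¬meet (i , c , c′)) ⟩
        H * (length (allFin n) * 1)                           ≡⟨ cong (H *_) (trans (*-identityʳ _) (length-allFin n)) ⟩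
        H * n                                                 ∎)

      -- By maximality the ball of i shares a row k with that of a representative; going through k
      -- doubles the radius.
      near : ∀ {i} → Y i → ∃[ a ] T * dist M i (List.lookup ys a) ≤ 2 * n
      near {i} yi =
        let y , y∈ , k , c , c′ = dominating (∈-filter⁺ Y? (∈-allFin i) yi)
        in Any.index y∈ , (begin
          T * dist M i (List.lookup ys (Any.index y∈))     ≡⟨ cong (λ v → T * dist M i v) (Any.lookup-index y∈) ⟨
          T * dist M i y                                   ≤⟨ *-monoʳ-≤ T (dist-triangle i y k) ⟩
          T * (dist M i k + dist M y k)                    ≡⟨ *-distribˡ-+ T (dist M i k) (dist M y k) ⟩
          T * dist M i k + T * dist M y k                  ≤⟨ +-mono-≤ c c′ ⟩
          n + n                                            ≡⟨ cong (n +_) (+-identityʳ n) ⟨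
          2 * n                                            ∎)

    errors : ℕ → Fin n → Fin n → ℕ
    errors T a j = ∑[ i ∈ allFin n ] ⟦ close? M T a i ×-dec differ? a i j ⟧

    -- Counted by rows instead of columns: each row of the ball differs from a in at most n / T
    -- columns.
    ∑-errors : ∀ T a → T * ∑[ j ∈ allFin n ] errors T a j ≤ ball M T a * n
    ∑-errors T a = begin
      T * ∑[ j ∈ allFin n ] errors T a j
        ≡⟨ cong (T *_) (∑-swap (allFin n) (allFin n) (λ j i → ⟦ close? M T a i ×-dec differ? a i j ⟧)) ⟩
      T * ∑[ i ∈ allFin n ] ∑[ j ∈ allFin n ] ⟦ close? M T a i ×-dec differ? a i j ⟧
        ≡⟨ cong (T *_) (∑-cong (allFin n) (λ i → trans
             (∑-cong (allFin n) (λ j → ⟦⟧-× (close? M T a i) (differ? a i j))) (∑-*ˡ (allFin n) ⟦ close? M T a i ⟧ _))) ⟩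
      T * ∑[ i ∈ allFin n ] (⟦ close? M T a i ⟧ * dist M a i)
        ≡⟨ ∑-*ˡ (allFin n) T _ ⟨
      ∑[ i ∈ allFin n ] (T * (⟦ close? M T a i ⟧ * dist M a i))
        ≡⟨ ∑-cong (allFin n) (λ i → lemma T ⟦ close? M T a i ⟧ (dist M a i)) ⟩
      ∑[ i ∈ allFin n ] (⟦ close? M T a i ⟧ * (T * dist M a i))
        ≤⟨ ∑-mono′ (allFin n) (λ i → ⟦⟧-* (close? M T a i) (λ c → c)) ⟩
      ∑[ i ∈ allFin n ] (⟦ close? M T a i ⟧ * n)
        ≡⟨ ∑-*ʳ (allFin n) n _ ⟩
      ball M T a * n ∎
      where
      lemma : ∀ a b c → a * (b * c) ≡ b * (a * c)
      lemma = solve-∀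

    -- The factor 2τ ensures that up to τ accurate columns together lose at most half of the ball.
    Accurate : ℕ → ℕ → Fin n → Fin n → Set
    Accurate T τ a j = 2 * τ * errors T a j ≤ ball M T a

    accurate? : ∀ T τ a j → Dec (Accurate T τ a j)
    accurate? T τ a j = 2 * τ * errors T a j ≤? ball M T a

    -- Markov's inequality for the number of errors in a column.
    inaccurate-few : ∀ T τ a → 0 < ball M T a → T * ∑[ j ∈ allFin n ] ⟦ ¬? (accurate? T τ a j) ⟧ ≤ 2 * τ * n
    inaccurate-few T τ a 0<b = *-cancelʳ-≤ _ _ b {{>-nonZero 0<b}} (begin
      T * X * b                                               ≡⟨ *-assoc T X b ⟩
      T * (X * b)                                             ≡⟨ cong (T *_) (∑-*ʳ (allFin n) b _) ⟨
      T * ∑[ j ∈ allFin n ] (⟦ ¬? (accurate? T τ a j) ⟧ * b)  ≤⟨ *-monoʳ-≤ T (∑-mono′ (allFin n) markov) ⟩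
      T * ∑[ j ∈ allFin n ] (2 * τ * errors T a j)            ≡⟨ cong (T *_) (∑-*ˡ (allFin n) (2 * τ) _) ⟩
      T * (2 * τ * ∑[ j ∈ allFin n ] errors T a j)            ≡⟨ lemma₁ T (2 * τ) _ ⟩
      2 * τ * (T * ∑[ j ∈ allFin n ] errors T a j)            ≤⟨ *-monoʳ-≤ (2 * τ) (∑-errors T a) ⟩
      2 * τ * (b * n)                                         ≡⟨ lemma₂ (2 * τ) b n ⟩
      2 * τ * n * b                                           ∎)
      where
      b = ball M T a
      X = ∑[ j ∈ allFin n ] ⟦ ¬? (accurate? T τ a j) ⟧
      markov : ∀ j → ⟦ ¬? (accurate? T τ a j) ⟧ * b ≤ 2 * τ * errors T a j
      markov j with accurate? T τ a j
      ... | yes _  = z≤n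
      ... | no ¬ac = ≤-trans (≤-reflexive (*-identityˡ b)) (<⇒≤ (≰⇒> ¬ac))
      lemma₁ : ∀ a b c → a * (b * c) ≡ b * (a * c)
      lemma₁ = solve-∀
      lemma₂ : ∀ a b c → a * (b * c) ≡ a * c * b
      lemma₂ = solve-∀

    -- At least half of the ball of a agrees with a on all of z, by a union bound over the columns
    -- of z, and the ball has at least n / H rows.
    accurate⇒frequent : ∀ T H τ a → Dense M T H a → 0 < τ → ∀ {t} → t ≤ τ → (z : Vec (Fin n) t) →
      (∀ k → Accurate T τ a (lookup z k)) → n ≤ 2 * H * freq M (Vec.map (entry M a) z) z
    accurate⇒frequent T H τ a dense 0<τ {t} t≤τ z accurate = begin
      n                ≤⟨ dense ⟩
      H * b            ≤⟨ *-monoʳ-≤ H b≤2f ⟩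
      H * (2 * f)      ≡⟨ lemma₁ H f ⟩
      2 * H * f        ∎
      where
      b = ball M T a
      f = freq M (Vec.map (entry M a) z) z
      e = ∑[ k ∈ allFin t ] errors T a (lookup z k)

      lemma₁ : ∀ a b → a * (2 * b) ≡ 2 * a * b
      lemma₁ = solve-∀

      match : ∀ {t} (z : Vec (Fin n) t) i → Vec.map (entry M i) z ≡ Vec.map (entry M a) z ⊎
              ∃[ k ] entry M a (lookup z k) ≢ entry M i (lookup z k)
      match []      i = inj₁ refl
      match (j ∷ z) i with entry M a j Bool.≟ entry M i j | match z i
      ... | no  a≢i | _            = inj₂ (zero , a≢i)
      ... | yes _   | inj₂ (k , h) = inj₂ (suc k , h)
      ... | yes a≡i | inj₁ eq      = inj₁ (cong₂ _∷_ (sym a≡i) eq)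

      b≤f+e : b ≤ f + e
      b≤f+e = begin
        b
          ≤⟨ ∑-mono′ (allFin n) (λ i → ⟦⟧-≤ (close? M T a i) (split i)) ⟩
        ∑[ i ∈ allFin n ] (⟦ Vec.map (entry M i) z ≟ᵛ Vec.map (entry M a) z ⟧ +
                           ∑[ k ∈ allFin t ] ⟦ close? M T a i ×-dec differ? a i (lookup z k) ⟧)
          ≡⟨ ∑-+ (allFin n) _ _ ⟩
        f + ∑[ i ∈ allFin n ] ∑[ k ∈ allFin t ] ⟦ close? M T a i ×-dec differ? a i (lookup z k) ⟧
          ≡⟨ cong (f +_) (∑-swap (allFin n) (allFin t) (λ i k → ⟦ close? M T a i ×-dec differ? a i (lookup z k) ⟧)) ⟩
        f + e ∎
        where
        split : ∀ i → Close M T a i → 1 ≤ ⟦ Vec.map (entry M i) z ≟ᵛ Vec.map (entry M a) z ⟧ +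
                                          ∑[ k ∈ allFin t ] ⟦ close? M T a i ×-dec differ? a i (lookup z k) ⟧
        split i c with match z i
        ... | inj₁ eq      = ≤-trans (≤-reflexive (sym (⟦⟧-yes (Vec.map (entry M i) z ≟ᵛ Vec.map (entry M a) z) eq))) (m≤m+n _ _)
        ... | inj₂ (k , h) = ≤-trans (≤-reflexive (sym (⟦⟧-yes (close? M T a i ×-dec differ? a i (lookup z k)) (c , h))))
              (≤-trans (∑-∈ (λ k → ⟦ close? M T a i ×-dec differ? a i (lookup z k) ⟧) (∈-allFin k)) (m≤n+m _ _))

      lemma₂ : ∀ τ e → τ * (2 * e) ≡ 2 * τ * e
      lemma₂ = solve-∀

      2e≤b : 2 * e ≤ b
      2e≤b = *-cancelˡ-≤ τ {{>-nonZero 0<τ}} (begin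
        τ * (2 * e)                                              ≡⟨ lemma₂ τ e ⟩
        2 * τ * e                                                ≡⟨ ∑-*ˡ (allFin t) (2 * τ) _ ⟨
        ∑[ k ∈ allFin t ] (2 * τ * errors T a (lookup z k))      ≤⟨ ∑-≤-const (allFin t) (λ k _ → accurate k) ⟩
        length (allFin t) * b                                    ≡⟨ cong (_* b) (length-allFin t) ⟩
        t * b                                                    ≤⟨ *-monoˡ-≤ b t≤τ ⟩
        τ * b                                                    ∎)

      b≤2f : b ≤ 2 * f
      b≤2f = +-cancelʳ-≤ b _ _ (begin
        b + b              ≡⟨ cong (b +_) (+-identityʳ b) ⟨
        2 * b              ≤⟨ *-monoʳ-≤ 2 b≤f+e ⟩
        2 * (f + e)        ≡⟨ *-distribˡ-+ 2 f e ⟩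
        2 * f + 2 * e      ≤⟨ +-monoʳ-≤ (2 * f) 2e≤b ⟩
        2 * f + b          ∎)

    collapse : (Fin n → Fin n) → (Fin n → Fin n) → Matrix n n
    collapse ρ g = tabulate λ i → tabulate λ j → entry M (ρ i) (g j)

    entry-collapse : ∀ ρ g i j → entry (collapse ρ g) i j ≡ entry M (ρ i) (g j)
    entry-collapse ρ g i j = trans (cong (λ v → lookup v j) (Vec.lookup∘tabulate _ i)) (Vec.lookup∘tabulate _ j)

    submatrix-collapse : ∀ ρ g {s t} (x : Vec (Fin n) s) (y : Vec (Fin n) t) →
      submatrix (collapse ρ g) x y ≡ submatrix M (Vec.map ρ x) (Vec.map g y)
    submatrix-collapse ρ g x y = trans
      (Vec.map-cong (λ i → trans (Vec.map-cong (entry-collapse ρ g i) y) (Vec.map-∘ (entry M (ρ i)) g y)) x)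
      (Vec.map-∘ (λ i → Vec.map (entry M i) (Vec.map g y)) ρ x)

    -- Three contributions of at most 2n² / c: rows outside Y, charged in full; columns outside K;
    -- and the distance from each row i of Y to `ρ i`.
    #changes-collapse : ∀ c ρ g {Y K : Fin n → Set} (Y? : ∀ i → Dec (Y i)) (K? : ∀ j → Dec (K j)) →
      c * ∑[ i ∈ allFin n ] ⟦ ¬? (Y? i) ⟧ ≤ 2 * n → c * ∑[ j ∈ allFin n ] ⟦ ¬? (K? j) ⟧ ≤ 2 * n →
      (∀ i → Y i → c * dist M i (ρ i) ≤ 2 * n) → (∀ j → K j → g j ≡ j) →
      c * #changes M (collapse ρ g) ≤ 6 * (n * n)
    #changes-collapse c ρ g Y? K? rows cols near fixed = begin
      c * #changes M N
        ≡⟨ cong (c *_) (trans (length-filter _ (cartesianProduct (allFin n) (allFin n)))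
                              (∑-cartesianProductWith _,_ (allFin n) (allFin n) _)) ⟩
      c * ∑[ i ∈ allFin n ] ∑[ j ∈ allFin n ] ⟦ changed? i j ⟧
        ≡⟨ ∑-*ˡ (allFin n) c _ ⟨
      ∑[ i ∈ allFin n ] (c * ∑[ j ∈ allFin n ] ⟦ changed? i j ⟧)
        ≤⟨ ∑-mono′ (allFin n) row ⟩
      ∑[ i ∈ allFin n ] (c * ⟦ ¬? (Y? i) ⟧ * n + (2 * n + 2 * n))
        ≡⟨ trans (∑-+ (allFin n) _ _) (cong₂ _+_
             (trans (∑-*ʳ (allFin n) n _) (cong (_* n) (∑-*ˡ (allFin n) c _)))
             (trans (∑-const (allFin n) _) (cong (_* (2 * n + 2 * n)) (length-allFin n)))) ⟩
      c * ∑[ i ∈ allFin n ] ⟦ ¬? (Y? i) ⟧ * n + n * (2 * n + 2 * n)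
        ≤⟨ +-monoˡ-≤ (n * (2 * n + 2 * n)) (*-monoˡ-≤ n rows) ⟩
      2 * n * n + n * (2 * n + 2 * n)
        ≡⟨ lemma n ⟩
      6 * (n * n) ∎
      where
      N = collapse ρ g
      changed? : ∀ i j → Dec (entry M i j ≢ entry N i j)
      changed? i j = ¬? (entry M i j Bool.≟ entry N i j)
      lemma : ∀ n → 2 * n * n + n * (2 * n + 2 * n) ≡ 6 * (n * n)
      lemma = solve-∀

      row : ∀ i → c * ∑[ j ∈ allFin n ] ⟦ changed? i j ⟧ ≤ c * ⟦ ¬? (Y? i) ⟧ * n + (2 * n + 2 * n)
      row i with Y? i
      ... | no _ = begin
        c * ∑[ j ∈ allFin n ] ⟦ changed? i j ⟧   ≤⟨ *-monoʳ-≤ c (∑-⟦⟧≤length (changed? i) (allFin n)) ⟩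
        c * length (allFin n)                    ≡⟨ cong₂ _*_ (sym (*-identityʳ c)) (length-allFin n) ⟩
        c * 1 * n                                ≤⟨ m≤m+n _ _ ⟩
        c * 1 * n + (2 * n + 2 * n)              ∎
      ... | yes yi = begin
        c * ∑[ j ∈ allFin n ] ⟦ changed? i j ⟧   ≤⟨ *-monoʳ-≤ c (∑-mono′ (allFin n) λ j → ⟦⟧-≤ (changed? i j) (split j)) ⟩
        c * ∑[ j ∈ allFin n ] (⟦ ¬? (K? j) ⟧ + ⟦ differ? i (ρ i) j ⟧)
                                                 ≡⟨ trans (cong (c *_) (∑-+ (allFin n) _ _)) (*-distribˡ-+ c _ _) ⟩
        c * ∑[ j ∈ allFin n ] ⟦ ¬? (K? j) ⟧ + c * dist M i (ρ i)
                                                 ≤⟨ +-mono-≤ cols (near i yi) ⟩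
        2 * n + 2 * n                            ≤⟨ m≤n+m (2 * n + 2 * n) (c * 0 * n) ⟩
        c * 0 * n + (2 * n + 2 * n)              ∎
        where
        split : ∀ j → entry M i j ≢ entry N i j → 1 ≤ ⟦ ¬? (K? j) ⟧ + ⟦ differ? i (ρ i) j ⟧
        split j M≢N with K? j
        ... | no  _  = s≤s z≤n
        ... | yes kj = ≤-reflexive (sym (⟦⟧-yes (differ? i (ρ i) j) λ eq →
                M≢N (trans eq (sym (trans (entry-collapse ρ g i j) (cong (entry M (ρ i)) (fixed j kj)))))))

  vec-ext : ∀ {X : Set} {k} {v w : Vec X k} → (∀ i → lookup v i ≡ lookup w i) → v ≡ w
  vec-ext {v = v} {w} h = trans (sym (Vec.tabulate∘lookup v)) (trans (Vec.tabulate-cong h) (Vec.tabulate∘lookup w))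

  lookup-submatrix : ∀ {m n s t} (M : Matrix m n) (x : Vec (Fin m) s) (z : Vec (Fin n) t) i k →
                     lookup (lookup (submatrix M x z) i) k ≡ entry M (lookup x i) (lookup z k)
  lookup-submatrix M x z i k = trans (cong (λ v → lookup v k) (Vec.lookup-map i _ x)) (Vec.lookup-map k _ z)

  Linked-map-mono : ∀ {n t} {g : Fin n → Fin n} → (∀ {j k} → j Fin.≤ k → g j Fin.≤ g k) →
                    {y : Vec (Fin n) t} → Linked Fin._<_ y → Linked Fin._≤_ (Vec.map g y)
  Linked-map-mono mono []                           = []
  Linked-map-mono mono [-]                          = [-]
  Linked-map-mono mono {_ ∷ _ ∷ _} (j<k ∷ l) = mono (<⇒≤ j<k) ∷ Linked-map-mono mono l

  ∑-∈-list : ∀ {n} (D : List (Fin n)) → ∑[ j ∈ allFin n ] ⟦ any? (j Fin.≟_) D ⟧ ≤ length D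
  ∑-∈-list {n} D = begin
    ∑[ j ∈ allFin n ] ⟦ any? (j Fin.≟_) D ⟧
      ≤⟨ ∑-mono′ (allFin n) (λ j → ⟦⟧-≤ (any? (j Fin.≟_) D) λ j∈ →
           ≤-trans (≤-reflexive (sym (⟦⟧-yes (j Fin.≟ j) refl))) (∑-∈ (λ d → ⟦ j Fin.≟ d ⟧) j∈)) ⟩
    ∑[ j ∈ allFin n ] ∑[ d ∈ D ] ⟦ j Fin.≟ d ⟧
      ≡⟨ ∑-swap (allFin n) D (λ j d → ⟦ j Fin.≟ d ⟧) ⟩
    ∑[ d ∈ D ] ∑[ j ∈ allFin n ] ⟦ j Fin.≟ d ⟧
      ≤⟨ ∑-≤-const D (λ d _ → ∑-Unique (Fin._≟ d) (ListUnique.allFin⁺ n) (λ e e′ → trans e (sym e′))) ⟩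
    length D * 1
      ≡⟨ *-identityʳ (length D) ⟩
    length D ∎

  ∑-¬× : ∀ {X : Set} {P Q : X → Set} (P? : ∀ x → Dec (P x)) (Q? : ∀ x → Dec (Q x)) xs →
         ∑[ x ∈ xs ] ⟦ ¬? (P? x ×-dec Q? x) ⟧ ≤ ∑[ x ∈ xs ] ⟦ ¬? (P? x) ⟧ + ∑[ x ∈ xs ] ⟦ ¬? (Q? x) ⟧
  ∑-¬× P? Q? xs = ≤-trans (∑-mono′ xs split) (≤-reflexive (∑-+ xs _ _))
    where
    split : ∀ x → ⟦ ¬? (P? x ×-dec Q? x) ⟧ ≤ ⟦ ¬? (P? x) ⟧ + ⟦ ¬? (Q? x) ⟧
    split x with P? x | Q? x
    ... | yes _ | yes _ = z≤n
    ... | yes _ | no _  = ≤-refl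
    ... | no _  | _     = s≤s z≤n

  -- If P failed everywhere, there would be n exceptions instead of at most 2n / e.
  few-exceptions : ∀ {n e} {P : Fin n → Set} (P? : ∀ i → Dec (P i)) → 0 < n → 8 ≤ e →
                   e * ∑[ i ∈ allFin n ] ⟦ ¬? (P? i) ⟧ ≤ 2 * n → ∃[ i ] P i
  few-exceptions {n} {e} P? 0<n 8≤e few with Fin.any? P?
  ... | yes some = some
  ... | no  none = ⊥-elim (<⇒≱ (*-monoˡ-< n {{>-nonZero 0<n}} {2} {8} (s≤s (s≤s (s≤s z≤n)))) (begin
    8 * n                                     ≤⟨ *-monoˡ-≤ n 8≤e ⟩
    e * n                                     ≡⟨ cong (e *_) (trans (*-identityʳ _) (length-allFin n)) ⟨
    e * (length (allFin n) * 1)               ≤⟨ *-monoʳ-≤ e (∑-const-≤ (allFin n) λ i _ →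
                                                   ≤-reflexive (sym (⟦⟧-yes (¬? (P? i)) λ p → none (i , p)))) ⟩
    e * ∑[ i ∈ allFin n ] ⟦ ¬? (P? i) ⟧       ≤⟨ few ⟩
    2 * n                                     ∎))

  -- Rounding n / G down loses at most a factor 2 once the quotient is positive.
  quotient-bounds : ∀ n G .{{_ : NonZero G}} → G ≤ n → ∃[ m ] (G * m ≤ n × n ≤ 2 * G * m)
  quotient-bounds n G G≤n = n / G , ≤-trans (≤-reflexive (*-comm G (n / G))) (m/n*n≤m n G) , (begin
    n                          ≡⟨ m≡m%n+[m/n]*n n G ⟩
    n % G + n / G * G          ≤⟨ +-monoˡ-≤ (n / G * G) (<⇒≤ (m%n<n n G)) ⟩
    G + n / G * G              ≤⟨ +-monoˡ-≤ (n / G * G) (m≤n*m G (n / G) {{>-nonZero (m≥n⇒m/n>0 G≤n)}}) ⟩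
    n / G * G + n / G * G      ≡⟨ lemma (n / G) G ⟩
    2 * G * (n / G)            ∎)
    where
    lemma : ∀ m G → m * G + m * G ≡ 2 * G * m
    lemma = solve-∀

  Rich-mono : ∀ {n F} {M : Matrix n n} {B B′} → B ≤ B′ → Rich F M B → Rich F M B′
  Rich-mono B≤B′ (s , t , A , A∈F , h) = s , t , A , A∈F , ≤-trans h (*-monoˡ-≤ _ B≤B′)

  -- Where all patterns on t columns are frequent, so are the rows of any A with t columns. Hence
  -- one member of the family suffices for this step.
  dense-or-rich : ∀ {n} (M : Matrix n n) → 0 < n → ∀ {F} → ClosedUnderRowPermutations F →
    ∀ {s t} {A : Matrix s t} → (s , t , A) ∈ F → ∀ q T e → let Θ = 2 * e * suc q ^ t in
    16 * (e * e) * (suc q ^ t * suc q ^ t) * T ^ q ≤ suc T ^ q → 2 * Θ * s ≤ n →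
    e * ∑[ i ∈ allFin n ] ⟦ ¬? (dense? M (suc T) (2 * Θ) i) ⟧ ≤ n ⊎
    Rich F M (2 * t ! * suc q ^ t * ((2 * Θ) ^ s * s !))
  dense-or-rich {n} M 0<n closed {s} {t} {A} A∈F q T e hq large =
    Sum.map₂ (rich M closed A∈F Θ (2 * t ! * suc q ^ t) large (sorted×robust? M Θ) (λ z (l , r) → l , λ k → r (lookup A k)))
             (dense-or-robust M 0<n t q T e (subst (λ m → m * T ^ q ≤ suc T ^ q) (sym (lemma e (suc q ^ t))) hq))
    where
    Θ = 2 * e * suc q ^ t
    lemma : ∀ e a → 4 * (2 * e * a * (2 * e * a)) ≡ 16 * (e * e) * (a * a)
    lemma = solve-∀

  *-pos : ∀ {a b} → 0 < a → 0 < b → 0 < a * b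
  *-pos {suc a} {suc b} _ _ = s≤s z≤n

  -- s₀ × t₀ are the dimensions of one member of the family, σ and τ bound the
  -- dimensions of all of its members, and f is their number.
  module Constants (s₀ t₀ σ τ f : ℕ) where

    -- The 16 e² is the part of 4Θ² other than powers of q + 1. `H` is twice `Θ` so that a sparse
    -- ball is less than half of a class.
    q Θ H B : ℕ → ℕ → ℕ
    q T e = sampleSize (16 * (e * e)) t₀ T
    Θ T e = 2 * e * suc (q T e) ^ t₀
    H T e = 2 * Θ T e
    B T e = 2 * t₀ ! * suc (q T e) ^ t₀ * (H T e ^ s₀ * s₀ !)

    -- At scale `T₁` the columns inaccurate for any of up to `H e e` representatives number at most
    -- n / e. With blocks of about n / G columns, the same holds for all hitting sets together. `n₀`
    -- adds up the lower bounds on n required on the way.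
    T₁ H₁ G B₂ n₀ bound : ℕ → ℕ
    T₁ e = e * (H e e * (2 * τ))
    H₁ e = H (T₁ e) e
    G  e = e * (f * (H e e ^ σ * τ))
    B₂ e = (2 * G e) ^ τ * ((2 * (2 * H₁ e)) ^ σ * σ !)
    n₀ e = H e e * s₀ + H₁ e * s₀ + 2 * (2 * H₁ e) * σ + G e
    bound e = B e e + B (T₁ e) e + B₂ e + n₀ e ^ (σ + τ)

    H-pos : ∀ T {e} → 0 < e → 0 < H T e
    H-pos T {e} 0<e = *-pos {2} {Θ T e} (s≤s z≤n)
      (*-pos {2 * e} {suc (q T e) ^ t₀} (*-pos {2} {e} (s≤s z≤n) 0<e) (m^n>0 (suc (q T e)) t₀))

    module _ {n : ℕ} (M : Matrix n n) (0<n : 0 < n) {F : Family} (closed : ClosedUnderRowPermutations F)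
             {A : Matrix s₀ t₀} (A∈F : (s₀ , t₀ , A) ∈ F) where

      dense-or-rich′ : ∀ T e → 0 < T → H T e * s₀ ≤ n →
        e * ∑[ i ∈ allFin n ] ⟦ ¬? (dense? M T (H T e) i) ⟧ ≤ n ⊎ Rich F M (B T e)
      dense-or-rich′ (suc T) e _ large =
        dense-or-rich M 0<n closed A∈F (q (suc T) e) T e (sampleSize-large (16 * (e * e)) t₀ T) large

  !-mono-≤ : ∀ {m n} → m ≤ n → m ! ≤ n !
  !-mono-≤ {n = n} z≤n       = 1≤n! n
  !-mono-≤         (s≤s m≤n) = *-mono-≤ (s≤s m≤n) (!-mono-≤ m≤n)

  ^-mono-≤ : ∀ {a m n} → 0 < a → m ≤ n → a ^ m ≤ a ^ n
  ^-mono-≤ {a} 0<a = ^-monoʳ-≤ a {{>-nonZero 0<a}}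

  -- A nearby F-free matrix when most rows are dense at both scales

  module Cleaning
    {n : ℕ} (M : Matrix n n) (0<n : 0 < n) {F : Family} (closed : ClosedUnderRowPermutations F)
    {σ τ : ℕ} (0<τ : 0 < τ) (dims : ∀ {s t} {A : Matrix s t} → (s , t , A) ∈ F → s ≤ σ × t ≤ τ)
    (e H₀ H₁ m : ℕ) (8≤e : 8 ≤ e) (0<H₀ : 0 < H₀) (0<H₁ : 0 < H₁)
    (dense₀ : e * ∑[ i ∈ allFin n ] ⟦ ¬? (dense? M e H₀ i) ⟧ ≤ n)
    (dense₁ : e * ∑[ i ∈ allFin n ] ⟦ ¬? (dense? M (e * (H₀ * (2 * τ))) H₁ i) ⟧ ≤ n)
    (large : 2 * (2 * H₁) * σ ≤ n)
    (0<G : 0 < e * (length F * (H₀ ^ σ * τ)))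
    (Gm≤n : e * (length F * (H₀ ^ σ * τ)) * m ≤ n)
    (n≤2Gm : n ≤ 2 * (e * (length F * (H₀ ^ σ * τ))) * m)
    where

    T₁ G bound : ℕ
    T₁ = e * (H₀ * (2 * τ))
    G  = e * (length F * (H₀ ^ σ * τ))
    bound = (2 * G) ^ τ * ((2 * (2 * H₁)) ^ σ * σ !)

    Y : Fin n → Set
    Y i = Dense M e H₀ i × Dense M T₁ H₁ i

    Y? : ∀ i → Dec (Y i)
    Y? i = dense? M e H₀ i ×-dec dense? M T₁ H₁ i

    twice : ∀ {a b c} → a ≤ b + c → e * b ≤ n → e * c ≤ n → e * a ≤ 2 * n
    twice {a} {b} {c} a≤ b≤ c≤ = begin
      e * a            ≤⟨ *-monoʳ-≤ e a≤ ⟩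
      e * (b + c)      ≡⟨ *-distribˡ-+ e b c ⟩
      e * b + e * c    ≤⟨ +-mono-≤ b≤ c≤ ⟩
      n + n            ≡⟨ cong (n +_) (+-identityʳ n) ⟨
      2 * n            ∎

    Y-most : e * ∑[ i ∈ allFin n ] ⟦ ¬? (Y? i) ⟧ ≤ 2 * n
    Y-most = twice (∑-¬× (dense? M e H₀) (dense? M T₁ H₁) (allFin n)) dense₀ dense₁

    module _ {r : ℕ} (reps : Fin r → Fin n) (r≤H₀ : r ≤ H₀) (reps-Y : ∀ a → Y (reps a)) where

      Good : Fin n → Set
      Good j = ∀ a → Accurate M T₁ τ (reps a) j

      good? : ∀ j → Dec (Good j)
      good? j = Fin.all? λ a → accurate? M T₁ τ (reps a) j

      -- A union bound over the representatives, at most H₀ in number; this is where the factor H₀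
      -- (2τ) in `T₁` is spent.
      Good-most : e * ∑[ j ∈ allFin n ] ⟦ ¬? (good? j) ⟧ ≤ n
      Good-most = *-cancelˡ-≤ h {{>-nonZero (*-pos 0<H₀ (*-pos {2} (s≤s z≤n) 0<τ))}} (begin
        h * (e * X)                        ≡⟨ lemma₁ h e X ⟩
        T₁ * X                             ≤⟨ *-monoʳ-≤ T₁ X≤ ⟩
        T₁ * ∑[ a ∈ allFin r ] bad a       ≡⟨ ∑-*ˡ (allFin r) T₁ bad ⟨
        ∑[ a ∈ allFin r ] (T₁ * bad a)     ≤⟨ ∑-≤-const (allFin r) (λ a _ → inaccurate-few M T₁ τ (reps a) (ball>0 a)) ⟩
        length (allFin r) * (2 * τ * n)    ≡⟨ cong (_* (2 * τ * n)) (length-allFin r) ⟩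
        r * (2 * τ * n)                    ≤⟨ *-monoˡ-≤ (2 * τ * n) r≤H₀ ⟩
        H₀ * (2 * τ * n)                   ≡⟨ *-assoc H₀ (2 * τ) n ⟨
        h * n                              ∎)
        where
        h X : ℕ
        h = H₀ * (2 * τ)
        X = ∑[ j ∈ allFin n ] ⟦ ¬? (good? j) ⟧
        bad : Fin r → ℕ
        bad a = ∑[ j ∈ allFin n ] ⟦ ¬? (accurate? M T₁ τ (reps a) j) ⟧
        lemma₁ : ∀ h e X → h * (e * X) ≡ e * h * X
        lemma₁ = solve-∀
        ball>0 : ∀ a → 0 < ball M T₁ (reps a)
        ball>0 a = n≢0⇒n>0 λ eq → <⇒≱ 0<n (≤-trans (proj₂ (reps-Y a))
          (≤-reflexive (trans (cong (H₁ *_) eq) (*-zeroʳ H₁))))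
        X≤ : X ≤ ∑ (allFin r) bad
        X≤ = ≤-trans
          (∑-mono′ (allFin n) λ j → ⟦⟧-≤ (¬? (good? j)) λ ¬good →
            let a , ¬acc = Fin.¬∀⟶∃¬ r _ (λ a → accurate? M T₁ τ (reps a) j) ¬good in
            ≤-trans (≤-reflexive (sym (⟦⟧-yes (¬? (accurate? M T₁ τ (reps a) j)) ¬acc)))
                    (∑-∈ (λ a → ⟦ ¬? (accurate? M T₁ τ (reps a) j) ⟧) (∈-allFin a)))
          (≤-reflexive (∑-swap (allFin n) (allFin r) (λ j a → ⟦ ¬? (accurate? M T₁ τ (reps a) j) ⟧)))

      -- The columns of M on which the representatives named by a show column k of A. `Good` ensures
      -- that what they show is shared by many rows of M.
      Column : ∀ {s t} → Matrix s t → Vec (Fin r) s → Fin t → Fin n → Set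
      Column A a k j = Good j × (∀ i → entry M (reps (lookup a i)) j ≡ entry A i k)

      column? : ∀ {s t} (A : Matrix s t) a k j → Dec (Column A a k j)
      column? A a k j = good? j ×-dec Fin.all? λ i → entry M (reps (lookup a i)) j Bool.≟ entry A i k

      Hits : ∀ {s t} → Matrix s t → Vec (Fin r) s → List (Fin n) → Set
      Hits A a D = ∀ z → Weakly 0 (Column A a) z → ∃[ k ] lookup z k ∈ D

      Hits-mono : ∀ {s t} {A : Matrix s t} {a D D′} → D ⊆ D′ → Hits A a D → Hits A a D′
      Hits-mono D⊆D′ h z w = let k , k∈D = h z w in k , D⊆D′ k∈D

      -- On an increasing sequence in these sets, accuracy makes every row of A appear on at least n
      -- / 2H₁ rows of M. If there are m^t such sequences, a (2G)^t-th part of all t-tuples, then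
      -- `rich` applies.
      rich-or-hit : ∀ {s t} {A : Matrix s t} → (s , t , A) ∈ F → ∀ a →
                    Rich F M bound ⊎ ∃[ D ] length D ≤ τ * m × Hits A a D
      rich-or-hit {s} {t} {A} A∈F a = Sum.swap (Sum.map
        (λ (D , D≤ , hits) → D , ≤-trans D≤ (*-monoˡ-≤ m t≤τ) , hits)
        (λ many → Rich-mono {M = M} bound≤ (rich M closed A∈F (2 * H₁) ((2 * G) ^ t) large-s
                    (increasing? 0 (column? A a)) good-columns (enough many)))
        (blocks-or-hittingSet t m 0 (column? A a)))
        where
        s≤σ = proj₁ (dims A∈F)
        t≤τ = proj₂ (dims A∈F)

        large-s : 2 * (2 * H₁) * s ≤ n
        large-s = ≤-trans (*-monoʳ-≤ (2 * (2 * H₁)) s≤σ) large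

        enough : m ^ t ≤ ∑[ z ∈ tuples n t ] ⟦ increasing? 0 (column? A a) z ⟧ →
                 n ^ t ≤ (2 * G) ^ t * ∑[ z ∈ tuples n t ] ⟦ increasing? 0 (column? A a) z ⟧
        enough many = begin
          n ^ t                    ≤⟨ ^-monoˡ-≤ t n≤2Gm ⟩
          (2 * G * m) ^ t          ≡⟨ ^-distribʳ-* t (2 * G) m ⟩
          (2 * G) ^ t * m ^ t      ≤⟨ *-monoʳ-≤ ((2 * G) ^ t) many ⟩
          (2 * G) ^ t * ∑[ z ∈ tuples n t ] ⟦ increasing? 0 (column? A a) z ⟧ ∎

        good-columns : ∀ z → Increasing 0 (Column A a) z →
                       Linked Fin._<_ z × (∀ i → n ≤ 2 * H₁ * freq M (lookup A i) z)
        good-columns z inc = increasing⇒Linked z inc , λ i →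
          subst (λ b → n ≤ 2 * H₁ * freq M b z) (row i)
            (accurate⇒frequent M T₁ H₁ τ (reps (lookup a i)) (proj₂ (reps-Y (lookup a i))) 0<τ t≤τ z
              λ k → proj₁ (increasing⇒lookup z inc k) (lookup a i))
          where
          row : ∀ i → Vec.map (entry M (reps (lookup a i))) z ≡ lookup A i
          row i = vec-ext λ k → trans (Vec.lookup-map k _ z) (proj₂ (increasing⇒lookup z inc k) i)

        bound≤ : (2 * G) ^ t * ((2 * (2 * H₁)) ^ s * s !) ≤ bound
        bound≤ = *-mono-≤ (^-mono-≤ (*-pos {2} (s≤s z≤n) 0<G) t≤τ)
          (*-mono-≤ (^-mono-≤ (*-pos {2} (s≤s z≤n) (*-pos {2} (s≤s z≤n) 0<H₁)) s≤σ) (!-mono-≤ s≤σ))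

      -- The hitting sets are united over at most H₀^σ choices of representatives and over the
      -- family; G is chosen to keep the union within n / e.
      rich-or-hit-all : Rich F M bound ⊎
        ∃[ D ] e * length D ≤ n × (∀ {s t} {A : Matrix s t} → (s , t , A) ∈ F → ∀ a → Hits A a D)
      rich-or-hit-all = Sum.map₂ (λ (D , D≤ , hits) → D , total D D≤ , λ A∈F → hits A∈F)
        (collect {R = λ x D → ∀ a → Hits (proj₂ (proj₂ x)) a D}
          (λ {x} D⊆D′ h a → Hits-mono {A = proj₂ (proj₂ x)} {a} D⊆D′ (h a)) F (H₀ ^ σ * (τ * m)) member)
        where
        lemma : ∀ e f h τ m → e * (f * (h * (τ * m))) ≡ e * (f * (h * τ)) * m
        lemma = solve-∀

        total : ∀ D → length D ≤ length F * (H₀ ^ σ * (τ * m)) → e * length D ≤ n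
        total D D≤ = begin
          e * length D                             ≤⟨ *-monoʳ-≤ e D≤ ⟩
          e * (length F * (H₀ ^ σ * (τ * m)))      ≡⟨ lemma e (length F) (H₀ ^ σ) τ m ⟩
          G * m                                    ≤⟨ Gm≤n ⟩
          n                                        ∎

        count : ∀ {s} (D : List (Fin n)) → s ≤ σ → length D ≤ length (tuples r s) * (τ * m) → length D ≤ H₀ ^ σ * (τ * m)
        count {s} D s≤σ D≤ = begin
          length D                              ≤⟨ D≤ ⟩
          length (tuples r s) * (τ * m)         ≡⟨ cong (_* (τ * m)) (length-tuples r s) ⟩
          r ^ s * (τ * m)                       ≤⟨ *-monoˡ-≤ (τ * m) (≤-trans (^-monoˡ-≤ s r≤H₀) (^-mono-≤ 0<H₀ s≤σ)) ⟩
          H₀ ^ σ * (τ * m)                      ∎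

        member : ∀ {x} → x ∈ F → Rich F M bound ⊎ ∃[ D ] length D ≤ H₀ ^ σ * (τ * m) × (∀ a → Hits (proj₂ (proj₂ x)) a D)
        member {s , t , A} A∈F = Sum.map₂ (λ (D , D≤ , hits) → D , count D (proj₁ (dims A∈F)) D≤ , λ a → hits (∈-tuples a))
          (collect {R = λ a D → Hits A a D} (λ {a} → Hits-mono {A = A} {a}) (tuples r s) (τ * m) (λ {a} _ → rich-or-hit A∈F a))

      module _ (D : List (Fin n)) (D-small : e * length D ≤ n)
               (hits : ∀ {s t} {A : Matrix s t} → (s , t , A) ∈ F → ∀ a → Hits A a D) where

        Keep : Fin n → Set
        Keep j = Good j × ¬ j ∈ D

        keep? : ∀ j → Dec (Keep j)
        keep? j = good? j ×-dec ¬? (any? (j Fin.≟_) D)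

        Keep-most : e * ∑[ j ∈ allFin n ] ⟦ ¬? (keep? j) ⟧ ≤ 2 * n
        Keep-most = twice (≤-trans (∑-¬× good? (λ j → ¬? (any? (j Fin.≟_) D)) (allFin n)) (+-monoʳ-≤ _ D-count)) Good-most D-small
          where
          D-count : ∑[ j ∈ allFin n ] ⟦ ¬? (¬? (any? (j Fin.≟_) D)) ⟧ ≤ length D
          D-count = ≤-trans (∑-mono′ (allFin n) λ j → ⟦⟧-mono (¬? (¬? (any? (j Fin.≟_) D))) (any? (j Fin.≟_) D)
                               (decidable-stable (any? (j Fin.≟_) D)))
                            (∑-∈-list D)

        module _ (ρ : Fin n → Fin r) (g : Fin n → Fin n) (g-Keep : ∀ j → Keep (g j))
                 (g-mono : ∀ {j k} → j Fin.≤ k → g j Fin.≤ g k) where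

          -- A copy in the cleaned matrix names representatives for the rows of A and, through g, a
          -- weakly increasing sequence in the sets `Column A a`. That sequence must meet D, which g
          -- avoids.
          collapse-free : Free F (collapse M (λ i → reps (ρ i)) g)
          collapse-free {s} {t} A A∈F ((x , y) , _ , y-sorted , eq) =
            let k , k∈D = hits A∈F (Vec.map ρ x) z weak
            in proj₂ (g-Keep (lookup y k)) (subst (_∈ D) (Vec.lookup-map k g y) k∈D)
            where
            z : Vec (Fin n) t
            z = Vec.map g y
            a : Vec (Fin r) s
            a = Vec.map ρ x
            copy : submatrix M (Vec.map (λ i → reps (ρ i)) x) z ≡ A
            copy = trans (sym (submatrix-collapse M (λ i → reps (ρ i)) g x y)) eq
            column : ∀ k → Column A a k (lookup z k)
            column k = subst Good (sym (Vec.lookup-map k g y)) (proj₁ (g-Keep (lookup y k))) , λ i →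
              trans (cong (λ v → entry M v (lookup z k)) (trans (cong reps (Vec.lookup-map i ρ x)) (sym (Vec.lookup-map i _ x))))
                (trans (sym (lookup-submatrix M (Vec.map (λ i → reps (ρ i)) x) z i k)) (cong (λ B → entry B i k) copy))
            weak : Weakly 0 (Column A a) z
            weak = Linked⇒weakly z (Linked-map-mono g-mono y-sorted) column

        not-far : (∀ {i} → Y i → ∃[ a ] e * dist M i (reps a) ≤ 2 * n) →
                  ¬ (∀ N → Free F N → 8 * (n * n) ≤ e * #changes M N)
        not-far near far = <⇒≱ 6<8 (≤-trans
          (far (collapse M (λ i → reps (ρ i)) g) (collapse-free ρ g (proj₁ (proj₂ retract)) (proj₂ (proj₂ (proj₂ retract)))))
          (#changes-collapse M e (λ i → reps (ρ i)) g Y? keep? Y-most Keep-most ρ-near (proj₁ (proj₂ (proj₂ retract)))))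
          where
          6<8 : 6 * (n * n) < 8 * (n * n)
          6<8 = *-monoˡ-< (n * n) {{>-nonZero (*-pos 0<n 0<n)}} (s≤s (n≤1+n 6))
          retract : Σ[ g ∈ (Fin n → Fin n) ]
            ((∀ j → Keep (g j)) × (∀ j → Keep j → g j ≡ j) × (∀ {j k} → j Fin.≤ k → g j Fin.≤ g k))
          retract = retraction keep? (few-exceptions keep? 0<n 8≤e Keep-most)
          g = proj₁ retract
          representative : ∀ i → Dec (Y i) → ∃[ a ] (Y i → e * dist M i (reps a) ≤ 2 * n)
          representative i (yes y) = let a , h = near y in a , λ _ → h
          -- A sparse row receives an arbitrary representative, since all its entries are counted as
          -- changed anyway.
          representative i (no ¬y) = proj₁ (near (proj₂ (few-exceptions Y? 0<n 8≤e Y-most))) , λ y → contradiction y ¬y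
          ρ : Fin n → Fin r
          ρ i = proj₁ (representative i (Y? i))
          ρ-near : ∀ i → Y i → e * dist M i (reps (ρ i)) ≤ 2 * n
          ρ-near i = proj₂ (representative i (Y? i))

    far⇒rich : (∀ N → Free F N → 8 * (n * n) ≤ e * #changes M N) → Rich F M bound
    far⇒rich far =
      let r , reps , r≤H₀ , reps-Y , near = clusters M e H₀ Y? 0<n proj₁ in
      Sum.fromInj₁ (λ (D , D-small , hits) → ⊥-elim (not-far reps r≤H₀ reps-Y D D-small hits near far))
                   (rich-or-hit-all reps r≤H₀ reps-Y)

  -- Polynomial bounds

  #copies>0 : ∀ {n s t} {A : Matrix s t} (M : Matrix n n) → ∃[ rc ] IsCopy A M rc → 0 < #copies A M
  #copies>0 {n} {s} {t} {A} M ((x , z) , copy) = begin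
    1                                      ≡⟨ ⟦⟧-yes (isCopy? A M (x , z)) copy ⟨
    ⟦ isCopy? A M (x , z) ⟧                ≤⟨ ∑-∈ (λ rc → ⟦ isCopy? A M rc ⟧) (∈-cartesianProduct⁺ (∈-tuples x) (∈-tuples z)) ⟩
    ∑[ rc ∈ cartesianProduct (tuples n s) (tuples n t) ] ⟦ isCopy? A M rc ⟧
                                           ≡⟨ length-filter (isCopy? A M) (cartesianProduct (tuples n s) (tuples n t)) ⟨
    #copies A M                            ∎

  #changes-refl : ∀ {n} (M : Matrix n n) → #changes M M ≡ 0
  #changes-refl {n} M = n≤0⇒n≡0 (begin
    #changes M M
      ≡⟨ length-filter _ (cartesianProduct (allFin n) (allFin n)) ⟩
    ∑[ ij ∈ cartesianProduct (allFin n) (allFin n) ] ⟦ same? ij ⟧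
      ≤⟨ ∑-≤-const (cartesianProduct (allFin n) (allFin n)) (λ ij _ → ≤-reflexive (⟦⟧-no (same? ij) λ h → h refl)) ⟩
    length (cartesianProduct (allFin n) (allFin n)) * 0
      ≡⟨ *-zeroʳ (length (cartesianProduct (allFin n) (allFin n))) ⟩
    0 ∎)
    where
    same? : ∀ ((i , j) : Fin n × Fin n) → Dec (entry M i j ≢ entry M i j)
    same? (i , j) = ¬? (entry M i j Bool.≟ entry M i j)

  -- Otherwise M itself would be free, at the cost of no changes.
  far⇒copy : ∀ {n e F} (M : Matrix n n) → 0 < n → (∀ N → Free F N → 8 * (n * n) ≤ e * #changes M N) →
             ∃[ s ] ∃[ t ] Σ[ A ∈ Matrix s t ] ((s , t , A) ∈ F × 0 < #copies A M)
  far⇒copy {n} {e} {F} M 0<n far with any? (λ (s , t , A) → 0 <? #copies A M) F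
  ... | yes some = let (s , t , A) , A∈F , h = find some in s , t , A , A∈F , h
  ... | no  none = ⊥-elim (<⇒≱ (*-pos {8} (s≤s z≤n) (*-pos 0<n 0<n))
    (≤-trans (far M (λ A A∈F copy → none (lose A∈F (#copies>0 M copy))))
             (≤-reflexive (trans (cong (e *_) (#changes-refl M)) (*-zeroʳ e)))))

  module _ {s₀ t₀ : ℕ} {A₀ : Matrix s₀ t₀} {F : Family} (A₀∈F : (s₀ , t₀ , A₀) ∈ F)
           (closed : ClosedUnderRowPermutations F) {σ τ : ℕ} (0<τ : 0 < τ)
           (dims : ∀ {s t} {A : Matrix s t} → (s , t , A) ∈ F → s ≤ σ × t ≤ τ) where

    open Constants s₀ t₀ σ τ (length F)

    module _ {n e : ℕ} (M : Matrix n n) (0<n : 0 < n) (8≤e : 8 ≤ e)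
             (far : ∀ N → Free F N → 8 * (n * n) ≤ e * #changes M N) where

      private
        0<e : 0 < e
        0<e = ≤-trans (s≤s z≤n) 8≤e

        0<f : 0 < length F
        0<f = nonempty A₀∈F
          where
          nonempty : ∀ {x} {xs : Family} → x ∈ xs → 0 < length xs
          nonempty (here _)  = s≤s z≤n
          nonempty (there _) = s≤s z≤n

        0<G : 0 < G e
        0<G = *-pos 0<e (*-pos 0<f (*-pos (m^n>0 (H e e) {{>-nonZero (H-pos e 0<e)}} σ) 0<τ))

      -- For bounded n a single copy is enough: n^(s + t) is itself at most the constant.
      far⇒rich-small : n < n₀ e → Rich F M (n₀ e ^ (σ + τ))
      far⇒rich-small n<n₀ =
        let s , t , A , A∈F , copy = far⇒copy {e = e} M 0<n far
            s≤σ , t≤τ = dims A∈F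
        in s , t , A , A∈F , (begin
          n ^ (s + t)                        ≤⟨ ^-monoˡ-≤ (s + t) (<⇒≤ n<n₀) ⟩
          n₀ e ^ (s + t)                     ≤⟨ ^-mono-≤ (<-trans 0<n n<n₀) (+-mono-≤ s≤σ t≤τ) ⟩
          n₀ e ^ (σ + τ)                     ≤⟨ m≤m*n (n₀ e ^ (σ + τ)) (#copies A M) {{>-nonZero copy}} ⟩
          n₀ e ^ (σ + τ) * #copies A M       ∎)

      far⇒rich-large : n₀ e ≤ n → Rich F M (B e e + B (T₁ e) e + B₂ e)
      far⇒rich-large n₀≤n = Sum.[ level₁ , Rich-mono {M = M} (≤-trans (m≤m+n (B e e) (B (T₁ e) e)) (m≤m+n _ (B₂ e))) ]′
        (dense-or-rich′ M 0<n closed A₀∈F e e 0<e (≤-trans p₁ n₀≤n))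
        where
        p₃ : H e e * s₀ + H₁ e * s₀ + 2 * (2 * H₁ e) * σ ≤ n₀ e
        p₃ = m≤m+n _ (G e)
        p₂ : H e e * s₀ + H₁ e * s₀ ≤ n₀ e
        p₂ = ≤-trans (m≤m+n _ (2 * (2 * H₁ e) * σ)) p₃
        p₁ : H e e * s₀ ≤ n₀ e
        p₁ = ≤-trans (m≤m+n _ (H₁ e * s₀)) p₂

        0<T₁ : 0 < T₁ e
        0<T₁ = *-pos 0<e (*-pos (H-pos e 0<e) (*-pos {2} (s≤s z≤n) 0<τ))

        quotient : ∃[ m ] (G e * m ≤ n × n ≤ 2 * G e * m)
        quotient = quotient-bounds n (G e) {{>-nonZero 0<G}} (≤-trans (m≤n+m (G e) _) n₀≤n)

        clean : e * ∑[ i ∈ allFin n ] ⟦ ¬? (dense? M e (H e e) i) ⟧ ≤ n →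
                e * ∑[ i ∈ allFin n ] ⟦ ¬? (dense? M (T₁ e) (H₁ e) i) ⟧ ≤ n → Rich F M (B₂ e)
        clean dense₀ dense₁ = Cleaning.far⇒rich M 0<n closed 0<τ dims e (H e e) (H₁ e) (proj₁ quotient) 8≤e
          (H-pos e 0<e) (H-pos (T₁ e) 0<e) dense₀ dense₁ (≤-trans (m≤n+m _ (H e e * s₀ + H₁ e * s₀)) (≤-trans p₃ n₀≤n))
          0<G (proj₁ (proj₂ quotient)) (proj₂ (proj₂ quotient)) far

        level₁ : e * ∑[ i ∈ allFin n ] ⟦ ¬? (dense? M e (H e e) i) ⟧ ≤ n → Rich F M (B e e + B (T₁ e) e + B₂ e)
        level₁ dense₀ = Sum.[ (λ dense₁ → Rich-mono {M = M} (m≤n+m (B₂ e) (B e e + B (T₁ e) e)) (clean dense₀ dense₁))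
                            , Rich-mono {M = M} (≤-trans (m≤n+m (B (T₁ e) e) (B e e)) (m≤m+n _ (B₂ e))) ]′
          (dense-or-rich′ M 0<n closed A₀∈F (T₁ e) e 0<T₁ (≤-trans (≤-trans (m≤n+m (H₁ e * s₀) (H e e * s₀)) p₂) n₀≤n))

      far⇒rich : Rich F M (bound e)
      far⇒rich = Sum.[ (λ n<n₀ → Rich-mono {M = M} (m≤n+m (n₀ e ^ (σ + τ)) (B e e + B (T₁ e) e + B₂ e)) (far⇒rich-small n<n₀))
                     , (λ n₀≤n → Rich-mono {M = M} (m≤m+n (B e e + B (T₁ e) e + B₂ e) (n₀ e ^ (σ + τ))) (far⇒rich-large n₀≤n)) ]′ (<-≤-connex n (n₀ e))

  -- The base 1 + x is positive even at x = 0, so exponents can be raised when two bounds are added.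
  PolynomiallyBounded : (ℕ → ℕ) → Set
  PolynomiallyBounded f = ∃[ c ] ∃[ d ] ∀ x → f x ≤ c * suc x ^ d

  poly-const : ∀ c → PolynomiallyBounded (λ _ → c)
  poly-const c = c , 0 , λ _ → ≤-reflexive (sym (*-identityʳ c))

  poly-id : PolynomiallyBounded (λ x → x)
  poly-id = 1 , 1 , λ x → ≤-trans (n≤1+n x) (≤-reflexive (lemma x))
    where
    lemma : ∀ x → 1 + x ≡ 1 * ((1 + x) * 1)
    lemma = solve-∀

  poly-* : ∀ {f g} → PolynomiallyBounded f → PolynomiallyBounded g → PolynomiallyBounded (λ x → f x * g x)
  poly-* {f} {g} (c , d , hf) (c′ , d′ , hg) = c * c′ , d + d′ , λ x → begin
    f x * g x                                   ≤⟨ *-mono-≤ (hf x) (hg x) ⟩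
    c * suc x ^ d * (c′ * suc x ^ d′)           ≡⟨ lemma c (suc x ^ d) c′ (suc x ^ d′) ⟩
    c * c′ * (suc x ^ d * suc x ^ d′)           ≡⟨ cong (c * c′ *_) (^-distribˡ-+-* (suc x) d d′) ⟨
    c * c′ * suc x ^ (d + d′)                   ∎
    where
    lemma : ∀ a b c d → a * b * (c * d) ≡ a * c * (b * d)
    lemma = solve-∀

  poly-+ : ∀ {f g} → PolynomiallyBounded f → PolynomiallyBounded g → PolynomiallyBounded (λ x → f x + g x)
  poly-+ {f} {g} (c , d , hf) (c′ , d′ , hg) = c + c′ , d + d′ , λ x → begin
    f x + g x                                         ≤⟨ +-mono-≤ (hf x) (hg x) ⟩
    c * suc x ^ d + c′ * suc x ^ d′                   ≤⟨ +-mono-≤ (*-monoʳ-≤ c (^-monoʳ-≤ (suc x) (m≤m+n d d′)))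
                                                                  (*-monoʳ-≤ c′ (^-monoʳ-≤ (suc x) (m≤n+m d′ d))) ⟩
    c * suc x ^ (d + d′) + c′ * suc x ^ (d + d′)      ≡⟨ *-distribʳ-+ (suc x ^ (d + d′)) c c′ ⟨
    (c + c′) * suc x ^ (d + d′)                       ∎

  poly-^ : ∀ {f} → PolynomiallyBounded f → ∀ k → PolynomiallyBounded (λ x → f x ^ k)
  poly-^ pf zero    = poly-const 1
  poly-^ pf (suc k) = poly-* pf (poly-^ pf k)

  module _ (s₀ t₀ σ τ f : ℕ) where
    open Constants s₀ t₀ σ τ f

    module _ {T : ℕ → ℕ} (T-poly : PolynomiallyBounded T) where

      private
        c-poly : PolynomiallyBounded (λ e → suc (q (T e) e) ^ t₀)
        c-poly = poly-^ (poly-+ (poly-const 1) (poly-* T-poly (poly-* (poly-const (suc (4 * t₀)))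
          (poly-+ (poly-* (poly-const 16) (poly-* poly-id poly-id)) (poly-* T-poly (poly-const (suc (4 * t₀)))))))) t₀

      H-poly : PolynomiallyBounded (λ e → H (T e) e)
      H-poly = poly-* (poly-const 2) (poly-* (poly-* (poly-const 2) poly-id) c-poly)

      B-poly : PolynomiallyBounded (λ e → B (T e) e)
      B-poly = poly-* (poly-* (poly-const (2 * t₀ !)) c-poly) (poly-* (poly-^ H-poly s₀) (poly-const (s₀ !)))

    bound-poly : PolynomiallyBounded bound
    bound-poly = poly-+ (poly-+ (poly-+ (B-poly poly-id) (B-poly T₁-poly)) B₂-poly) (poly-^ n₀-poly (σ + τ))
      where
      T₁-poly : PolynomiallyBounded T₁
      T₁-poly = poly-* poly-id (poly-* (H-poly poly-id) (poly-const (2 * τ)))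
      H₁-poly : PolynomiallyBounded H₁
      H₁-poly = H-poly T₁-poly
      4H₁-poly : PolynomiallyBounded (λ e → 2 * (2 * H₁ e))
      4H₁-poly = poly-* (poly-const 2) (poly-* (poly-const 2) H₁-poly)
      G-poly : PolynomiallyBounded G
      G-poly = poly-* poly-id (poly-* (poly-const f) (poly-* (poly-^ (H-poly poly-id) σ) (poly-const τ)))
      B₂-poly : PolynomiallyBounded B₂
      B₂-poly = poly-* (poly-^ (poly-* (poly-const 2) G-poly) τ) (poly-* (poly-^ 4H₁-poly σ) (poly-const (σ !)))
      n₀-poly : PolynomiallyBounded n₀
      n₀-poly = poly-+ (poly-+ (poly-+ (poly-* (H-poly poly-id) (poly-const s₀)) (poly-* H₁-poly (poly-const s₀)))
                               (poly-* 4H₁-poly (poly-const σ))) G-poly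

  theorem-ℕ : ∀ F → ClosedUnderRowPermutations F → ∃[ c ] ∃[ d ] (∀ E n (M : Matrix n n) → 0 < E → 0 < n →
              (∀ N → Free F N → n * n ≤ E * #changes M N) → Rich F M (c * E ^ d))
  -- Every matrix is free of the empty family, so M with no changes contradicts farness.
  theorem-ℕ [] closed = 0 , 0 , λ E n M 0<E 0<n far → ⊥-elim (<⇒≱ (*-pos 0<n 0<n)
    (≤-trans (far M λ _ ()) (≤-reflexive (trans (cong (E *_) (#changes-refl M)) (*-zeroʳ E)))))
  -- The argument runs with e = 8E, and 9^d comes from 8E + 1 ≤ 9E.
  theorem-ℕ F@((s₀ , t₀ , A₀) ∷ _) closed = c * 9 ^ d , d , λ E n M 0<E 0<n far →
    Rich-mono {M = M} (bound≤ E 0<E) (far⇒rich (here refl) closed (s≤s z≤n) dims M 0<n (*-monoʳ-≤ 8 0<E)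
      λ N free → ≤-trans (*-monoʳ-≤ 8 (far N free)) (≤-reflexive (sym (*-assoc 8 E (#changes M N)))))
    where
    σ τ : ℕ
    σ = ∑[ x ∈ F ] proj₁ x
    -- The successor keeps τ positive even if no member of the family has a column.
    τ = suc (∑[ x ∈ F ] proj₁ (proj₂ x))
    dims : ∀ {s t} {A : Matrix s t} → (s , t , A) ∈ F → s ≤ σ × t ≤ τ
    dims A∈F = ∑-∈ proj₁ A∈F , ≤-trans (∑-∈ (λ x → proj₁ (proj₂ x)) A∈F) (n≤1+n _)
    open Constants s₀ t₀ σ τ (length F) using (bound)
    c = proj₁ (bound-poly s₀ t₀ σ τ (length F))
    d = proj₁ (proj₂ (bound-poly s₀ t₀ σ τ (length F)))
    bound≤ : ∀ E → 0 < E → bound (8 * E) ≤ c * 9 ^ d * E ^ d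
    bound≤ E 0<E = begin
      bound (8 * E)            ≤⟨ proj₂ (proj₂ (bound-poly s₀ t₀ σ τ (length F))) (8 * E) ⟩
      c * suc (8 * E) ^ d      ≤⟨ *-monoʳ-≤ c (^-monoˡ-≤ d (+-monoˡ-≤ (8 * E) 0<E)) ⟩
      c * (9 * E) ^ d          ≡⟨ cong (c *_) (^-distribʳ-* d 9 E) ⟩
      c * (9 ^ d * E ^ d)      ≡⟨ *-assoc c (9 ^ d) (E ^ d) ⟨
      c * 9 ^ d * E ^ d        ∎

-- Rational arithmetic

open import Data.Integer as ℤ using (+_)
import Data.Integer.Properties as ℤ
open import Data.List using ([]; _∷_)
open import Data.List.Membership.Propositional using (_∈_)
open import Data.Nat as ℕ using (ℕ; zero; suc; NonZero; _+_; _^_; z≤n; s≤s)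
open import Data.Nat.Coprimality as Coprime using (1-coprimeTo)
import Data.Nat.DivMod as ℕ
import Data.Nat.Properties as ℕ
open import Data.Product using (Σ-syntax; ∃-syntax; _×_; _,_; proj₁; proj₂)
open import Data.Rational as ℚ using (ℚ; mkℚ; Positive; NonNegative; 0ℚ; 1ℚ; _*_; _≤_; *≤*; positive; nonNegative)
import Data.Rational.Properties as ℚ
open import Data.Rational.Solver using (module +-*-Solver)
open import Relation.Binary.PropositionalEquality using (_≡_; refl; sym; trans; cong; cong₂; subst; subst₂)
open import Defs
open NaturalBound using (Rich; theorem-ℕ)

-- `+ k / 1` is blocked on a gcd for variable k; in normalised form, comparisons and products
-- compute.
toℚ-mkℚ : ∀ k → toℚ k ≡ mkℚ (+ k) 0 (Coprime.sym (1-coprimeTo k))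
toℚ-mkℚ k = ℚ.↥p/↧p≡p (mkℚ (+ k) 0 (Coprime.sym (1-coprimeTo k)))

toℚ-mono : ∀ {a b} → a ℕ.≤ b → toℚ a ≤ toℚ b
toℚ-mono {a} {b} a≤b = subst₂ _≤_ (sym (toℚ-mkℚ a)) (sym (toℚ-mkℚ b)) (*≤* (ℤ.*-monoʳ-≤-nonNeg (+ 1) (ℤ.+≤+ a≤b)))

toℚ-cancel : ∀ {a b} → toℚ a ≤ toℚ b → a ℕ.≤ b
toℚ-cancel {a} {b} h with subst₂ _≤_ (toℚ-mkℚ a) (toℚ-mkℚ b) h
... | *≤* le = ℤ.drop‿+≤+ (subst₂ ℤ._≤_ (ℤ.*-identityʳ (+ a)) (ℤ.*-identityʳ (+ b)) le)

toℚ-* : ∀ a b → toℚ (a ℕ.* b) ≡ toℚ a * toℚ b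
toℚ-* a b = trans (cong (ℚ._/ 1) (ℤ.pos-* a b)) (sym (cong₂ _*_ (toℚ-mkℚ a) (toℚ-mkℚ b)))

toℚ-suc : ∀ a → toℚ (suc a) ≡ 1ℚ ℚ.+ toℚ a
toℚ-suc a = sym (trans (cong (1ℚ ℚ.+_) (toℚ-mkℚ a)) (cong (λ m → (+ 1 ℤ.+ m) ℚ./ 1) (ℤ.*-identityʳ (+ a))))

toℚ-nonNeg : ∀ a → NonNegative (toℚ a)
toℚ-nonNeg a = nonNegative (toℚ-mono {0} {a} z≤n)

-- The floor of x plus one serves as an integer upper bound. The estimate 1 + x is what lets powers
-- of E be dominated by powers of 1 + x.
ceiling : ∀ x .{{_ : Positive x}} → ∃[ E ] (0 ℕ.< E × x ≤ toℚ E × toℚ E ≤ 1ℚ ℚ.+ x)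
ceiling x@(mkℚ (+ a) d-1 c) = suc k , s≤s z≤n , x≤E , E≤1+x
  where
  d k : ℕ
  d = suc d-1
  k = a ℕ./ d
  x≤E : x ≤ toℚ (suc k)
  x≤E = subst (x ≤_) (sym (toℚ-mkℚ (suc k))) (*≤* (subst₂ ℤ._≤_ (sym (ℤ.*-identityʳ (+ a))) (ℤ.pos-* (suc k) d)
    (ℤ.+≤+ (subst (ℕ._≤ suc k ℕ.* d) (sym (ℕ.m≡m%n+[m/n]*n a d)) (ℕ.+-monoˡ-≤ (k ℕ.* d) (ℕ.<⇒≤ (ℕ.m%n<n a d)))))))
  k≤x : toℚ k ≤ x
  k≤x = subst (_≤ x) (sym (toℚ-mkℚ k)) (*≤* (subst₂ ℤ._≤_ (ℤ.pos-* k d) (sym (ℤ.*-identityʳ (+ a)))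
    (ℤ.+≤+ (ℕ.m/n*n≤m a d))))
  E≤1+x : toℚ (suc k) ≤ 1ℚ ℚ.+ x
  E≤1+x = subst (_≤ 1ℚ ℚ.+ x) (sym (toℚ-suc k)) (ℚ.+-monoʳ-≤ 1ℚ k≤x)

-- Here c is the coefficient carried over from the preceding degree, so the result represents c + (1
-- + x) p(x).
timesOnePlusX : ℚ → Polynomial → Polynomial
timesOnePlusX c []      = c ∷ []
timesOnePlusX c (a ∷ p) = (c ℚ.+ a) ∷ timesOnePlusX a p

eval-timesOnePlusX : ∀ c p x → eval (timesOnePlusX c p) x ≡ c ℚ.+ (1ℚ ℚ.+ x) * eval p x
eval-timesOnePlusX c [] x =
  solve 2 (λ c x → c :+ x :* con 0ℚ := c :+ (con 1ℚ :+ x) :* con 0ℚ) refl c x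
  where open +-*-Solver
eval-timesOnePlusX c (a ∷ p) x = trans (cong (λ v → c ℚ.+ a ℚ.+ x * v) (eval-timesOnePlusX a p x))
  (solve 4 (λ c a x v → c :+ a :+ x :* (a :+ (con 1ℚ :+ x) :* v) := c :+ (con 1ℚ :+ x) :* (a :+ x :* v))
     refl c a x (eval p x))
  where open +-*-Solver

power : ℕ → ℕ → Polynomial
power c zero    = toℚ c ∷ []
power c (suc d) = timesOnePlusX 0ℚ (power c d)

eval-power : ∀ c d {E x} → 0ℚ ≤ x → toℚ E ≤ 1ℚ ℚ.+ x → toℚ (c ℕ.* E ^ d) ≤ eval (power c d) x
eval-power c zero {x = x} _ _ = ℚ.≤-reflexive (trans (cong toℚ (ℕ.*-identityʳ c))
  (solve 2 (λ c x → c := c :+ x :* con 0ℚ) refl (toℚ c) x))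
  where open +-*-Solver
eval-power c (suc d) {E} {x} 0≤x E≤ = begin
  toℚ (c ℕ.* (E ℕ.* E ^ d))                ≡⟨ cong toℚ (trans (sym (ℕ.*-assoc c E (E ^ d)))
                                                (trans (cong (ℕ._* E ^ d) (ℕ.*-comm c E)) (ℕ.*-assoc E c (E ^ d)))) ⟩
  toℚ (E ℕ.* (c ℕ.* E ^ d))                ≡⟨ toℚ-* E (c ℕ.* E ^ d) ⟩
  toℚ E * toℚ (c ℕ.* E ^ d)                ≤⟨ ℚ.*-monoʳ-≤-nonNeg (toℚ (c ℕ.* E ^ d)) {{toℚ-nonNeg (c ℕ.* E ^ d)}} E≤ ⟩
  (1ℚ ℚ.+ x) * toℚ (c ℕ.* E ^ d)           ≤⟨ ℚ.*-monoˡ-≤-nonNeg (1ℚ ℚ.+ x) {{nonNeg}} (eval-power c d 0≤x E≤) ⟩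
  (1ℚ ℚ.+ x) * eval (power c d) x          ≡⟨ ℚ.+-identityˡ _ ⟨
  0ℚ ℚ.+ (1ℚ ℚ.+ x) * eval (power c d) x   ≡⟨ eval-timesOnePlusX 0ℚ (power c d) x ⟨
  eval (timesOnePlusX 0ℚ (power c d)) x    ∎
  where
  open ℚ.≤-Reasoning
  nonNeg : NonNegative (1ℚ ℚ.+ x)
  nonNeg = nonNegative (ℚ.≤-trans (toℚ-mono {0} {E} z≤n) E≤)

theorem1p5 : (F : Family) → ClosedUnderRowPermutations F →
    Σ[ p ∈ Polynomial ]
    ((ε : ℚ) → .{{_ : Positive ε}} →
    Σ[ p>0 ∈ Positive (eval p (inverse ε)) ]
    (let δ = inverse (eval p (inverse ε)) {{p>0}} in
    (n : ℕ) → .{{_ : NonZero n}} → (M : Matrix n n) → Far ε F M →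
    ∃[ s ] ∃[ t ] Σ[ A ∈ Matrix s t ]
    ((s , t , A) ∈ F × δ * toℚ (n ^ (s + t)) ≤ toℚ (#copies A M))))
-- The polynomial is (c + 1) (1 + x)^d; `suc c` keeps its value positive when c is 0, as it is for
-- the empty family.
theorem1p5 F closed = power (suc c) d , λ ε → P>0 ε , λ n M far →
  let s , t , A , A∈F , many = rich ε n M far
  in s , t , A , A∈F , conclude ε (n ^ (s + t)) (#copies A M) many
  where
  c = proj₁ (theorem-ℕ F closed)
  d = proj₁ (proj₂ (theorem-ℕ F closed))

  module _ (ε : ℚ) .{{ε>0 : Positive ε}} where
    open ℚ.≤-Reasoning

    x P : ℚ
    x = inverse ε
    P = eval (power (suc c) d) x

    instance
      x>0 : Positive x
      x>0 = ℚ.1/pos⇒pos ε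

    E : ℕ
    E = proj₁ (ceiling x)

    0<E : 0 ℕ.< E
    0<E = proj₁ (proj₂ (ceiling x))

    cE^d≤P : toℚ (suc c ℕ.* E ^ d) ≤ P
    cE^d≤P = eval-power (suc c) d (ℚ.<⇒≤ (ℚ.positive⁻¹ x)) (proj₂ (proj₂ (proj₂ (ceiling x))))

    P>0 : Positive P
    P>0 = positive (ℚ.<-≤-trans (ℚ.positive⁻¹ 1ℚ) (ℚ.≤-trans
      (toℚ-mono {1} (ℕ.*-mono-≤ {1} {suc c} (s≤s z≤n) (ℕ.m^n>0 E {{ℕ.>-nonZero 0<E}} d))) cE^d≤P))

    rich : ∀ n .{{_ : NonZero n}} (M : Matrix n n) → Far ε F M → Rich F M (c ℕ.* E ^ d)
    rich n M far = proj₂ (proj₂ (theorem-ℕ F closed)) E n M 0<E (ℕ.>-nonZero⁻¹ n) λ N free → toℚ-cancel (begin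
      toℚ (n ℕ.* n)               ≡⟨ cong (λ m → toℚ (n ℕ.* m)) (ℕ.*-identityʳ n) ⟨
      toℚ (n ^ 2)                 ≡⟨ ℚ.*-identityˡ (toℚ (n ^ 2)) ⟨
      1ℚ * toℚ (n ^ 2)            ≡⟨ cong (_* toℚ (n ^ 2)) (ℚ.*-inverseˡ ε {{ℚ.pos⇒nonZero ε}}) ⟨
      x * ε * toℚ (n ^ 2)         ≡⟨ ℚ.*-assoc x ε (toℚ (n ^ 2)) ⟩
      x * (ε * toℚ (n ^ 2))       ≤⟨ ℚ.*-monoˡ-≤-nonNeg x {{ℚ.pos⇒nonNeg x}} (far N free) ⟩
      x * toℚ (#changes M N)      ≤⟨ ℚ.*-monoʳ-≤-nonNeg (toℚ (#changes M N)) {{toℚ-nonNeg (#changes M N)}} (proj₁ (proj₂ (proj₂ (ceiling x)))) ⟩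
      toℚ E * toℚ (#changes M N)  ≡⟨ toℚ-* E (#changes M N) ⟨
      toℚ (E ℕ.* #changes M N)    ∎)

    conclude : ∀ a b → a ℕ.≤ c ℕ.* E ^ d ℕ.* b → inverse P {{P>0}} * toℚ a ≤ toℚ b
    conclude a b a≤ = begin
      δ * toℚ a                         ≤⟨ ℚ.*-monoˡ-≤-nonNeg δ {{δ≥0}} (toℚ-mono a≤) ⟩
      δ * toℚ (c ℕ.* E ^ d ℕ.* b)       ≡⟨ cong (δ *_) (toℚ-* (c ℕ.* E ^ d) b) ⟩
      δ * (toℚ (c ℕ.* E ^ d) * toℚ b)   ≤⟨ ℚ.*-monoˡ-≤-nonNeg δ {{δ≥0}} (ℚ.*-monoʳ-≤-nonNeg (toℚ b) {{toℚ-nonNeg b}}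
                                             (ℚ.≤-trans (toℚ-mono (ℕ.*-monoˡ-≤ (E ^ d) (ℕ.n≤1+n c))) cE^d≤P)) ⟩
      δ * (P * toℚ b)                   ≡⟨ ℚ.*-assoc δ P (toℚ b) ⟨
      δ * P * toℚ b                     ≡⟨ cong (_* toℚ b) (ℚ.*-inverseˡ P {{ℚ.pos⇒nonZero P {{P>0}}}}) ⟩
      1ℚ * toℚ b                        ≡⟨ ℚ.*-identityˡ (toℚ b) ⟩
      toℚ b                             ∎
      where
      δ = inverse P {{P>0}}
      δ≥0 : NonNegative δ
      δ≥0 = ℚ.pos⇒nonNeg δ {{ℚ.1/pos⇒pos P {{P>0}}}}
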